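{- Let $\alpha,\beta\geq 1$ be natural numbers, let $p$ be a prime number, and let $n\geq 2$ be an integer with prime factorization $n=\prod_{i=1}^r p_i^{a_i}$, where $p_1,\dots,p_r$ are distinct primes and $a_i$ are positive integers, such that $\gcd(n,p)=1$. Then: i) If $\alpha\geq\beta\geq\Omega(n)e^{ -H(n)}$, then $H(np^\alpha)\leq H(np^\beta)$. ii) If $\beta\leq\alpha\leq\Omega(n)e^{ -H(n)}$, then $H(np^\alpha)\geq H(np^\beta)$.
   Context: $\log$ is the natural logarithm. For an integer $N=p_1^{\alpha_1}\cdots p_r^{\alpha_r}\geq 2$ (distinct primes $p_i$, exponents $\alpha_i\geq 1$), $\Omega(N)=\alpha_1+\dots+\alpha_r$ and the entropy of $N$ is $$H(N)=-\sum_{i=1}^r\frac{\alpha_i}{\Omega(N)}\log\frac{\alpha_i}{\Omega(N)}.$$ -}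

module Defs where

open import Data.Nat as ℕ using (ℕ; zero; suc; _!; NonZero; z≤n; s≤s)
import Data.Nat.Properties as ℕₚ
open import Data.Nat.Primality.Factorisation using (factorise; factors)
open import Data.Integer as ℤ using (+_)
import Data.Integer.Properties as ℤₚ
open import Data.Rational
  using (ℚ; 0ℚ; 1ℚ; ½; _+_; _*_; _-_; -_; ∣_∣; _/_; _÷_; 1/_; _≤_; _<_; Positive; NonNegative; positive; nonNegative; mkℚ; *≤*; *<*; toℚᵘ)
open import Data.Rational.Base using (+-*-rawSemiring)
open import Data.Rational.Properties
import Data.Rational.Unnormalised as ℚᵘ
import Data.Rational.Unnormalised.Properties as ℚᵘₚ
open import Data.Rational.Solver using (module +-*-Solver)
open import Data.List using (List; []; _∷_; length; map; filter; foldr; deduplicate)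
open import Data.Product using (∃; _×_; _,_; proj₁; proj₂)
open import Data.Sum using (inj₁; inj₂)
open import Function using (_∘_)
open import Algebra.Definitions.RawSemiring +-*-rawSemiring using (_^_)
open import Relation.Nullary using (yes; no)
open import Relation.Binary.PropositionalEquality

Cauchy : (ℕ → ℚ) → Set
Cauchy x = ∀ ε → 0ℚ < ε → ∃ λ N → ∀ m n → N ℕ.≤ m → N ℕ.≤ n → ∣ x m - x n ∣ ≤ ε

-- Real numbers are represented by Cauchy sequences of rationals; two
-- representatives x, y denote the same real exactly when x ≤ᴿ y and y ≤ᴿ x.
record ℝ : Set where
  constructor mkℝ
  field
    seq    : ℕ → ℚ
    cauchy : Cauchy seq
open ℝ public

infix 4 _≤ᴿ_ _≥ᴿ_
_≤ᴿ_ _≥ᴿ_ : ℝ → ℝ → Set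
x ≤ᴿ y = ∀ ε → 0ℚ < ε → ∃ λ N → ∀ n → N ℕ.≤ n → seq x n ≤ seq y n + ε
x ≥ᴿ y = y ≤ᴿ x

Σ< : ℕ → (ℕ → ℚ) → ℚ
Σ< zero    t = 0ℚ
Σ< (suc n) t = Σ< n t + t n

expTerm : ℚ → ℕ → ℚ
expTerm u k = u ^ k * ((+ 1 / (k !)) {{k ℕₚ.!≢0}})

artanhTerm : ℚ → ℕ → ℚ
artanhTerm z k = z ^ suc (2 ℕ.* k) * (+ 1 / suc (2 ℕ.* k))

-- Estimates showing that the sequences used for the real operations, exp and
-- artanh below are Cauchy.
module Convergence where
  open ≤-Reasoning
  open +-*-Solver using (solve; _:=_; _:+_; _:*_; _:-_; :-_; con)

  opaque
    ι : ℕ → ℚ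
    ι n = + n / 1

  to-/ : ∀ i n .{{_ : NonZero n}} → toℚᵘ (i / n) ℚᵘ.≃ (i ℚᵘ./ n)
  to-/ i (suc d) = toℚᵘ-fromℚᵘ (ℚᵘ.mkℚᵘ i d)

  opaque
    unfolding ι

    ι-1 : ι 1 ≡ 1ℚ
    ι-1 = refl

    ι-0 : ι 0 ≡ 0ℚ
    ι-0 = refl

    ι-suc-pos : ∀ n → 0ℚ < ι (suc n)
    ι-suc-pos n = positive⁻¹ (+ suc n / 1) {{normalize-pos (suc n) 1}}

    ι-mono : ∀ {m n} → m ℕ.≤ n → ι m ≤ ι n
    ι-mono {m} {n} m≤n = toℚᵘ-cancel-≤
      (ℚᵘₚ.≤-respˡ-≃ (ℚᵘₚ.≃-sym (to-/ (+ m) 1))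
        (ℚᵘₚ.≤-respʳ-≃ (ℚᵘₚ.≃-sym (to-/ (+ n) 1))
          (ℚᵘ.*≤* (ℤₚ.*-monoʳ-≤-nonNeg (+ 1) (ℤ.+≤+ m≤n)))))

    ι-* : ∀ m n → ι (m ℕ.* n) ≡ ι m * ι n
    ι-* m n = toℚᵘ-injective (ℚᵘₚ.≃-trans (to-/ (+ (m ℕ.* n)) 1)
      (ℚᵘₚ.≃-trans (ℚᵘ.*≡* (cong (ℤ._* + 1) (ℤₚ.pos-* m n)))
        (ℚᵘₚ.≃-sym (ℚᵘₚ.≃-trans (toℚᵘ-homo-* (ι m) (ι n))
          (ℚᵘₚ.*-cong (to-/ (+ m) 1) (to-/ (+ n) 1))))))

    ι-+ : ∀ m n → ι (m ℕ.+ n) ≡ ι m + ι n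
    ι-+ m n = toℚᵘ-injective (ℚᵘₚ.≃-trans (to-/ (+ (m ℕ.+ n)) 1)
      (ℚᵘₚ.≃-trans (ℚᵘ.*≡* (cong (ℤ._* + 1) (sym (cong₂ ℤ._+_ (ℤₚ.*-identityʳ (+ m)) (ℤₚ.*-identityʳ (+ n))))))
        (ℚᵘₚ.≃-sym (ℚᵘₚ.≃-trans (toℚᵘ-homo-+ (ι m) (ι n))
          (ℚᵘₚ.+-cong (to-/ (+ m) 1) (to-/ (+ n) 1))))))

    ι-/ : ∀ n .{{_ : NonZero n}} → ι n * (+ 1 / n) ≡ 1ℚ
    ι-/ n@(suc d) = toℚᵘ-injective (ℚᵘₚ.≃-trans (toℚᵘ-homo-* (ι n) (+ 1 / n))
      (ℚᵘₚ.≃-trans (ℚᵘₚ.*-cong (to-/ (+ n) 1) (to-/ (+ 1) n))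
        (ℚᵘ.*≡* (trans (ℤₚ.*-identityʳ _) (trans (ℤₚ.*-identityʳ _)
           (sym (trans (ℤₚ.*-identityˡ _) (cong (λ k → + suc k) (ℕₚ.+-identityʳ d)))))))))

  0≤1/ : ∀ n .{{_ : NonZero n}} → 0ℚ ≤ + 1 / n
  0≤1/ n = nonNegative⁻¹ (+ 1 / n) {{normalize-nonNeg 1 n}}

  1/≤1 : ∀ n .{{_ : NonZero n}} → + 1 / n ≤ 1ℚ
  1/≤1 n@(suc _) = begin
    + 1 / n         ≡⟨ *-identityˡ _ ⟨
    1ℚ * (+ 1 / n)  ≤⟨ *-monoʳ-≤-nonNeg (+ 1 / n) {{normalize-nonNeg 1 n}} (≤-trans (≤-reflexive (sym ι-1)) (ι-mono {1} {n} (s≤s z≤n))) ⟩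
    ι n * (+ 1 / n) ≡⟨ ι-/ n ⟩
    1ℚ ∎

  0≤ι : ∀ n → 0ℚ ≤ ι n
  0≤ι n = subst (_≤ ι n) ι-0 (ι-mono {0} {n} z≤n)

  *-mono : ∀ {a b c d} → 0ℚ ≤ a → 0ℚ ≤ d → a ≤ b → c ≤ d → a * c ≤ b * d
  *-mono {a} {b} {c} {d} 0≤a 0≤d a≤b c≤d = begin
    a * c ≤⟨ *-monoˡ-≤-nonNeg a {{nonNegative 0≤a}} c≤d ⟩
    a * d ≤⟨ *-monoʳ-≤-nonNeg d {{nonNegative 0≤d}} a≤b ⟩
    b * d ∎

  *-monoˡ : ∀ {a b c} → 0ℚ ≤ c → a ≤ b → c * a ≤ c * b
  *-monoˡ {c = c} 0≤c = *-monoˡ-≤-nonNeg c {{nonNegative 0≤c}}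

  *-monoʳ : ∀ {a b c} → 0ℚ ≤ c → a ≤ b → a * c ≤ b * c
  *-monoʳ {c = c} 0≤c = *-monoʳ-≤-nonNeg c {{nonNegative 0≤c}}

  0≤* : ∀ {a b} → 0ℚ ≤ a → 0ℚ ≤ b → 0ℚ ≤ a * b
  0≤* {a} {b} 0≤a 0≤b = begin
    0ℚ     ≡⟨ *-zeroʳ a ⟨
    a * 0ℚ ≤⟨ *-monoˡ 0≤a 0≤b ⟩
    a * b  ∎

  0<* : ∀ {a b} → 0ℚ < a → 0ℚ < b → 0ℚ < a * b
  0<* {a} {b} 0<a 0<b =
    positive⁻¹ (a * b) {{pos*pos⇒pos a {{positive 0<a}} b {{positive 0<b}}}}

  ≤-diff : ∀ {a b} → a ≤ b → 0ℚ ≤ b - a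
  ≤-diff {a} {b} a≤b = begin
    0ℚ    ≡⟨ +-inverseʳ a ⟨
    a - a ≤⟨ +-monoˡ-≤ (- a) a≤b ⟩
    b - a ∎

  0≤1ℚ : 0ℚ ≤ 1ℚ
  0≤1ℚ = nonNegative⁻¹ 1ℚ

  0≤^ : ∀ {r} n → 0ℚ ≤ r → 0ℚ ≤ r ^ n
  0≤^ zero    0≤r = 0≤1ℚ
  0≤^ (suc n) 0≤r = 0≤* 0≤r (0≤^ n 0≤r)

  ∣^∣ : ∀ u n → ∣ u ^ n ∣ ≡ ∣ u ∣ ^ n
  ∣^∣ u zero    = refl
  ∣^∣ u (suc n) = trans (∣p*q∣≡∣p∣*∣q∣ u (u ^ n)) (cong (∣ u ∣ *_) (∣^∣ u n))

  ^-mono : ∀ {a b} n → 0ℚ ≤ a → a ≤ b → a ^ n ≤ b ^ n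
  ^-mono zero    0≤a a≤b = ≤-refl
  ^-mono (suc n) 0≤a a≤b = *-mono 0≤a (0≤^ n (≤-trans 0≤a a≤b)) a≤b (^-mono n 0≤a a≤b)

  ^-anti : ∀ {r} m n → 0ℚ ≤ r → r ≤ 1ℚ → r ^ (m ℕ.+ n) ≤ r ^ n
  ^-anti zero n 0≤r r≤1 = ≤-refl
  ^-anti {r} (suc m) n 0≤r r≤1 = begin
    r * r ^ (m ℕ.+ n)  ≤⟨ *-monoʳ (0≤^ (m ℕ.+ n) 0≤r) r≤1 ⟩
    1ℚ * r ^ (m ℕ.+ n) ≡⟨ *-identityˡ _ ⟩
    r ^ (m ℕ.+ n)      ≤⟨ ^-anti m n 0≤r r≤1 ⟩
    r ^ n              ∎

  ι-^ : ∀ b k → ι (b ℕ.^ k) ≡ ι b ^ k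
  ι-^ b zero    = ι-1
  ι-^ b (suc k) = trans (ι-* b (b ℕ.^ k)) (cong (ι b *_) (ι-^ b k))

  tri : ∀ a b c → ∣ a - c ∣ ≤ ∣ a - b ∣ + ∣ b - c ∣
  tri a b c = begin
    ∣ a - c ∣             ≡⟨ cong ∣_∣ (solve 3 (λ a b c → a :- c := (a :- b) :+ (b :- c)) refl a b c) ⟩
    ∣ (a - b) + (b - c) ∣ ≤⟨ ∣p+q∣≤∣p∣+∣q∣ (a - b) (b - c) ⟩
    ∣ a - b ∣ + ∣ b - c ∣ ∎

  ∣-∣-sym : ∀ a b → ∣ a - b ∣ ≡ ∣ b - a ∣
  ∣-∣-sym a b = trans (cong ∣_∣ (solve 2 (λ a b → a :- b := :- (b :- a)) refl a b)) (∣-p∣≡∣p∣ (b - a))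

  _CloseBy_ : (ℕ → ℚ) → ℚ → Set
  x CloseBy C = ∀ ε → 0ℚ < ε → ∃ λ N → ∀ m n → N ℕ.≤ m → N ℕ.≤ n → ∣ x m - x n ∣ ≤ C * ε

  rescale : ∀ {ε C} → 0ℚ < ε → 0ℚ < C → ∃ λ δ → 0ℚ < δ × C * δ ≡ ε
  rescale {ε} {C} 0<ε 0<C = 1/C * ε ,
      0<* (positive⁻¹ 1/C {{1/pos⇒pos C}}) 0<ε ,
      trans (sym (*-assoc C 1/C ε)) (trans (cong (_* ε) (*-inverseʳ C)) (*-identityˡ ε))
    where
    instance
      C-pos : Positive C
      C-pos = positive 0<C
      C-nz : Data.Rational.NonZero C
      C-nz = pos⇒nonZero C
    1/C : ℚ
    1/C = 1/ C

  close⇒cauchy : ∀ x C → 0ℚ < C → x CloseBy C → Cauchy x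
  close⇒cauchy x C 0<C h ε 0<ε with rescale 0<ε 0<C
  ... | δ , 0<δ , refl = h δ 0<δ

  ⊔-≤ˡ : ∀ {M N n} → M ℕ.⊔ N ℕ.≤ n → M ℕ.≤ n
  ⊔-≤ˡ {M} {N} = ℕₚ.≤-trans (ℕₚ.m≤m⊔n M N)
  ⊔-≤ʳ : ∀ {M N n} → M ℕ.⊔ N ℕ.≤ n → N ℕ.≤ n
  ⊔-≤ʳ {M} {N} = ℕₚ.≤-trans (ℕₚ.m≤n⊔m M N)

  0<1 : 0ℚ < 1ℚ
  0<1 = positive⁻¹ 1ℚ

  archimedean : ∀ ε → 0ℚ < ε → ∃ λ N → 1ℚ ≤ ι N * ε
  archimedean ε@(mkℚ (+ suc a) d-1 c) 0<ε = suc d-1 , (begin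
    1ℚ                        ≡⟨ ι-/ (suc d-1) ⟨
    ι (suc d-1) * (+ 1 / suc d-1) ≤⟨ *-monoˡ (0≤ι (suc d-1)) 1/d≤ε ⟩
    ι (suc d-1) * ε           ∎)
    where
    1/d≤ε : + 1 / suc d-1 ≤ ε
    1/d≤ε = toℚᵘ-cancel-≤ (ℚᵘₚ.≤-respˡ-≃ (ℚᵘₚ.≃-sym (to-/ (+ 1) (suc d-1)))
      (ℚᵘ.*≤* (ℤₚ.*-monoʳ-≤-nonNeg (+ suc d-1) {+ 1} {+ suc a} (ℤ.+≤+ (s≤s z≤n)))))
  archimedean (mkℚ (+ zero) _ _) (*<* (ℤ.+<+ ()))
  archimedean (mkℚ ℤ.-[1+ _ ] _ _) (*<* ())

  ceiling : ∀ q → ∃ λ n → ∣ q ∣ ≤ ι n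
  ceiling q with 1ℚ <? ∣ q ∣
  ... | no 1≮q = 1 , ≤-trans (≮⇒≥ 1≮q) (≤-reflexive (sym ι-1))
  ... | yes 1<q = let n , 1≤nr = archimedean r (positive⁻¹ r {{1/pos⇒pos ∣ q ∣}}) in n , (begin
      ∣ q ∣               ≡⟨ *-identityˡ _ ⟨
      1ℚ * ∣ q ∣          ≤⟨ *-monoʳ (0≤∣p∣ q) 1≤nr ⟩
      ι n * r * ∣ q ∣     ≡⟨ *-assoc (ι n) r ∣ q ∣ ⟩
      ι n * (r * ∣ q ∣)   ≡⟨ cong (ι n *_) (*-inverseˡ ∣ q ∣) ⟩
      ι n * 1ℚ            ≡⟨ *-identityʳ _ ⟩
      ι n                 ∎)
    where
    instance
      q-pos : Positive ∣ q ∣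
      q-pos = positive (<-trans 0<1 1<q)
      q-nz : Data.Rational.NonZero ∣ q ∣
      q-nz = pos⇒nonZero ∣ q ∣
    r : ℚ
    r = 1/ ∣ q ∣

  Bound : ℝ → Set
  Bound x = ∃ λ b → ∃ λ N → ∀ n → N ℕ.≤ n → ∣ seq x n ∣ ≤ ι b

  bounded : (x : ℝ) → Bound x
  bounded x with cauchy x 1ℚ 0<1
  ... | N , h with ceiling (seq x N)
  ...   | b , xN≤b = b ℕ.+ 1 , N , λ n N≤n → begin
    ∣ seq x n ∣                               ≡⟨ cong ∣_∣ (solve 2 (λ a c → a := c :+ (a :- c)) refl (seq x n) (seq x N)) ⟩
    ∣ seq x N + (seq x n - seq x N) ∣         ≤⟨ ∣p+q∣≤∣p∣+∣q∣ (seq x N) _ ⟩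
    ∣ seq x N ∣ + ∣ seq x n - seq x N ∣       ≤⟨ +-mono-≤ xN≤b (≤-trans (h n N N≤n ℕₚ.≤-refl) (≤-reflexive (sym ι-1))) ⟩
    ι b + ι 1                                 ≡⟨ ι-+ b 1 ⟨
    ι (b ℕ.+ 1)                               ∎

  -- a series dominated by C·rᵏ with 0 ≤ r < 1
  module Geometric (t : ℕ → ℚ) (C r : ℚ) (0≤C : 0ℚ ≤ C) (0≤r : 0ℚ ≤ r) (r<1 : r < 1ℚ)
                   (dom : ∀ k → ∣ t k ∣ ≤ C * r ^ k) where
    s : ℚ
    s = 1ℚ - r

    0<s : 0ℚ < s
    0<s = begin-strict
      0ℚ    ≡⟨ +-inverseʳ r ⟨
      r - r <⟨ +-monoˡ-< (- r) r<1 ⟩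
      s     ∎

    tail : ∀ m j → ∣ Σ< (j ℕ.+ m) t - Σ< m t ∣ * s ≤ C * (r ^ m - r ^ (j ℕ.+ m))
    tail m zero = ≤-reflexive (trans (cong (λ z → ∣ z ∣ * s) (+-inverseʳ (Σ< m t)))
      (trans (*-zeroˡ s) (sym (trans (cong (C *_) (+-inverseʳ (r ^ m))) (*-zeroʳ C)))))
    tail m (suc j) = begin
      ∣ S' + t k - S ∣ * s                ≡⟨ cong (λ z → ∣ z ∣ * s) (solve 3 (λ a b c → (a :+ b) :- c := (a :- c) :+ b) refl S' (t k) S) ⟩
      ∣ (S' - S) + t k ∣ * s              ≤⟨ *-monoʳ (<⇒≤ 0<s) (∣p+q∣≤∣p∣+∣q∣ (S' - S) (t k)) ⟩
      (∣ S' - S ∣ + ∣ t k ∣) * s          ≡⟨ *-distribʳ-+ s ∣ S' - S ∣ ∣ t k ∣ ⟩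
      ∣ S' - S ∣ * s + ∣ t k ∣ * s        ≤⟨ +-mono-≤ (tail m j) (*-monoʳ (<⇒≤ 0<s) (dom k)) ⟩
      C * (r ^ m - R) + C * R * (1ℚ - r)  ≡⟨ solve 4 (λ C a R r → C :* (a :- R) :+ C :* R :* (con 1ℚ :- r) := C :* (a :- r :* R)) refl C (r ^ m) R r ⟩
      C * (r ^ m - r * R)                 ∎
      where
      k = j ℕ.+ m
      S' = Σ< k t
      S = Σ< m t
      R = r ^ k

    decay : ∀ n → ι n * (r ^ n * s) ≤ 1ℚ - r ^ n
    decay zero = ≤-reflexive (trans (cong (_* (r ^ 0 * s)) ι-0) (*-zeroˡ (r ^ 0 * s)))
    decay (suc n) = begin
      ι (suc n) * (r * R * s)        ≤⟨ *-monoˡ (0≤ι (suc n)) (*-monoʳ (<⇒≤ 0<s) (^-anti 1 n 0≤r (<⇒≤ r<1))) ⟩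
      ι (suc n) * (R * s)            ≡⟨ cong (_* (R * s)) (trans (ι-+ 1 n) (cong (_+ ι n) ι-1)) ⟩
      (1ℚ + ι n) * (R * s)           ≡⟨ solve 2 (λ a b → (con 1ℚ :+ a) :* b := a :* b :+ b) refl (ι n) (R * s) ⟩
      ι n * (R * s) + R * s          ≤⟨ +-monoˡ-≤ (R * s) (decay n) ⟩
      1ℚ - R + R * (1ℚ - r)          ≡⟨ solve 2 (λ R r → con 1ℚ :- R :+ R :* (con 1ℚ :- r) := con 1ℚ :- r :* R) refl R r ⟩
      1ℚ - r * R                     ∎
      where R = r ^ n

    small : ∀ ε → 0ℚ < ε → ∃ λ N → ∀ n → N ℕ.≤ n → r ^ n * s ≤ ε
    small ε 0<ε with archimedean ε 0<ε
    ... | N , 1≤Nε = suc N , λ where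
      n@(suc n-1) N<n → *-cancelˡ-≤-pos (ι n) {{positive (ι-suc-pos n-1)}} (begin
        ι n * (r ^ n * s) ≤⟨ decay n ⟩
        1ℚ - r ^ n        ≤⟨ +-monoʳ-≤ 1ℚ (neg-antimono-≤ (0≤^ n 0≤r)) ⟩
        1ℚ - 0ℚ           ≡⟨⟩
        1ℚ                ≤⟨ 1≤Nε ⟩
        ι N * ε           ≤⟨ *-monoʳ (<⇒≤ 0<ε) (ι-mono (ℕₚ.<⇒≤ N<n)) ⟩
        ι n * ε           ∎)

    tail≤ : ∀ {ε} m n → m ℕ.≤ n → r ^ m * s ≤ ε → ∣ Σ< n t - Σ< m t ∣ * (s * s) ≤ C * ε
    tail≤ {ε} m n m≤n h = begin
      ∣ Σ< n t - Σ< m t ∣ * (s * s) ≡⟨ *-assoc ∣ Σ< n t - Σ< m t ∣ s s ⟨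
      ∣ Σ< n t - Σ< m t ∣ * s * s   ≤⟨ *-monoʳ (<⇒≤ 0<s) tail′ ⟩
      C * r ^ m * s                 ≡⟨ *-assoc C (r ^ m) s ⟩
      C * (r ^ m * s)               ≤⟨ *-monoˡ 0≤C h ⟩
      C * ε                         ∎
      where
      tail′ : ∣ Σ< n t - Σ< m t ∣ * s ≤ C * r ^ m
      tail′ = begin
        ∣ Σ< n t - Σ< m t ∣ * s  ≡⟨ cong (λ l → ∣ Σ< l t - Σ< m t ∣ * s) (ℕₚ.m∸n+n≡m m≤n) ⟨
        ∣ Σ< (n ℕ.∸ m ℕ.+ m) t - Σ< m t ∣ * s ≤⟨ tail m (n ℕ.∸ m) ⟩
        C * (r ^ m - r ^ (n ℕ.∸ m ℕ.+ m)) ≤⟨ *-monoˡ 0≤C (begin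
          r ^ m - r ^ (n ℕ.∸ m ℕ.+ m) ≤⟨ +-monoʳ-≤ (r ^ m) (neg-antimono-≤ (0≤^ (n ℕ.∸ m ℕ.+ m) 0≤r)) ⟩
          r ^ m - 0ℚ ≡⟨ +-identityʳ (r ^ m) ⟩
          r ^ m ∎) ⟩
        C * r ^ m ∎

    sums-close : ∀ ε → 0ℚ < ε → ∃ λ N → ∀ m n → N ℕ.≤ m → N ℕ.≤ n → ∣ Σ< m t - Σ< n t ∣ * (s * s) ≤ C * ε
    sums-close ε 0<ε with small ε 0<ε
    ... | N , h = N , go
      where
      go : ∀ m n → N ℕ.≤ m → N ℕ.≤ n → ∣ Σ< m t - Σ< n t ∣ * (s * s) ≤ C * ε
      go m n N≤m N≤n with ℕₚ.≤-total m n
      ... | inj₁ m≤n = subst (λ z → z * (s * s) ≤ C * ε) (∣-∣-sym (Σ< n t) (Σ< m t)) (tail≤ m n m≤n (h m N≤m))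
      ... | inj₂ n≤m = tail≤ n m n≤m (h n N≤n)

    C<C+1 : C < C + 1ℚ
    C<C+1 = begin-strict
      C      ≡⟨ +-identityʳ C ⟨
      C + 0ℚ <⟨ +-monoʳ-< C 0<1 ⟩
      C + 1ℚ ∎

    descale : ∀ X {δ ε} → 0ℚ < δ → (C + 1ℚ) * δ ≡ ε * (s * s) → X * (s * s) ≤ C * δ → X ≤ ε
    descale X {δ} {ε} 0<δ eq h = *-cancelʳ-≤-pos (s * s) {{positive (0<* 0<s 0<s)}} (begin
      X * (s * s)  ≤⟨ h ⟩
      C * δ        ≤⟨ *-monoʳ (<⇒≤ 0<δ) (<⇒≤ C<C+1) ⟩
      (C + 1ℚ) * δ ≡⟨ eq ⟩
      ε * (s * s)  ∎)

    summable : Cauchy (λ n → Σ< n t)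
    summable ε 0<ε =
      let δ , 0<δ , eq = rescale {ε * (s * s)} {C + 1ℚ} (0<* 0<ε (0<* 0<s 0<s)) (≤-<-trans 0≤C C<C+1)
          N , h = sums-close δ 0<δ
      in N , λ m n N≤m N≤n → descale ∣ Σ< m t - Σ< n t ∣ 0<δ eq (h m n N≤m N≤n)

  +-estimate : ∀ a b c d {ε} → ∣ a - c ∣ ≤ ε → ∣ b - d ∣ ≤ ε → ∣ (a + b) - (c + d) ∣ ≤ (1ℚ + 1ℚ) * ε
  +-estimate a b c d {ε} p q = begin
    ∣ (a + b) - (c + d) ∣   ≡⟨ cong ∣_∣ (solve 4 (λ a b c d → (a :+ b) :- (c :+ d) := (a :- c) :+ (b :- d)) refl a b c d) ⟩
    ∣ (a - c) + (b - d) ∣   ≤⟨ ∣p+q∣≤∣p∣+∣q∣ (a - c) (b - d) ⟩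
    ∣ a - c ∣ + ∣ b - d ∣   ≤⟨ +-mono-≤ p q ⟩
    ε + ε                   ≡⟨ solve 1 (λ e → e :+ e := (con 1ℚ :+ con 1ℚ) :* e) refl ε ⟩
    (1ℚ + 1ℚ) * ε           ∎

  +-cauchy : (x y : ℝ) → Cauchy (λ n → seq x n + seq y n)
  +-cauchy x y = close⇒cauchy (λ n → seq x n + seq y n) (1ℚ + 1ℚ) (positive⁻¹ (1ℚ + 1ℚ)) λ ε 0<ε →
    let M , f = cauchy x ε 0<ε
        N , g = cauchy y ε 0<ε
    in M ℕ.⊔ N , λ m n p q →
      +-estimate (seq x m) (seq y m) (seq x n) (seq y n)
        (f m n (⊔-≤ˡ {M} {N} p) (⊔-≤ˡ {M} {N} q)) (g m n (⊔-≤ʳ {M} {N} p) (⊔-≤ʳ {M} {N} q))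

  neg-cauchy : (x : ℝ) → Cauchy (λ n → - seq x n)
  neg-cauchy x ε 0<ε = let N , f = cauchy x ε 0<ε in N , λ m n p q → begin
    ∣ - seq x m - - seq x n ∣ ≡⟨ cong ∣_∣ (solve 2 (λ a b → (:- a) :- (:- b) := :- (a :- b)) refl (seq x m) (seq x n)) ⟩
    ∣ - (seq x m - seq x n) ∣ ≡⟨ ∣-p∣≡∣p∣ (seq x m - seq x n) ⟩
    ∣ seq x m - seq x n ∣     ≤⟨ f m n p q ⟩
    ε ∎

  *-estimate : ∀ x y x′ y′ a b {ε} → ∣ x ∣ ≤ ι a → ∣ y′ ∣ ≤ ι b → ∣ x - x′ ∣ ≤ ε → ∣ y - y′ ∣ ≤ ε →
               ∣ x * y - x′ * y′ ∣ ≤ ι (suc (a ℕ.+ b)) * ε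
  *-estimate x y x′ y′ a b {ε} x≤a y′≤b p q = begin
    ∣ x * y - x′ * y′ ∣
      ≡⟨ cong ∣_∣ (solve 4 (λ a b c d → a :* b :- c :* d := a :* (b :- d) :+ d :* (a :- c)) refl x y x′ y′) ⟩
    ∣ x * (y - y′) + y′ * (x - x′) ∣
      ≤⟨ ∣p+q∣≤∣p∣+∣q∣ (x * (y - y′)) (y′ * (x - x′)) ⟩
    ∣ x * (y - y′) ∣ + ∣ y′ * (x - x′) ∣
      ≡⟨ cong₂ _+_ (∣p*q∣≡∣p∣*∣q∣ x (y - y′)) (∣p*q∣≡∣p∣*∣q∣ y′ (x - x′)) ⟩
    ∣ x ∣ * ∣ y - y′ ∣ + ∣ y′ ∣ * ∣ x - x′ ∣
      ≤⟨ +-mono-≤ (*-mono (0≤∣p∣ x) 0≤ε x≤a q) (*-mono (0≤∣p∣ y′) 0≤ε y′≤b p) ⟩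
    ι a * ε + ι b * ε
      ≡⟨ *-distribʳ-+ ε (ι a) (ι b) ⟨
    (ι a + ι b) * ε
      ≡⟨ cong (_* ε) (ι-+ a b) ⟨
    ι (a ℕ.+ b) * ε
      ≤⟨ *-monoʳ 0≤ε (ι-mono (ℕₚ.n≤1+n (a ℕ.+ b))) ⟩
    ι (suc (a ℕ.+ b)) * ε ∎
    where
    0≤ε : 0ℚ ≤ ε
    0≤ε = ≤-trans (0≤∣p∣ (x - x′)) p

  *-cauchy′ : (x y : ℝ) → Bound x → Bound y → Cauchy (λ n → seq x n * seq y n)
  *-cauchy′ x y (a , K , xb) (b , L , yb) =
    close⇒cauchy (λ n → seq x n * seq y n) (ι (suc (a ℕ.+ b))) (ι-suc-pos (a ℕ.+ b)) λ ε 0<ε →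
    let M , f = cauchy x ε 0<ε
        N , g = cauchy y ε 0<ε
    in (K ℕ.⊔ L) ℕ.⊔ (M ℕ.⊔ N) , λ m n p q →
      let p₁ = ⊔-≤ˡ {K ℕ.⊔ L} {M ℕ.⊔ N} p ; q₁ = ⊔-≤ˡ {K ℕ.⊔ L} {M ℕ.⊔ N} q
          p₂ = ⊔-≤ʳ {K ℕ.⊔ L} {M ℕ.⊔ N} p ; q₂ = ⊔-≤ʳ {K ℕ.⊔ L} {M ℕ.⊔ N} q
      in *-estimate (seq x m) (seq y m) (seq x n) (seq y n) a b
           (xb m (⊔-≤ˡ {K} {L} p₁)) (yb n (⊔-≤ʳ {K} {L} q₁))
           (f m n (⊔-≤ˡ {M} {N} p₂) (⊔-≤ˡ {M} {N} q₂)) (g m n (⊔-≤ʳ {M} {N} p₂) (⊔-≤ʳ {M} {N} q₂))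

  *-cauchy : (x y : ℝ) → Cauchy (λ n → seq x n * seq y n)
  *-cauchy x y = *-cauchy′ x y (bounded x) (bounded y)

  invFact : ℕ → ℚ
  invFact k = (+ 1 / (k !)) {{k ℕₚ.!≢0}}

  0≤invFact : ∀ k → 0ℚ ≤ invFact k
  0≤invFact k = 0≤1/ (k !) {{k ℕₚ.!≢0}}

  ι-invFact : ∀ k → ι (k !) * invFact k ≡ 1ℚ
  ι-invFact k = ι-/ (k !) {{k ℕₚ.!≢0}}

  invFact-suc : ∀ k → ι (suc k) * invFact (suc k) ≡ invFact k
  invFact-suc k = begin-equality
    ι (suc k) * g                     ≡⟨ *-identityʳ _ ⟨
    ι (suc k) * g * 1ℚ                ≡⟨ cong (ι (suc k) * g *_) (ι-invFact k) ⟨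
    ι (suc k) * g * (ι (k !) * f)     ≡⟨ solve 4 (λ a g b f → a :* g :* (b :* f) := (a :* b) :* g :* f) refl (ι (suc k)) g (ι (k !)) f ⟩
    (ι (suc k) * ι (k !)) * g * f     ≡⟨ cong (λ z → z * g * f) (ι-* (suc k) (k !)) ⟨
    ι (suc k !) * g * f               ≡⟨ cong (_* f) (ι-invFact (suc k)) ⟩
    1ℚ * f                            ≡⟨ *-identityˡ f ⟩
    f                                 ∎
    where
    f = invFact k
    g = invFact (suc k)

  power≤factorial : ∀ M → 1 ℕ.≤ M → ∀ k → M ℕ.^ k ℕ.≤ k ! ℕ.* M ℕ.^ M
  power≤factorial M 1≤M zero = ℕₚ.≤-trans (ℕₚ.m^n>0 M {{ℕ.>-nonZero 1≤M}} M) (ℕₚ.≤-reflexive (sym (ℕₚ.*-identityˡ _)))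
  power≤factorial M 1≤M (suc k) with ℕₚ.≤-total M (suc k)
  ... | inj₁ M≤k+1 = ℕₚ.≤-trans (ℕₚ.*-mono-≤ M≤k+1 (power≤factorial M 1≤M k)) (ℕₚ.≤-reflexive (sym (ℕₚ.*-assoc (suc k) (k !) (M ℕ.^ M))))
  ... | inj₂ k+1≤M = ℕₚ.≤-trans (ℕₚ.^-monoʳ-≤ M {{ℕ.>-nonZero 1≤M}} k+1≤M)
                       (ℕₚ.m≤n*m (M ℕ.^ M) (suc k !) {{suc k ℕₚ.!≢0}})

  opaque
    expBound : ℕ → ℕ
    expBound b = (2 ℕ.* suc b) ℕ.^ (2 ℕ.* suc b)

    expBound-eq : ∀ b → expBound b ≡ (2 ℕ.* suc b) ℕ.^ (2 ℕ.* suc b)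
    expBound-eq b = refl

  2ℚ 4ℚ : ℚ
  2ℚ = 1ℚ + 1ℚ
  4ℚ = 2ℚ + 2ℚ

  0≤2 : 0ℚ ≤ 2ℚ
  0≤2 = nonNegative⁻¹ 2ℚ

  ι-2 : ι 2 ≡ 2ℚ
  ι-2 = trans (ι-+ 1 1) (cong₂ _+_ ι-1 ι-1)

  half-power : ∀ b k → ι (2 ℕ.* b) ^ k * ½ ^ k ≡ ι b ^ k
  half-power b zero = refl
  half-power b (suc k) = begin-equality
    ι (2 ℕ.* b) * P * (½ * Q) ≡⟨ cong (λ z → z * P * (½ * Q)) (trans (ι-* 2 b) (cong (_* ι b) ι-2)) ⟩
    2ℚ * ι b * P * (½ * Q)    ≡⟨ solve 3 (λ b P Q → con 2ℚ :* b :* P :* (con ½ :* Q) := b :* (P :* Q)) refl (ι b) P Q ⟩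
    ι b * (P * Q)             ≡⟨ cong (ι b *_) (half-power b k) ⟩
    ι b * ι b ^ k             ∎
    where
    P = ι (2 ℕ.* b) ^ k
    Q = ½ ^ k

  0≤½ : 0ℚ ≤ ½
  0≤½ = nonNegative⁻¹ ½

  expTerm-dom : ∀ b k → expTerm (ι (suc b)) k ≤ ι (expBound b) * ½ ^ k
  expTerm-dom b k = begin
    ι (suc b) ^ k * f                     ≡⟨ cong (_* f) (half-power (suc b) k) ⟨
    ι M ^ k * ½ ^ k * f                   ≡⟨ cong (λ z → z * ½ ^ k * f) (ι-^ M k) ⟨
    ι (M ℕ.^ k) * ½ ^ k * f               ≤⟨ *-monoʳ (0≤invFact k) (*-monoʳ (0≤^ k 0≤½) (ι-mono (power≤factorial M (s≤s z≤n) k))) ⟩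
    ι (k ! ℕ.* M ℕ.^ M) * ½ ^ k * f       ≡⟨ cong (λ z → z * ½ ^ k * f) (ι-* (k !) (M ℕ.^ M)) ⟩
    ι (k !) * ι (M ℕ.^ M) * ½ ^ k * f     ≡⟨ solve 4 (λ a c h f → a :* c :* h :* f := a :* f :* (c :* h)) refl (ι (k !)) (ι (M ℕ.^ M)) (½ ^ k) f ⟩
    ι (k !) * f * (ι (M ℕ.^ M) * ½ ^ k)   ≡⟨ cong (_* (ι (M ℕ.^ M) * ½ ^ k)) (ι-invFact k) ⟩
    1ℚ * (ι (M ℕ.^ M) * ½ ^ k)            ≡⟨ *-identityˡ _ ⟩
    ι (M ℕ.^ M) * ½ ^ k                   ≡⟨ cong (λ z → ι z * ½ ^ k) (expBound-eq b) ⟨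
    ι (expBound b) * ½ ^ k                ∎
    where
    f = invFact k
    M = 2 ℕ.* suc b

  ∣expTerm∣ : ∀ {u B} k → ∣ u ∣ ≤ B → ∣ expTerm u k ∣ ≤ expTerm B k
  ∣expTerm∣ {u} {B} k u≤B = begin
    ∣ u ^ k * f ∣     ≡⟨ ∣p*q∣≡∣p∣*∣q∣ (u ^ k) f ⟩
    ∣ u ^ k ∣ * ∣ f ∣ ≡⟨ cong₂ _*_ (∣^∣ u k) (0≤p⇒∣p∣≡p (0≤invFact k)) ⟩
    ∣ u ∣ ^ k * f     ≤⟨ *-monoʳ (0≤invFact k) (^-mono k (0≤∣p∣ u) u≤B) ⟩
    B ^ k * f         ∎
    where f = invFact k

  ^-lipschitz : ∀ {u v B} k → ∣ u ∣ ≤ B → ∣ v ∣ ≤ B →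
                ∣ u ^ suc k - v ^ suc k ∣ ≤ ι (suc k) * B ^ k * ∣ u - v ∣
  ^-lipschitz {u} {v} {B} zero u≤B v≤B = ≤-reflexive (begin-equality
    ∣ u * 1ℚ - v * 1ℚ ∣      ≡⟨ cong₂ (λ a b → ∣ a - b ∣) (*-identityʳ u) (*-identityʳ v) ⟩
    ∣ u - v ∣                ≡⟨ *-identityˡ _ ⟨
    1ℚ * ∣ u - v ∣           ≡⟨ cong (_* ∣ u - v ∣) (trans (*-identityʳ (ι 1)) ι-1) ⟨
    ι 1 * 1ℚ * ∣ u - v ∣     ∎)
  ^-lipschitz {u} {v} {B} (suc k) u≤B v≤B = begin
    ∣ u * U - v * V ∣
      ≡⟨ cong ∣_∣ (solve 4 (λ u U v V → u :* U :- v :* V := u :* (U :- V) :+ V :* (u :- v)) refl u U v V) ⟩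
    ∣ u * (U - V) + V * (u - v) ∣
      ≤⟨ ∣p+q∣≤∣p∣+∣q∣ (u * (U - V)) (V * (u - v)) ⟩
    ∣ u * (U - V) ∣ + ∣ V * (u - v) ∣
      ≡⟨ cong₂ _+_ (∣p*q∣≡∣p∣*∣q∣ u (U - V)) (∣p*q∣≡∣p∣*∣q∣ V (u - v)) ⟩
    ∣ u ∣ * ∣ U - V ∣ + ∣ V ∣ * D
      ≤⟨ +-mono-≤ (*-mono (0≤∣p∣ u) (0≤* (0≤* (0≤ι (suc k)) (0≤^ k 0≤B)) (0≤∣p∣ (u - v))) u≤B (^-lipschitz k u≤B v≤B))
                  (*-monoʳ (0≤∣p∣ (u - v)) V≤) ⟩
    B * (ι (suc k) * B ^ k * D) + B * B ^ k * D
      ≡⟨ solve 4 (λ B n P D → B :* (n :* P :* D) :+ B :* P :* D := (con 1ℚ :+ n) :* (B :* P) :* D) refl B (ι (suc k)) (B ^ k) D ⟩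
    (1ℚ + ι (suc k)) * (B * B ^ k) * D
      ≡⟨ cong (λ z → z * (B * B ^ k) * D) (trans (ι-+ 1 (suc k)) (cong (_+ ι (suc k)) ι-1)) ⟨
    ι (suc (suc k)) * (B * B ^ k) * D ∎
    where
    U = u ^ suc k
    V = v ^ suc k
    D = ∣ u - v ∣
    0≤B : 0ℚ ≤ B
    0≤B = ≤-trans (0≤∣p∣ u) u≤B
    V≤ : ∣ V ∣ ≤ B ^ suc k
    V≤ = begin
      ∣ V ∣          ≡⟨ ∣^∣ v (suc k) ⟩
      ∣ v ∣ ^ suc k  ≤⟨ ^-mono (suc k) (0≤∣p∣ v) v≤B ⟩
      B ^ suc k      ∎

  expTerm-lipschitz : ∀ {u v B} k → ∣ u ∣ ≤ B → ∣ v ∣ ≤ B →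
                      ∣ expTerm u (suc k) - expTerm v (suc k) ∣ ≤ expTerm B k * ∣ u - v ∣
  expTerm-lipschitz {u} {v} {B} k u≤B v≤B = begin
    ∣ U * g - V * g ∣                    ≡⟨ cong ∣_∣ (solve 3 (λ U V g → U :* g :- V :* g := (U :- V) :* g) refl U V g) ⟩
    ∣ (U - V) * g ∣                      ≡⟨ ∣p*q∣≡∣p∣*∣q∣ (U - V) g ⟩
    ∣ U - V ∣ * ∣ g ∣                    ≡⟨ cong (∣ U - V ∣ *_) (0≤p⇒∣p∣≡p (0≤invFact (suc k))) ⟩
    ∣ U - V ∣ * g                        ≤⟨ *-monoʳ (0≤invFact (suc k)) (^-lipschitz k u≤B v≤B) ⟩
    ι (suc k) * B ^ k * D * g            ≡⟨ solve 4 (λ n P D g → n :* P :* D :* g := P :* (n :* g) :* D) refl (ι (suc k)) (B ^ k) D g ⟩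
    B ^ k * (ι (suc k) * g) * D          ≡⟨ cong (λ z → B ^ k * z * D) (invFact-suc k) ⟩
    B ^ k * invFact k * D                ∎
    where
    U = u ^ suc k
    V = v ^ suc k
    g = invFact (suc k)
    D = ∣ u - v ∣

  expSum-lipschitz : ∀ {u v} b n → ∣ u ∣ ≤ ι (suc b) → ∣ v ∣ ≤ ι (suc b) →
    ∣ Σ< n (expTerm u) - Σ< n (expTerm v) ∣ ≤ (2ℚ * ι (expBound b)) * ∣ u - v ∣
  expSum-lipschitz {u} {v} b zero u≤B v≤B =
    0≤* (0≤* (0≤2) (0≤ι (expBound b))) (0≤∣p∣ (u - v))
  expSum-lipschitz {u} {v} b (suc n) u≤B v≤B = begin
    ∣ Σ< (suc n) (expTerm u) - Σ< (suc n) (expTerm v) ∣ ≤⟨ go n ⟩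
    C * (2ℚ - 2ℚ * ½ ^ n) * D  ≤⟨ *-monoʳ (0≤∣p∣ (u - v)) (*-monoˡ (0≤ι (expBound b)) (begin
      2ℚ - 2ℚ * ½ ^ n ≤⟨ +-monoʳ-≤ (2ℚ) (neg-antimono-≤ (0≤* (0≤2) (0≤^ n 0≤½))) ⟩
      2ℚ - 0ℚ          ≡⟨⟩
      2ℚ               ∎)) ⟩
    C * 2ℚ * D                  ≡⟨ cong (_* D) (*-comm C (2ℚ)) ⟩
    2ℚ * C * D                  ∎
    where
    C = ι (expBound b)
    D = ∣ u - v ∣
    go : ∀ n → ∣ Σ< (suc n) (expTerm u) - Σ< (suc n) (expTerm v) ∣ ≤ C * (2ℚ - 2ℚ * ½ ^ n) * D
    go zero = ≤-reflexive (sym (trans (cong (_* D) (*-zeroʳ C)) (*-zeroˡ D)))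
    go (suc n) = begin
      ∣ (S + s) - (T + t) ∣          ≡⟨ cong ∣_∣ (solve 4 (λ S s T t → (S :+ s) :- (T :+ t) := (S :- T) :+ (s :- t)) refl S s T t) ⟩
      ∣ (S - T) + (s - t) ∣          ≤⟨ ∣p+q∣≤∣p∣+∣q∣ (S - T) (s - t) ⟩
      ∣ S - T ∣ + ∣ s - t ∣          ≤⟨ +-mono-≤ (go n) (≤-trans (expTerm-lipschitz n u≤B v≤B) (*-monoʳ (0≤∣p∣ (u - v)) (expTerm-dom b n))) ⟩
      C * (2ℚ - 2ℚ * H) * D + C * H * D
        ≡⟨ solve 3 (λ C H D → C :* (con 2ℚ :- con 2ℚ :* H) :* D :+ C :* H :* D := C :* (con 2ℚ :- con 2ℚ :* (con ½ :* H)) :* D) refl C H D ⟩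
      C * (2ℚ - 2ℚ * (½ * H)) * D  ∎
      where
      S = Σ< (suc n) (expTerm u)
      T = Σ< (suc n) (expTerm v)
      s = expTerm u (suc n)
      t = expTerm v (suc n)
      H = ½ ^ n

  ½<1 : ½ < 1ℚ
  ½<1 = *<* (ℤ.+<+ (s≤s (s≤s z≤n)))

  ½-small : ∀ ε → 0ℚ < ε → ∃ λ N → ∀ n → N ℕ.≤ n → ½ ^ n * ½ ≤ ε
  ½-small = Geometric.small (λ _ → 0ℚ) 0ℚ ½ ≤-refl 0≤½ ½<1 (λ k → ≤-reflexive (sym (*-zeroˡ (½ ^ k))))

  expSum-close : ∀ u b {ε} m n → ∣ u ∣ ≤ ι (suc b) → ½ ^ m * ½ ≤ ε → ½ ^ n * ½ ≤ ε →
                 ∣ Σ< m (expTerm u) - Σ< n (expTerm u) ∣ ≤ 4ℚ * ι (expBound b) * ε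
  expSum-close u b {ε} m n u≤B hm hn = begin
      X                   ≡⟨ solve 1 (λ X → X := con 4ℚ :* (X :* (con ½ :* con ½))) refl X ⟩
      4ℚ * (X * (½ * ½))  ≤⟨ *-monoˡ (nonNegative⁻¹ 4ℚ) both ⟩
      4ℚ * (C * ε)        ≡⟨ *-assoc 4ℚ C ε ⟨
      4ℚ * C * ε          ∎
    where
    C = ι (expBound b)
    X = ∣ Σ< m (expTerm u) - Σ< n (expTerm u) ∣
    module E = Geometric (expTerm u) C ½ (0≤ι (expBound b)) 0≤½ ½<1
      (λ k → ≤-trans (∣expTerm∣ k u≤B) (expTerm-dom b k))
    both : X * (½ * ½) ≤ C * ε
    both with ℕₚ.≤-total m n
    ... | inj₁ m≤n = subst (λ z → z * (½ * ½) ≤ C * ε) (∣-∣-sym (Σ< n (expTerm u)) (Σ< m (expTerm u))) (E.tail≤ m n m≤n hm)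
    ... | inj₂ n≤m = E.tail≤ n m n≤m hn

  expRate : ℕ → ℚ
  expRate b = 4ℚ * ι (expBound b) + 2ℚ * ι (expBound b)

  0<expRate : ∀ b → 0ℚ < expRate b
  0<expRate b = subst (_< expRate b) (+-identityʳ 0ℚ)
    (+-mono-< (0<* {4ℚ} {C} (positive⁻¹ 4ℚ) 0<C) (0<* {2ℚ} {C} (positive⁻¹ 2ℚ) 0<C))
    where
    C = ι (expBound b)
    0<C : 0ℚ < C
    0<C = <-≤-trans (ι-suc-pos 0) (ι-mono (ℕₚ.≤-trans (ℕₚ.m^n>0 (2 ℕ.* suc b) (2 ℕ.* suc b)) (ℕₚ.≤-reflexive (sym (expBound-eq b)))))

  exp-estimate : ∀ u v b {ε} m n → ∣ u ∣ ≤ ι (suc b) → ∣ v ∣ ≤ ι (suc b) → ∣ u - v ∣ ≤ ε →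
                 ½ ^ m * ½ ≤ ε → ½ ^ n * ½ ≤ ε →
                 ∣ Σ< m (expTerm u) - Σ< n (expTerm v) ∣ ≤ expRate b * ε
  exp-estimate u v b {ε} m n u≤B v≤B d hm hn = begin
    ∣ S - T ∣               ≤⟨ tri S R T ⟩
    ∣ S - R ∣ + ∣ R - T ∣   ≤⟨ +-mono-≤ (expSum-close u b m n u≤B hm hn)
                                (≤-trans (expSum-lipschitz b n u≤B v≤B)
                                  (*-monoˡ (0≤* 0≤2 (0≤ι (expBound b))) d)) ⟩
    4ℚ * C * ε + 2ℚ * C * ε ≡⟨ *-distribʳ-+ ε (4ℚ * C) (2ℚ * C) ⟨
    (4ℚ * C + 2ℚ * C) * ε   ∎
    where
    C = ι (expBound b)
    S = Σ< m (expTerm u)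
    R = Σ< n (expTerm u)
    T = Σ< n (expTerm v)

  exp-cauchy′ : (x : ℝ) → Bound x → Cauchy (λ n → Σ< n (expTerm (seq x n)))
  exp-cauchy′ x (b , K , xb) = close⇒cauchy (λ n → Σ< n (expTerm (seq x n))) (expRate b) (0<expRate b) λ ε 0<ε →
    let N , f = cauchy x ε 0<ε
        L , h = ½-small ε 0<ε
    in K ℕ.⊔ (N ℕ.⊔ L) , λ m n p q →
      let p₂ = ⊔-≤ʳ {K} {N ℕ.⊔ L} p ; q₂ = ⊔-≤ʳ {K} {N ℕ.⊔ L} q
      in exp-estimate (seq x m) (seq x n) b m n
           (xb′ m (⊔-≤ˡ {K} {N ℕ.⊔ L} p)) (xb′ n (⊔-≤ˡ {K} {N ℕ.⊔ L} q))
           (f m n (⊔-≤ˡ {N} {L} p₂) (⊔-≤ˡ {N} {L} q₂))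
           (h m (⊔-≤ʳ {N} {L} p₂)) (h n (⊔-≤ʳ {N} {L} q₂))
    where
    xb′ : ∀ n → K ℕ.≤ n → ∣ seq x n ∣ ≤ ι (suc b)
    xb′ n K≤n = ≤-trans (xb n K≤n) (ι-mono (ℕₚ.n≤1+n b))

  exp-cauchy : (x : ℝ) → Cauchy (λ n → Σ< n (expTerm (seq x n)))
  exp-cauchy x = exp-cauchy′ x (bounded x)

  artanh-cauchy : ∀ z → ∣ z ∣ < 1ℚ → Cauchy (λ n → Σ< n (artanhTerm z))
  artanh-cauchy z z<1 = Geometric.summable (artanhTerm z) 1ℚ ∣ z ∣ 0≤1ℚ (0≤∣p∣ z) z<1 λ k →
    let d = suc (2 ℕ.* k) in begin
    ∣ z ^ d * (+ 1 / d) ∣      ≡⟨ ∣p*q∣≡∣p∣*∣q∣ (z ^ d) (+ 1 / d) ⟩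
    ∣ z ^ d ∣ * ∣ + 1 / d ∣    ≡⟨ cong₂ _*_ (∣^∣ z d) (0≤p⇒∣p∣≡p (0≤1/ d)) ⟩
    ∣ z ∣ ^ d * (+ 1 / d)      ≤⟨ *-mono (0≤^ d (0≤∣p∣ z)) 0≤1ℚ ≤-refl (1/≤1 d) ⟩
    ∣ z ∣ ^ d * 1ℚ             ≡⟨ *-identityʳ _ ⟩
    ∣ z ∣ ^ d                  ≡⟨ cong (∣ z ∣ ^_) (cong (λ j → suc (k ℕ.+ j)) (ℕₚ.+-identityʳ k)) ⟩
    ∣ z ∣ ^ (suc k ℕ.+ k)      ≤⟨ ^-anti (suc k) k (0≤∣p∣ z) (<⇒≤ z<1) ⟩
    ∣ z ∣ ^ k                  ≡⟨ *-identityˡ _ ⟨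
    1ℚ * ∣ z ∣ ^ k             ∎

  const-cauchy : ∀ q → Cauchy (λ _ → q)
  const-cauchy q ε 0<ε = 0 , λ _ _ _ _ → subst (λ z → ∣ z ∣ ≤ ε) (sym (+-inverseʳ q)) (<⇒≤ 0<ε)

open Convergence using (const-cauchy; +-cauchy; neg-cauchy; *-cauchy; exp-cauchy; artanh-cauchy)

infixl 6 _+ᴿ_
infixl 7 _*ᴿ_
infix  8 -ᴿ_

fromℚ : ℚ → ℝ
fromℚ q = mkℝ (λ _ → q) (const-cauchy q)

fromℕ : ℕ → ℝ
fromℕ n = fromℚ (+ n / 1)

_+ᴿ_ _*ᴿ_ : ℝ → ℝ → ℝ
x +ᴿ y = mkℝ (λ n → seq x n + seq y n) (+-cauchy x y)
x *ᴿ y = mkℝ (λ n → seq x n * seq y n) (*-cauchy x y)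

-ᴿ_ : ℝ → ℝ
-ᴿ x = mkℝ (λ n → - seq x n) (neg-cauchy x)

-- The diagonal sequence of Σ xᵏ / k!: the n-th partial sum at the n-th
-- approximation of x.
exp : ℝ → ℝ
exp x = mkℝ (λ n → Σ< n (expTerm (seq x n))) (exp-cauchy x)

artanh : (z : ℚ) → ∣ z ∣ < 1ℚ → ℝ
artanh z z<1 = mkℝ (λ n → Σ< n (artanhTerm z)) (artanh-cauchy z z<1)

-- |cayley q| < 1 for q > 0, so the artanh series converges on all of (0,∞).
cayley : (q : ℚ) → 0ℚ < q → ℚ
cayley q 0<q = ((q - 1ℚ) ÷ (q + 1ℚ)) {{pos⇒nonZero (q + 1ℚ) {{pos+pos⇒pos q {{positive 0<q}} 1ℚ}}}}

∣cayley∣<1 : ∀ q 0<q → ∣ cayley q 0<q ∣ < 1ℚ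
∣cayley∣<1 q 0<q = *-cancelʳ-<-nonNeg w {{pos⇒nonNeg w}} (begin-strict
    ∣ z ∣ * w       ≡⟨ cong (∣ z ∣ *_) (0≤p⇒∣p∣≡p (<⇒≤ 0<w)) ⟨
    ∣ z ∣ * ∣ w ∣   ≡⟨ ∣p*q∣≡∣p∣*∣q∣ z w ⟨
    ∣ z * w ∣       ≡⟨ cong ∣_∣ zw ⟩
    ∣ q - 1ℚ ∣      <⟨ lemma (∣p∣≡p∨∣p∣≡-p (q - 1ℚ)) ⟩
    w               ≡⟨ *-identityˡ w ⟨
    1ℚ * w          ∎)
  where
  open ≤-Reasoning
  open +-*-Solver using (solve; _:=_; _:+_; _:-_; :-_; con)
  w = q + 1ℚ
  z = cayley q 0<q
  instance
    w-pos : Positive w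
    w-pos = pos+pos⇒pos q {{positive 0<q}} 1ℚ
    w-nz : Data.Rational.NonZero w
    w-nz = pos⇒nonZero w
  0<w : 0ℚ < w
  0<w = positive⁻¹ w
  zw : z * w ≡ q - 1ℚ
  zw = trans (*-assoc (q - 1ℚ) (1/ w) w) (trans (cong ((q - 1ℚ) *_) (*-inverseˡ w)) (*-identityʳ _))
  lemma : _ → ∣ q - 1ℚ ∣ < w
  lemma (inj₁ eq) = subst (_< w) (sym eq) (+-monoʳ-< q (<-trans (negative⁻¹ (- 1ℚ)) (positive⁻¹ 1ℚ)))
  lemma (inj₂ eq) = subst (_< w) (sym eq) (begin-strict
    - (q - 1ℚ) ≡⟨ solve 1 (λ q → :- (q :- con 1ℚ) := :- q :+ con 1ℚ) refl q ⟩
    - q + 1ℚ   <⟨ +-monoˡ-< 1ℚ (<-trans (neg-antimono-< 0<q) 0<q) ⟩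
    q + 1ℚ     ∎)

-- Natural logarithm of a positive rational: log q = 2 artanh ((q-1)/(q+1)).
-- The value at q ≤ 0 is a convention; entropy only uses q = αᵢ / Ω(N) > 0.
log : ℚ → ℝ
log q with 0ℚ <? q
... | yes 0<q = fromℕ 2 *ᴿ artanh (cayley q 0<q) (∣cayley∣<1 q 0<q)
... | no  _   = fromℕ 0

-- Prime factors with multiplicity; the value at 0 is a convention.
primeFactors : ℕ → List ℕ
primeFactors zero      = []
primeFactors n@(suc _) = factors (factorise n)

Ω : ℕ → ℕ
Ω N = length (primeFactors N)

multiplicity : ℕ → ℕ → ℕ
multiplicity p N = length (filter (p ℕ.≟_) (primeFactors N))

-- α / Ω; the value at Ω = 0 is a convention, and Ω N > 0 for N ≥ 2.
ratio : ℕ → ℕ → ℚ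
ratio a zero      = 0ℚ
ratio a n@(suc _) = + a / n

sumᴿ : List ℝ → ℝ
sumᴿ = foldr _+ᴿ_ (fromℕ 0)

entropyTerm : ℕ → ℕ → ℝ
entropyTerm N p = fromℚ f *ᴿ log f
  where
  f : ℚ
  f = ratio (multiplicity p N) (Ω N)

-- The sum runs over the distinct prime factors of N.
H : ℕ → ℝ
H N = -ᴿ sumᴿ (map (entropyTerm N) (deduplicate ℕ._≟_ (primeFactors N)))

{-# OPTIONS --safe #-}
module Submission where

-- Let W = Ω(n), h = H(n), L = log, and S = ∑ aᵢ L(aᵢ) = W L(W) - W h, so that
--   (W + x) H(n pˣ) = (W + x) L(W + x) - x L(x) - S.
-- Gibbs' inequality bounds H(n pˣ) by the cross entropy against the weights of n pʸ, and the
-- cross entropy differs from H(n pʸ) by a positive multiple of (x - y)(W L(y) - S).  Hence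
-- (x - y)(W L(y) - S) ≥ 0 implies H(n pˣ) ≤ H(n pʸ), and the condition comparing y with
-- W exp(-h) is the sign of W L(y) - S.  Both parts are this one comparison.
--
-- All inequalities used are linear in logarithms with rational coefficients, and logarithms
-- enter only through s (L(t) - L(s)) ≤ t - s, read off the artanh series.  By subdivision
-- this determines L, which gives L(ab) = L(a) + L(b).  The exponential series is linked to L
-- through the powers (1 + u/M)^M.

open import Defs

-- The threshold is a familiar mean: since W log(W exp(-h)) = S, the number W exp(-h) is the
-- geometric mean of the aᵢ with weights aᵢ/W. The obstacle is that this logarithm cannot be formed:
-- `log` accepts rationals only, while exp(-h) is a real given by a Cauchy sequence. The order
-- between a rational q and exp(y) is therefore carried over to log(q) and y by way of a rational P
-- that is close to exp(y) and whose logarithm is close to y. A power (1 + u/M)^M with u near y is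
-- such a P: its logarithm is M log(1 + u/M), which the tangent inequality brackets between u -
-- O(1/M) and u. A second obstacle is that partial sums of the artanh series are not additive: at a
-- fixed index k, the terms of L(ab) and of L(a) + L(b) differ. Inequalities are therefore
-- statements about limits of rational sequences (`_≳0`, `_≈0`). A typical deduction takes a
-- combination of such sequences, with nonnegative coefficients on the inequalities, and checks one
-- polynomial identity at each index.

module EntropyComparison where
  open import Defs
  open import Data.Nat as ℕ using (ℕ; zero; suc; NonZero; z≤n; s≤s)
  import Data.Nat.Properties as ℕₚ
  open import Data.Nat.GCD using (gcd; gcd-greatest)
  open import Data.Nat.Divisibility using (_∣_; ∣-refl; ∣1⇒≡1)
  open import Data.Nat.ListAction using (product)
  open import Data.Nat.ListAction.Properties using (product-++; ∈⇒∣product)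
  open import Data.Nat.Primality using (Prime; prime⇒nonZero; ¬prime[1])
  open import Data.Nat.Primality.Factorisation using (PrimeFactorisation; factorise; factorisationUnique)
  open import Data.Integer as ℤ using (+_)
  import Data.Integer.Properties as ℤₚ
  open import Data.Rational
    using (ℚ; 0ℚ; 1ℚ; ½; _+_; _*_; _-_; -_; ∣_∣; _/_; 1/_; _≤_; _<_; positive; nonNegative; toℚᵘ)
  open import Data.Rational.Base using (+-*-rawSemiring)
  open import Data.Rational.Properties
  import Data.Rational.Unnormalised as ℚᵘ
  import Data.Rational.Unnormalised.Properties as ℚᵘₚ
  open import Data.Rational.Solver using (module +-*-Solver)
  open import Algebra.Definitions.RawSemiring +-*-rawSemiring using (_^_)
  open import Data.List using (List; []; _∷_; _++_; length; map; filter; replicate; deduplicate)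
  open import Data.List.Properties using (length-filter; length-++; length-replicate; filter-++; filter-all; filter-none; filter-accept; filter-reject)
  open import Data.List.Membership.Propositional using (_∈_)
  open import Data.List.Membership.Propositional.Properties using (∈-deduplicate⁺; ∈-filter⁺)
  open import Data.List.Relation.Unary.All as All using (All; []; _∷_)
  open import Data.List.Relation.Unary.All.Properties using (++⁺; replicate⁺)
  open import Data.List.Relation.Unary.Any using (here; there)
  open import Data.List.Relation.Unary.Unique.Propositional using (Unique)
  open import Data.List.Relation.Unary.AllPairs using ([]; _∷_)
  open import Data.List.Relation.Unary.Unique.DecPropositional.Properties ℕ._≟_ using (deduplicate-!)
  open import Data.List.Relation.Binary.Permutation.Propositional as ↭ using (_↭_)
  open import Data.List.Relation.Binary.Permutation.Propositional.Properties using (↭-length; filter-↭)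
  open import Data.Product using (∃; _×_; _,_; proj₁; proj₂)
  open import Data.Sum using (inj₁; inj₂)
  open import Relation.Nullary using (yes; no; contradiction)
  open import Relation.Binary.PropositionalEquality
  open Convergence
  open ≤-Reasoning
  open +-*-Solver using (solve; _:=_; _:+_; _:*_; _:-_; :-_; con)

  -- Rational estimates

  0≤-diff : ∀ {a b} → 0ℚ ≤ b - a → a ≤ b
  0≤-diff {a} {b} h = begin
    a             ≡⟨ +-identityʳ a ⟨
    a + 0ℚ        ≤⟨ +-monoʳ-≤ a h ⟩
    a + (b - a)   ≡⟨ solve 2 (λ a b → a :+ (b :- a) := b) refl a b ⟩
    b             ∎

  0≤-square : ∀ a → 0ℚ ≤ a * a
  0≤-square a with ≤-total 0ℚ a
  ... | inj₁ 0≤a = 0≤* 0≤a 0≤a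
  ... | inj₂ a≤0 = subst (0ℚ ≤_) (solve 1 (λ a → :- a :* :- a := a :* a) refl a)
                     (0≤* (neg-antimono-≤ a≤0) (neg-antimono-≤ a≤0))

  p≤∣p∣ : ∀ p → p ≤ ∣ p ∣
  p≤∣p∣ p with ∣p∣≡p∨∣p∣≡-p p
  ... | inj₁ eq = ≤-reflexive (sym eq)
  ... | inj₂ eq with ≤-total 0ℚ p
  ...   | inj₁ 0≤p = ≤-reflexive (sym (0≤p⇒∣p∣≡p 0≤p))
  ...   | inj₂ p≤0 = ≤-trans p≤0 (0≤∣p∣ p)

  -p≤∣p∣ : ∀ p → - p ≤ ∣ p ∣
  -p≤∣p∣ p = ≤-trans (p≤∣p∣ (- p)) (≤-reflexive (∣-p∣≡∣p∣ p))

  ∣p∣≤⇒≤ : ∀ {p q} → ∣ p ∣ ≤ q → p ≤ q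
  ∣p∣≤⇒≤ {p} = ≤-trans (p≤∣p∣ p)

  abs-≤ : ∀ {p q} → ∣ p ∣ ≤ q → - q ≤ p
  abs-≤ {p} {q} h = begin
    - q     ≤⟨ neg-antimono-≤ (≤-trans (-p≤∣p∣ p) h) ⟩
    - - p   ≡⟨ solve 1 (λ p → :- :- p := p) refl p ⟩
    p       ∎

  ∣p∣-≤0 : ∀ {p} → p ≤ 0ℚ → ∣ p ∣ ≡ - p
  ∣p∣-≤0 {p} p≤0 = trans (sym (∣-p∣≡∣p∣ p)) (0≤p⇒∣p∣≡p (neg-antimono-≤ p≤0))

  0<ι : ∀ {m} → 0 ℕ.< m → 0ℚ < ι m
  0<ι {suc m} _ = ι-suc-pos m

  opaque
    unfolding ι
    ι≡ : ∀ n → ι n ≡ + n / 1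
    ι≡ n = refl

  -- The integer is a successor so that it can serve as a denominator, that is, as a number of equal
  -- steps.
  archimedean-suc : ∀ {C ε} → 0ℚ ≤ C → 0ℚ < ε → ∃ λ N → C ≤ ι (suc N) * ε
  archimedean-suc {C} {ε} 0≤C 0<ε =
    let δ , 0<δ , eq = rescale {ε} {C + 1ℚ} 0<ε 0<C+1
        N , 1≤Nδ = archimedean δ 0<δ
    in N , (begin
      C                      ≤⟨ ≤-trans (≤-reflexive (sym (+-identityʳ C))) (+-monoʳ-≤ C 0≤1ℚ) ⟩
      C + 1ℚ                 ≡⟨ *-identityʳ (C + 1ℚ) ⟨
      (C + 1ℚ) * 1ℚ          ≤⟨ *-monoˡ (<⇒≤ 0<C+1) 1≤Nδ ⟩
      (C + 1ℚ) * (ι N * δ)   ≡⟨ solve 3 (λ a b c → a :* (b :* c) := b :* (a :* c)) refl (C + 1ℚ) (ι N) δ ⟩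
      ι N * ((C + 1ℚ) * δ)   ≡⟨ cong (ι N *_) eq ⟩
      ι N * ε                ≤⟨ *-monoʳ (<⇒≤ 0<ε) (ι-mono (ℕₚ.n≤1+n N)) ⟩
      ι (suc N) * ε          ∎)
    where
    0<C+1 : 0ℚ < C + 1ℚ
    0<C+1 = +-mono-≤-< 0≤C 0<1

  ι-suc : ∀ n → ι (suc n) ≡ 1ℚ + ι n
  ι-suc n = trans (ι-+ 1 n) (cong (_+ ι n) ι-1)

  -- Asymptotically nonnegative and null sequences

  infix 4 _≳0
  -- The lower limit is nonnegative. `x ≤ᴿ y` amounts to this for the difference of the two
  -- sequences; stated for bare sequences, it lets terms of several reals be combined index by
  -- index.
  record _≳0 (x : ℕ → ℚ) : Set where
    constructor mk≳0
    field
      eventually : ∀ ε → 0ℚ < ε → ∃ λ N → ∀ n → N ℕ.≤ n → 0ℚ ≤ x n + ε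
  open _≳0 public

  module _ {x y : ℕ → ℚ} where
    ≳0-resp : (∀ k → x k ≡ y k) → x ≳0 → y ≳0
    ≳0-resp x≗y x≳0 = mk≳0 λ ε 0<ε → let N , h = eventually x≳0 ε 0<ε in
      N , λ n N≤n → subst (λ q → 0ℚ ≤ q + ε) (x≗y n) (h n N≤n)

    ≳0-mono : (∀ k → x k ≤ y k) → x ≳0 → y ≳0
    ≳0-mono x≤y x≳0 = mk≳0 λ ε 0<ε → let N , h = eventually x≳0 ε 0<ε in
      N , λ n N≤n → ≤-trans (h n N≤n) (+-monoˡ-≤ ε (x≤y n))

    ≳0-+ : x ≳0 → y ≳0 → (λ k → x k + y k) ≳0
    ≳0-+ x≳0 y≳0 = mk≳0 λ ε 0<ε →
      let δ , 0<δ , 2δ≡ε = rescale {ε} {2ℚ} 0<ε (positive⁻¹ 2ℚ)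
          M , f = eventually x≳0 δ 0<δ
          N , g = eventually y≳0 δ 0<δ
      in M ℕ.⊔ N , λ n p → begin
        0ℚ                      ≤⟨ +-mono-≤ (f n (⊔-≤ˡ {M} {N} p)) (g n (⊔-≤ʳ {M} {N} p)) ⟩
        (x n + δ) + (y n + δ)   ≡⟨ solve 3 (λ x y δ → (x :+ δ) :+ (y :+ δ) := x :+ y :+ con 2ℚ :* δ) refl (x n) (y n) δ ⟩
        x n + y n + 2ℚ * δ      ≡⟨ cong (λ q → x n + y n + q) 2δ≡ε ⟩
        x n + y n + ε           ∎

  module _ {x : ℕ → ℚ} where
    ≳0-pointwise : (∀ k → 0ℚ ≤ x k) → x ≳0
    ≳0-pointwise 0≤x = mk≳0 λ ε 0<ε → 0 , λ n _ → +-mono-≤ (0≤x n) (<⇒≤ 0<ε)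

    ≳0-*ˡ : ∀ {c} → 0ℚ ≤ c → x ≳0 → (λ k → c * x k) ≳0
    ≳0-*ˡ {c} 0≤c x≳0 = mk≳0 λ ε 0<ε →
      let δ , 0<δ , eq = rescale {ε} {c + 1ℚ} 0<ε (+-mono-≤-< 0≤c 0<1)
          N , h = eventually x≳0 δ 0<δ
      in N , λ n N≤n → begin
        0ℚ                    ≤⟨ +-mono-≤ (0≤* 0≤c (h n N≤n)) (<⇒≤ 0<δ) ⟩
        c * (x n + δ) + δ     ≡⟨ solve 3 (λ c x δ → c :* (x :+ δ) :+ δ := c :* x :+ (c :+ con 1ℚ) :* δ) refl c (x n) δ ⟩
        c * x n + (c + 1ℚ) * δ ≡⟨ cong (λ q → c * x n + q) eq ⟩
        c * x n + ε           ∎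

    ≳0-cancel : ∀ {c} → 0ℚ < c → (λ k → c * x k) ≳0 → x ≳0
    ≳0-cancel {c} 0<c cx≳0 = mk≳0 λ ε 0<ε →
      let N , h = eventually cx≳0 (c * ε) (0<* 0<c 0<ε)
      in N , λ n N≤n → *-cancelˡ-≤-pos c {{positive 0<c}} (begin
        c * 0ℚ            ≡⟨ *-zeroʳ c ⟩
        0ℚ                ≤⟨ h n N≤n ⟩
        c * x n + c * ε   ≡⟨ *-distribˡ-+ c (x n) ε ⟨
        c * (x n + ε)     ∎)

    -- Lets an auxiliary parameter, such as the number of subdivision steps, depend on `ε` and stay
    -- fixed while the index grows.
    ≳0-limit : (∀ ε → 0ℚ < ε → (λ k → x k + ε) ≳0) → x ≳0
    ≳0-limit h = mk≳0 λ ε 0<ε →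
      let δ , 0<δ , 2δ≡ε = rescale {ε} {2ℚ} 0<ε (positive⁻¹ 2ℚ)
          N , g = eventually (h δ 0<δ) δ 0<δ
      in N , λ n N≤n → begin
        0ℚ                ≤⟨ g n N≤n ⟩
        x n + δ + δ       ≡⟨ solve 2 (λ x δ → x :+ δ :+ δ := x :+ con 2ℚ :* δ) refl (x n) δ ⟩
        x n + 2ℚ * δ      ≡⟨ cong (λ q → x n + q) 2δ≡ε ⟩
        x n + ε           ∎

  ≳0-mono-from : ∀ {x y : ℕ → ℚ} m → (∀ k → m ℕ.≤ k → x k ≤ y k) → x ≳0 → y ≳0
  ≳0-mono-from m x≤y x≳0 = mk≳0 λ ε 0<ε → let N , h = eventually x≳0 ε 0<ε in
    m ℕ.⊔ N , λ n p → ≤-trans (h n (⊔-≤ʳ {m} {N} p)) (+-monoˡ-≤ ε (x≤y n (⊔-≤ˡ {m} {N} p)))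

  infix 4 _≈0
  record _≈0 (x : ℕ → ℚ) : Set where
    constructor mk≈0
    field
      ≈0⇒≳0  : x ≳0
      -≈0⇒≳0 : (λ k → - x k) ≳0
  open _≈0 public

  module _ {x y : ℕ → ℚ} where
    ≈0-resp : (∀ k → x k ≡ y k) → x ≈0 → y ≈0
    ≈0-resp x≗y (mk≈0 p q) = mk≈0 (≳0-resp x≗y p) (≳0-resp (λ k → cong -_ (x≗y k)) q)

    ≈0-+ : x ≈0 → y ≈0 → (λ k → x k + y k) ≈0
    ≈0-+ (mk≈0 p q) (mk≈0 p′ q′) =
      mk≈0 (≳0-+ p p′) (≳0-resp (λ k → sym (neg-distrib-+ (x k) (y k))) (≳0-+ q q′))

  ≈0-*ˡ : ∀ {x} c → x ≈0 → (λ k → c * x k) ≈0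
  ≈0-*ˡ {x} c (mk≈0 p q) with ≤-total 0ℚ c
  ... | inj₁ 0≤c = mk≈0 (≳0-*ˡ 0≤c p) (≳0-resp (λ k → sym (neg-distribʳ-* c (x k))) (≳0-*ˡ 0≤c q))
  ... | inj₂ c≤0 = mk≈0 (≳0-resp (λ k → solve 2 (λ c x → :- c :* :- x := c :* x) refl c (x k)) (≳0-*ˡ (neg-antimono-≤ c≤0) q))
                        (≳0-resp (λ k → solve 2 (λ c x → :- c :* x := :- (c :* x)) refl c (x k)) (≳0-*ˡ (neg-antimono-≤ c≤0) p))

  ≈0-zero : ∀ {x} → (∀ k → x k ≡ 0ℚ) → x ≈0
  ≈0-zero x≗0 = mk≈0 (≳0-pointwise λ k → ≤-reflexive (sym (x≗0 k)))
                     (≳0-pointwise λ k → ≤-reflexive (sym (cong -_ (x≗0 k))))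

  -- The logarithm

  -- Convexity of powers on the nonnegative half-line, with the tangent taken at `z`. In the
  -- induction the new slack is `w` times the previous slack plus `ι (suc m) * z ^ m` times the
  -- square of `w - z`.
  pow-tangent : ∀ {z w} m → 0ℚ ≤ z → 0ℚ ≤ w → z ^ suc m - w ^ suc m ≤ ι (suc m) * z ^ m * (z - w)
  pow-tangent {z} {w} zero 0≤z 0≤w = ≤-reflexive (begin-equality
    z * 1ℚ - w * 1ℚ      ≡⟨ solve 2 (λ z w → z :* con 1ℚ :- w :* con 1ℚ := con 1ℚ :* con 1ℚ :* (z :- w)) refl z w ⟩
    1ℚ * 1ℚ * (z - w)    ≡⟨ cong (λ i → i * 1ℚ * (z - w)) ι-1 ⟨
    ι 1 * 1ℚ * (z - w)   ∎)
  pow-tangent {z} {w} (suc m) 0≤z 0≤w = 0≤-diff (begin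
    0ℚ ≤⟨ +-mono-≤ (0≤* 0≤w (≤-diff (pow-tangent m 0≤z 0≤w)))
                   (0≤* (0≤* (0≤ι (suc m)) (0≤^ m 0≤z)) (0≤-square (w - z))) ⟩
    w * (i * Z * (z - w) - (z * Z - w * W)) + i * Z * ((w - z) * (w - z))
       ≡⟨ solve 5 (λ z w i Z W →
            w :* (i :* Z :* (z :- w) :- (z :* Z :- w :* W)) :+ i :* Z :* ((w :- z) :* (w :- z)) :=
            (con 1ℚ :+ i) :* (z :* Z) :* (z :- w) :- (z :* (z :* Z) :- w :* (w :* W))) refl z w i Z W ⟩
    (1ℚ + i) * (z * Z) * (z - w) - (z * (z * Z) - w * (w * W))
       ≡⟨ cong (λ j → j * (z * Z) * (z - w) - (z * (z * Z) - w * (w * W))) (trans (ι-+ 1 (suc m)) (cong (_+ i) ι-1)) ⟨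
    ι (suc (suc m)) * (z * Z) * (z - w) - (z * (z * Z) - w * (w * W)) ∎)
    where
    i = ι (suc m)
    Z = z ^ m
    W = w ^ m

  pow-double : ∀ z k → z ^ (2 ℕ.* k) ≡ (z * z) ^ k
  pow-double z zero    = refl
  pow-double z (suc k) = trans (cong (λ j → z * z ^ j) (ℕₚ.+-suc k (k ℕ.+ 0)))
    (trans (sym (*-assoc z z _)) (cong ((z * z) *_) (pow-double z k)))

  artanhTerm-tangent : ∀ {z w} k → 0ℚ ≤ z → 0ℚ ≤ w → artanhTerm z k - artanhTerm w k ≤ (z * z) ^ k * (z - w)
  artanhTerm-tangent {z} {w} k 0≤z 0≤w = begin
    z ^ m * r - w ^ m * r          ≡⟨ solve 3 (λ a b r → a :* r :- b :* r := (a :- b) :* r) refl (z ^ m) (w ^ m) r ⟩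
    (z ^ m - w ^ m) * r            ≤⟨ *-monoʳ (0≤1/ m) (pow-tangent (2 ℕ.* k) 0≤z 0≤w) ⟩
    ι m * Z * (z - w) * r          ≡⟨ solve 4 (λ i Z d r → i :* Z :* d :* r := (i :* r) :* (Z :* d)) refl (ι m) Z (z - w) r ⟩
    ι m * r * (Z * (z - w))        ≡⟨ cong (_* (Z * (z - w))) (ι-/ m) ⟩
    1ℚ * (Z * (z - w))             ≡⟨ *-identityˡ _ ⟩
    Z * (z - w)                    ≡⟨ cong (_* (z - w)) (pow-double z k) ⟩
    (z * z) ^ k * (z - w)          ∎
    where
    m = suc (2 ℕ.* k)
    r = + 1 / m
    Z = z ^ (2 ℕ.* k)

  artanhSum : ℚ → ℕ → ℚ
  artanhSum z n = Σ< n (artanhTerm z)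

  -- The derivatives of the terms at `z` form the geometric series of ratio `z * z`, with sum 1/(1 -
  -- z²). Multiplying by `1ℚ - z * z` telescopes it and keeps division out.
  artanhSum-tangent : ∀ {z w} n → 0ℚ ≤ z → 0ℚ ≤ w → z * z ≤ 1ℚ →
    (1ℚ - z * z) * (artanhSum z n - artanhSum w n) ≤ (1ℚ - (z * z) ^ n) * (z - w)
  artanhSum-tangent {z} {w} zero 0≤z 0≤w zz≤1 = ≤-reflexive
    (solve 2 (λ z w → (con 1ℚ :- z :* z) :* (con 0ℚ :- con 0ℚ) := (con 1ℚ :- con 1ℚ) :* (z :- w)) refl z w)
  artanhSum-tangent {z} {w} (suc n) 0≤z 0≤w zz≤1 = begin
    (1ℚ - r) * ((A + a) - (B + b))            ≡⟨ solve 5 (λ r A a B b → (con 1ℚ :- r) :* ((A :+ a) :- (B :+ b)) := (con 1ℚ :- r) :* (A :- B) :+ (con 1ℚ :- r) :* (a :- b)) refl r A a B b ⟩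
    (1ℚ - r) * (A - B) + (1ℚ - r) * (a - b)   ≤⟨ +-mono-≤ (artanhSum-tangent n 0≤z 0≤w zz≤1) (*-monoˡ (≤-diff zz≤1) (artanhTerm-tangent n 0≤z 0≤w)) ⟩
    (1ℚ - R) * d + (1ℚ - r) * (R * d)         ≡⟨ solve 3 (λ R r d → (con 1ℚ :- R) :* d :+ (con 1ℚ :- r) :* (R :* d) := (con 1ℚ :- r :* R) :* d) refl R r d ⟩
    (1ℚ - r * R) * d                          ∎
    where
    r = z * z
    R = r ^ n
    d = z - w
    A = artanhSum z n
    B = artanhSum w n
    a = artanhTerm z n
    b = artanhTerm w n

  artanh-tangent⁺ : ∀ {z w} → 0ℚ ≤ z → z < 1ℚ → 0ℚ ≤ w → w ≤ 1ℚ →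
    (λ n → z - w - (1ℚ - z * z) * (artanhSum z n - artanhSum w n)) ≳0
  artanh-tangent⁺ {z} {w} 0≤z z<1 0≤w w≤1 = mk≳0 λ ε 0<ε → proj₁ (R-small ε 0<ε) , λ n N≤n → begin
    0ℚ
      -- The finite bound differs from the limit by `R n * (z - w)`, which is at least `- R n`
      -- because `0 ≤ z` and `w ≤ 1`, and `R n ≤ ε` from some index on.
      ≤⟨ +-mono-≤ (+-mono-≤ (≤-diff (artanhSum-tangent n 0≤z 0≤w (<⇒≤ r<1)))
                            (0≤* (0≤^ n 0≤r) (+-mono-≤ 0≤z (≤-diff w≤1))))
                  (≤-diff (proj₂ (R-small ε 0<ε) n N≤n)) ⟩
    (1ℚ - R n) * (z - w) - Y n + R n * (z + (1ℚ - w)) + (ε - R n)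
      ≡⟨ solve 5 (λ R z w Y ε → (con 1ℚ :- R) :* (z :- w) :- Y :+ R :* (z :+ (con 1ℚ :- w)) :+ (ε :- R) := z :- w :- Y :+ ε) refl (R n) z w (Y n) ε ⟩
    z - w - Y n + ε ∎
    where
    r = z * z
    R Y : ℕ → ℚ
    R n = r ^ n
    Y n = (1ℚ - z * z) * (artanhSum z n - artanhSum w n)
    0≤r : 0ℚ ≤ r
    0≤r = 0≤-square z
    r<1 : r < 1ℚ
    r<1 = begin-strict
      z * z   ≤⟨ *-monoˡ 0≤z (<⇒≤ z<1) ⟩
      z * 1ℚ  ≡⟨ *-identityʳ z ⟩
      z       <⟨ z<1 ⟩
      1ℚ      ∎
    open Geometric (λ _ → 0ℚ) 0ℚ r ≤-refl 0≤r r<1 (λ k → ≤-reflexive (sym (*-zeroˡ (r ^ k)))) using (s; 0<s; small)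
    R-small : ∀ ε → 0ℚ < ε → ∃ λ N → ∀ n → N ℕ.≤ n → R n ≤ ε
    R-small ε 0<ε = let N , h = small (ε * s) (0<* 0<ε 0<s) in
      N , λ n N≤n → *-cancelʳ-≤-pos s {{positive 0<s}} (h n N≤n)

  opaque
    ℓ : ℚ → ℕ → ℚ
    ℓ q = seq (log q)

    ℓ≡log : ∀ q k → ℓ q k ≡ seq (log q) k
    ℓ≡log q k = refl

  module _ (q : ℚ) (0<q : 0ℚ < q) where
    private
      z = cayley q 0<q
      0<q+1 : 0ℚ < q + 1ℚ
      0<q+1 = +-mono-< 0<q 0<1

    cayley-eq : cayley q 0<q * (q + 1ℚ) ≡ q - 1ℚ
    cayley-eq = trans (*-assoc (q - 1ℚ) (1/ (q + 1ℚ)) (q + 1ℚ))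
      (trans (cong ((q - 1ℚ) *_) (*-inverseˡ (q + 1ℚ))) (*-identityʳ (q - 1ℚ)))
      where
      instance
        nz : Data.Rational.NonZero (q + 1ℚ)
        nz = pos⇒nonZero (q + 1ℚ) {{positive 0<q+1}}

    cayley<1 : cayley q 0<q < 1ℚ
    cayley<1 = ≤-<-trans (p≤∣p∣ z) (∣cayley∣<1 q 0<q)

    -cayley<1 : - cayley q 0<q < 1ℚ
    -cayley<1 = ≤-<-trans (-p≤∣p∣ z) (∣cayley∣<1 q 0<q)

    0≤cayley : 1ℚ ≤ q → 0ℚ ≤ cayley q 0<q
    0≤cayley 1≤q = *-cancelʳ-≤-pos (q + 1ℚ) {{positive 0<q+1}} (begin
      0ℚ * (q + 1ℚ)  ≡⟨ *-zeroˡ (q + 1ℚ) ⟩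
      0ℚ             ≤⟨ ≤-diff 1≤q ⟩
      q - 1ℚ         ≡⟨ cayley-eq ⟨
      z * (q + 1ℚ)   ∎)

    cayley≤0 : q ≤ 1ℚ → cayley q 0<q ≤ 0ℚ
    cayley≤0 q≤1 = *-cancelʳ-≤-pos (q + 1ℚ) {{positive 0<q+1}} (begin
      z * (q + 1ℚ)   ≡⟨ cayley-eq ⟩
      q - 1ℚ         ≤⟨ +-monoˡ-≤ (- 1ℚ) q≤1 ⟩
      1ℚ - 1ℚ        ≡⟨ *-zeroˡ (q + 1ℚ) ⟨
      0ℚ * (q + 1ℚ)  ∎)

    log≡artanhSum : ∀ k → seq (log q) k ≡ 2ℚ * artanhSum (cayley q 0<q) k
    log≡artanhSum k with 0ℚ <? q
    ... | yes _   = refl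
    ... | no 0≮q = contradiction 0<q 0≮q

    ℓ≡artanhSum : ∀ k → ℓ q k ≡ 2ℚ * artanhSum (cayley q 0<q) k
    ℓ≡artanhSum k = trans (ℓ≡log q k) (log≡artanhSum k)

  artanhTerm-neg : ∀ z k → artanhTerm (- z) k ≡ - artanhTerm z k
  artanhTerm-neg z k = begin-equality
    - z * (- z) ^ (2 ℕ.* k) * r   ≡⟨ cong (λ p → - z * p * r) (trans (pow-double (- z) k) (cong (_^ k) (solve 1 (λ z → :- z :* :- z := z :* z) refl z))) ⟩
    - z * (z * z) ^ k * r         ≡⟨ cong (λ p → - z * p * r) (pow-double z k) ⟨
    - z * z ^ (2 ℕ.* k) * r       ≡⟨ solve 3 (λ z Z r → :- z :* Z :* r := :- (z :* Z :* r)) refl z (z ^ (2 ℕ.* k)) r ⟩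
    - (z * z ^ (2 ℕ.* k) * r)     ∎
    where r = + 1 / suc (2 ℕ.* k)

  artanhSum-neg : ∀ z n → artanhSum (- z) n ≡ - artanhSum z n
  artanhSum-neg z zero    = refl
  artanhSum-neg z (suc n) = trans (cong₂ _+_ (artanhSum-neg z n) (artanhTerm-neg z n))
    (sym (neg-distrib-+ (artanhSum z n) (artanhTerm z n)))

  -- artanh is odd, hence concave for nonpositive arguments, so the useful tangent is now the one at
  -- `w`. The bound for nonnegative arguments is applied to `- w` and `- z`.
  artanh-tangent⁻ : ∀ {z w} → z ≤ 0ℚ → - 1ℚ ≤ z → w ≤ 0ℚ → - w < 1ℚ →
    (λ n → z - w - (1ℚ - w * w) * (artanhSum z n - artanhSum w n)) ≳0
  artanh-tangent⁻ {z} {w} z≤0 -1≤z w≤0 -w<1 = ≳0-resp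
    (λ n → trans (cong₂ (λ A B → - w - - z - (1ℚ - - w * - w) * (B - A)) (artanhSum-neg z n) (artanhSum-neg w n))
      (solve 4 (λ z w A B → :- w :- :- z :- (con 1ℚ :- :- w :* :- w) :* (:- B :- :- A)
                  := z :- w :- (con 1ℚ :- w :* w) :* (A :- B)) refl z w (artanhSum z n) (artanhSum w n)))
    (artanh-tangent⁺ (neg-antimono-≤ w≤0) -w<1 (neg-antimono-≤ z≤0) (neg-antimono-≤ -1≤z))

  module _ {s t z w : ℚ} (zt : z * (t + 1ℚ) ≡ t - 1ℚ) (ws : w * (s + 1ℚ) ≡ s - 1ℚ) (A B : ℚ) where
    -- The coefficients clear the denominators in z - w = 2(t - s)/((t + 1)(s + 1)) and 1 - z² =
    -- 4t/(t + 1)². The tangent bound for artanh is sharper than the one wanted for the logarithm;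
    -- the square of `t - s` is what is given away.
    cayley-tangent⁺ : ½ * s * ((t + 1ℚ) * (t + 1ℚ) * (s + 1ℚ)) * (z - w - (1ℚ - z * z) * (A - B)) + (t - s) * (t - s)
      ≡ (s + 1ℚ) * t * (t - s - s * (2ℚ * A - 2ℚ * B))
    cayley-tangent⁺ = begin-equality
      ½ * s * (T * T * S) * (z - w - (1ℚ - z * z) * (A - B)) + (t - s) * (t - s)
        ≡⟨ solve 8 (λ s t z w T S A B → con ½ :* s :* (T :* T :* S) :* (z :- w :- (con 1ℚ :- z :* z) :* (A :- B)) :+ (t :- s) :* (t :- s)
             := con ½ :* s :* (T :* (S :* (z :* T) :- T :* (w :* S)) :- (T :* T :- (z :* T) :* (z :* T)) :* S :* (A :- B)) :+ (t :- s) :* (t :- s))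
           refl s t z w T S A B ⟩
      ½ * s * (T * (S * (z * T) - T * (w * S)) - (T * T - (z * T) * (z * T)) * S * (A - B)) + (t - s) * (t - s)
        ≡⟨ cong₂ (λ x y → ½ * s * (T * (S * x - T * y) - (T * T - x * x) * S * (A - B)) + (t - s) * (t - s)) zt ws ⟩
      ½ * s * (T * (S * (t - 1ℚ) - T * (s - 1ℚ)) - (T * T - (t - 1ℚ) * (t - 1ℚ)) * S * (A - B)) + (t - s) * (t - s)
        ≡⟨ solve 4 (λ s t A B → let T = t :+ con 1ℚ ; S = s :+ con 1ℚ in
             con ½ :* s :* (T :* (S :* (t :- con 1ℚ) :- T :* (s :- con 1ℚ)) :- (T :* T :- (t :- con 1ℚ) :* (t :- con 1ℚ)) :* S :* (A :- B)) :+ (t :- s) :* (t :- s)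
             := S :* t :* (t :- s :- s :* (con 2ℚ :* A :- con 2ℚ :* B))) refl s t A B ⟩
      S * t * (t - s - s * (2ℚ * A - 2ℚ * B)) ∎
      where
      T = t + 1ℚ
      S = s + 1ℚ

    cayley-tangent⁻ : ½ * ((s + 1ℚ) * (s + 1ℚ) * (t + 1ℚ)) * (z - w - (1ℚ - w * w) * (A - B)) + (t - s) * (t - s)
      ≡ (t + 1ℚ) * (t - s - s * (2ℚ * A - 2ℚ * B))
    cayley-tangent⁻ = begin-equality
      ½ * (S * S * T) * (z - w - (1ℚ - w * w) * (A - B)) + (t - s) * (t - s)
        ≡⟨ solve 8 (λ s t z w T S A B → con ½ :* (S :* S :* T) :* (z :- w :- (con 1ℚ :- w :* w) :* (A :- B)) :+ (t :- s) :* (t :- s)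
             := con ½ :* (S :* (S :* (z :* T) :- T :* (w :* S)) :- (S :* S :- (w :* S) :* (w :* S)) :* T :* (A :- B)) :+ (t :- s) :* (t :- s))
           refl s t z w T S A B ⟩
      ½ * (S * (S * (z * T) - T * (w * S)) - (S * S - (w * S) * (w * S)) * T * (A - B)) + (t - s) * (t - s)
        ≡⟨ cong₂ (λ x y → ½ * (S * (S * x - T * y) - (S * S - y * y) * T * (A - B)) + (t - s) * (t - s)) zt ws ⟩
      ½ * (S * (S * (t - 1ℚ) - T * (s - 1ℚ)) - (S * S - (s - 1ℚ) * (s - 1ℚ)) * T * (A - B)) + (t - s) * (t - s)
        ≡⟨ solve 4 (λ s t A B → let T = t :+ con 1ℚ ; S = s :+ con 1ℚ in
             con ½ :* (S :* (S :* (t :- con 1ℚ) :- T :* (s :- con 1ℚ)) :- (S :* S :- (s :- con 1ℚ) :* (s :- con 1ℚ)) :* T :* (A :- B)) :+ (t :- s) :* (t :- s)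
             := T :* (t :- s :- s :* (con 2ℚ :* A :- con 2ℚ :* B))) refl s t A B ⟩
      T * (t - s - s * (2ℚ * A - 2ℚ * B)) ∎
      where
      T = t + 1ℚ
      S = s + 1ℚ

  module _ {s t : ℚ} (0<s : 0ℚ < s) (0<t : 0ℚ < t) where
    private
      z = cayley t 0<t
      w = cayley s 0<s
      0<S : 0ℚ < s + 1ℚ
      0<S = +-mono-< 0<s 0<1
      0<T : 0ℚ < t + 1ℚ
      0<T = +-mono-< 0<t 0<1
      0≤½*s : 0ℚ ≤ ½ * s
      0≤½*s = 0≤* 0≤½ (<⇒≤ 0<s)

      fold-ℓ : ∀ c k → c * (t - s - s * (2ℚ * artanhSum z k - 2ℚ * artanhSum w k)) ≡ c * (t - s - s * (ℓ t k - ℓ s k))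
      fold-ℓ c k = cong₂ (λ a b → c * (t - s - s * (a - b))) (sym (ℓ≡artanhSum t 0<t k)) (sym (ℓ≡artanhSum s 0<s k))

    log-tangent⁺ : 1ℚ ≤ s → 1ℚ ≤ t → (λ k → t - s - s * (ℓ t k - ℓ s k)) ≳0
    log-tangent⁺ 1≤s 1≤t = ≳0-cancel (0<* 0<S 0<t) (≳0-resp
      (λ k → trans (cayley-tangent⁺ {s} {t} {z} {w} (cayley-eq t 0<t) (cayley-eq s 0<s) (artanhSum z k) (artanhSum w k)) (fold-ℓ ((s + 1ℚ) * t) k))
      (≳0-+ (≳0-*ˡ (0≤* 0≤½*s (<⇒≤ (0<* (0<* 0<T 0<T) 0<S)))
              (artanh-tangent⁺ (0≤cayley t 0<t 1≤t) (cayley<1 t 0<t) (0≤cayley s 0<s 1≤s) (<⇒≤ (cayley<1 s 0<s))))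
            (≳0-pointwise (λ k → 0≤-square (t - s)))))

    log-tangent⁻ : s ≤ 1ℚ → t ≤ 1ℚ → (λ k → t - s - s * (ℓ t k - ℓ s k)) ≳0
    log-tangent⁻ s≤1 t≤1 = ≳0-cancel 0<T (≳0-resp
      (λ k → trans (cayley-tangent⁻ {s} {t} {z} {w} (cayley-eq t 0<t) (cayley-eq s 0<s) (artanhSum z k) (artanhSum w k)) (fold-ℓ (t + 1ℚ) k))
      (≳0-+ (≳0-*ˡ (0≤* 0≤½ (<⇒≤ (0<* (0<* 0<S 0<S) 0<T)))
              (artanh-tangent⁻ (cayley≤0 t 0<t t≤1) -1≤z (cayley≤0 s 0<s s≤1) (-cayley<1 s 0<s)))
            (≳0-pointwise (λ k → 0≤-square (t - s)))))
      where
      -1≤z : - 1ℚ ≤ z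
      -1≤z = begin
        - 1ℚ   ≤⟨ neg-antimono-≤ (<⇒≤ (-cayley<1 t 0<t)) ⟩
        - - z  ≡⟨ solve 1 (λ z → :- :- z := z) refl z ⟩
        z      ∎

  ℓ-1 : ∀ k → ℓ 1ℚ k ≡ 0ℚ
  ℓ-1 k = trans (ℓ≡artanhSum 1ℚ 0<1 k) (cong (2ℚ *_) (sum0 k))
    where
    sum0 : ∀ k → artanhSum 0ℚ k ≡ 0ℚ
    sum0 zero    = refl
    sum0 (suc k) = trans (cong₂ _+_ (sum0 k)
      (trans (cong (_* (+ 1 / suc (2 ℕ.* k))) (*-zeroˡ (0ℚ ^ (2 ℕ.* k)))) (*-zeroˡ (+ 1 / suc (2 ℕ.* k))))) refl

  -- artanh is convex on one side of 0 and concave on the other, so the direct bounds cover only `s`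
  -- and `t` on the same side of 1. When 1 separates them, the tangents at `s` and at 1 are chained,
  -- and `(t - 1ℚ) * (1ℚ - s)` is the slack.
  log-tangent-via-1 : ∀ {s t} → 0ℚ < s →
    (λ k → 1ℚ - s - s * (ℓ 1ℚ k - ℓ s k)) ≳0 → (λ k → t - 1ℚ - 1ℚ * (ℓ t k - ℓ 1ℚ k)) ≳0 →
    0ℚ ≤ (t - 1ℚ) * (1ℚ - s) → (λ k → t - s - s * (ℓ t k - ℓ s k)) ≳0
  log-tangent-via-1 {s} {t} 0<s s→1 1→t sides = ≳0-resp
    (λ k → solve 5 (λ s t a b o → s :* (t :- con 1ℚ :- con 1ℚ :* (a :- o)) :+ (con 1ℚ :- s :- s :* (o :- b)) :+ (t :- con 1ℚ) :* (con 1ℚ :- s)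
       := t :- s :- s :* (a :- b)) refl s t (ℓ t k) (ℓ s k) (ℓ 1ℚ k))
    (≳0-+ (≳0-+ (≳0-*ˡ (<⇒≤ 0<s) 1→t) s→1) (≳0-pointwise λ _ → sides))

  log-tangent : ∀ {s t} → 0ℚ < s → 0ℚ < t → (λ k → t - s - s * (ℓ t k - ℓ s k)) ≳0
  log-tangent {s} {t} 0<s 0<t with ≤-total s 1ℚ | ≤-total t 1ℚ
  ... | inj₁ s≤1 | inj₁ t≤1 = log-tangent⁻ 0<s 0<t s≤1 t≤1
  ... | inj₂ 1≤s | inj₂ 1≤t = log-tangent⁺ 0<s 0<t 1≤s 1≤t
  ... | inj₁ s≤1 | inj₂ 1≤t = log-tangent-via-1 {t = t} 0<s
          (log-tangent⁻ 0<s 0<1 s≤1 ≤-refl) (log-tangent⁺ 0<1 0<t ≤-refl 1≤t)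
          (0≤* (≤-diff 1≤t) (≤-diff s≤1))
  ... | inj₂ 1≤s | inj₁ t≤1 = log-tangent-via-1 {t = t} 0<s
          (log-tangent⁺ 0<s 0<1 1≤s ≤-refl) (log-tangent⁻ 0<1 0<t ≤-refl t≤1)
          (subst (0ℚ ≤_) (solve 2 (λ s t → (con 1ℚ :- t) :* (s :- con 1ℚ) := (t :- con 1ℚ) :* (con 1ℚ :- s)) refl s t)
            (0≤* (≤-diff t≤1) (≤-diff 1≤s)))

  -- Additivity of the logarithm by subdivision

  module _ (D : ℚ → ℕ → ℚ) {m K : ℚ} (0≤K : 0ℚ ≤ K)
           (step : ∀ s t → m ≤ s → m ≤ t → (λ k → K * ((t - s) * (t - s)) + D s k - D t k) ≳0)
           {a b : ℚ} (m≤a : m ≤ a) (m≤b : m ≤ b) where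
    private
      C : ℚ
      C = K * ((b - a) * (b - a))

      0≤C : 0ℚ ≤ C
      0≤C = 0≤* 0≤K (0≤-square (b - a))

      module Path (M : ℕ) {{_ : NonZero M}} where
        r d : ℚ
        r = + 1 / M
        d = r * (b - a)

        p : ℕ → ℚ
        p j = a + ι j * d

        -- Each division point is a convex combination of `a` and `b`, so the increment bound,
        -- available only above `m`, applies to every step.
        m≤p : ∀ j → j ℕ.≤ M → m ≤ p j
        m≤p j j≤M = 0≤-diff (begin
          0ℚ
            ≤⟨ +-mono-≤ (0≤* (≤-diff jr≤1) (≤-diff m≤a)) (0≤* (0≤* (0≤ι j) (0≤1/ M)) (≤-diff m≤b)) ⟩
          (1ℚ - ι j * r) * (a - m) + ι j * r * (b - m)
            ≡⟨ solve 5 (λ j r a b m → (con 1ℚ :- j :* r) :* (a :- m) :+ j :* r :* (b :- m) := a :+ j :* (r :* (b :- a)) :- m) refl (ι j) r a b m ⟩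
          p j - m ∎)
          where
          jr≤1 : ι j * r ≤ 1ℚ
          jr≤1 = ≤-trans (*-monoʳ (0≤1/ M) (ι-mono j≤M)) (≤-reflexive (ι-/ M))

        along : ∀ j → j ℕ.≤ M → (λ k → ι j * (K * (d * d)) + D a k - D (p j) k) ≳0
        along zero _ = ≳0-pointwise λ k → ≤-reflexive (sym (begin-equality
          ι 0 * e + D a k - D (a + ι 0 * d) k  ≡⟨ cong (λ i → i * e + D a k - D (a + i * d) k) ι-0 ⟩
          0ℚ * e + D a k - D (a + 0ℚ * d) k    ≡⟨ cong (λ q → 0ℚ * e + D a k - D q k) (solve 2 (λ a d → a :+ con 0ℚ :* d := a) refl a d) ⟩
          0ℚ * e + D a k - D a k               ≡⟨ solve 2 (λ e x → con 0ℚ :* e :+ x :- x := con 0ℚ) refl e (D a k) ⟩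
          0ℚ                                   ∎))
          where e = K * (d * d)
        along (suc j) j<M = ≳0-resp
          (λ k → begin-equality
            ι j * (K * (d * d)) + D a k - D (p j) k + (K * ((p (suc j) - p j) * (p (suc j) - p j)) + D (p j) k - D (p (suc j)) k)
              ≡⟨ cong (λ δ → ι j * (K * (d * d)) + D a k - D (p j) k + (K * (δ * δ) + D (p j) k - D (p (suc j)) k)) Δ ⟩
            ι j * (K * (d * d)) + D a k - D (p j) k + (K * (d * d) + D (p j) k - D (p (suc j)) k)
              ≡⟨ solve 5 (λ i e x y z → i :* e :+ x :- y :+ (e :+ y :- z) := (con 1ℚ :+ i) :* e :+ x :- z) refl (ι j) (K * (d * d)) (D a k) (D (p j) k) (D (p (suc j)) k) ⟩
            (1ℚ + ι j) * (K * (d * d)) + D a k - D (p (suc j)) k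
              ≡⟨ cong (λ i → i * (K * (d * d)) + D a k - D (p (suc j)) k) (ι-suc j) ⟨
            ι (suc j) * (K * (d * d)) + D a k - D (p (suc j)) k ∎)
          (≳0-+ (along j (ℕₚ.<⇒≤ j<M)) (step (p j) (p (suc j)) (m≤p j (ℕₚ.<⇒≤ j<M)) (m≤p (suc j) j<M)))
          where
          Δ : p (suc j) - p j ≡ d
          Δ = trans (cong (λ i → a + i * d - p j) (ι-suc j))
                (solve 3 (λ a i d → a :+ (con 1ℚ :+ i) :* d :- (a :+ i :* d) := d) refl a (ι j) d)

        end : p M ≡ b
        end = begin-equality
          a + ι M * (r * (b - a))  ≡⟨ cong (λ q → a + q) (*-assoc (ι M) r (b - a)) ⟨
          a + ι M * r * (b - a)    ≡⟨ cong (λ q → a + q * (b - a)) (ι-/ M) ⟩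
          a + 1ℚ * (b - a)         ≡⟨ solve 2 (λ a b → a :+ con 1ℚ :* (b :- a) := b) refl a b ⟩
          b                        ∎

        total≤ : ∀ {ε} → C ≤ ι M * ε → ι M * (K * (d * d)) ≤ ε
        total≤ {ε} C≤Mε = begin
          ι M * (K * (d * d))     ≡⟨ solve 4 (λ i K r e → i :* (K :* ((r :* e) :* (r :* e))) := (i :* r) :* (K :* (e :* e) :* r)) refl (ι M) K r (b - a) ⟩
          ι M * r * (C * r)       ≡⟨ cong (_* (C * r)) (ι-/ M) ⟩
          1ℚ * (C * r)            ≡⟨ *-identityˡ (C * r) ⟩
          C * r                   ≤⟨ *-monoʳ (0≤1/ M) C≤Mε ⟩
          ι M * ε * r             ≡⟨ solve 3 (λ i e r → i :* e :* r := (i :* r) :* e) refl (ι M) ε r ⟩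
          ι M * r * ε             ≡⟨ cong (_* ε) (ι-/ M) ⟩
          1ℚ * ε                  ≡⟨ *-identityˡ ε ⟩
          ε                       ∎

    -- Cut the segment from a to b into M equal steps: the total increment is O(1/M).
    quadratic-increments⇒nonincreasing : (λ k → D a k - D b k) ≳0
    quadratic-increments⇒nonincreasing = ≳0-limit λ ε 0<ε →
      let N , C≤Mε = archimedean-suc 0≤C 0<ε
          open Path (suc N)
      in ≳0-mono
        (λ k → begin
          ι (suc N) * (K * (d * d)) + D a k - D (p (suc N)) k ≡⟨ cong (λ q → ι (suc N) * (K * (d * d)) + D a k - D q k) end ⟩
          ι (suc N) * (K * (d * d)) + D a k - D b k           ≤⟨ +-monoˡ-≤ (- D b k) (+-monoˡ-≤ (D a k) (total≤ C≤Mε)) ⟩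
          ε + D a k - D b k                                   ≡⟨ solve 3 (λ e x y → e :+ x :- y := x :- y :+ e) refl ε (D a k) (D b k) ⟩
          D a k - D b k + ε                                   ∎)
        (along (suc N) ℕₚ.≤-refl)

  module _ {c : ℚ} (0<c : 0ℚ < c) {m : ℚ} (0<m : 0ℚ < m) where
    private
      K : ℚ
      K = proj₁ (rescale 0<1 (0<* 0<m 0<m))
      0<K : 0ℚ < K
      0<K = proj₁ (proj₂ (rescale 0<1 (0<* 0<m 0<m)))
      mmK : m * m * K ≡ 1ℚ
      mmK = proj₂ (proj₂ (rescale 0<1 (0<* 0<m 0<m)))

    -- The tangent inequality in both directions puts L(t) - L(s) between (t - s)/t and (t - s)/s,
    -- and likewise L(ct) - L(cs). The two increments thus differ by at most (t - s)²/(st), and `K`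
    -- is 1/m², which bounds 1/(st).
    ratio-increment : ∀ s t → m ≤ s → m ≤ t →
      (λ k → K * ((t - s) * (t - s)) + (ℓ (c * s) k - ℓ s k) - (ℓ (c * t) k - ℓ t k)) ≳0
    ratio-increment s t m≤s m≤t = ≳0-cancel (0<* (0<* 0<c 0<s) 0<t) (≳0-resp
      (λ k → solve 8 (λ c s t K x y u v →
          t :* (c :* t :- c :* s :- c :* s :* (x :- y)) :+ c :* s :* (s :- t :- t :* (v :- u)) :+ c :* (s :* t :* K :- con 1ℚ) :* ((t :- s) :* (t :- s))
          := c :* s :* t :* (K :* ((t :- s) :* (t :- s)) :+ (y :- v) :- (x :- u)))
        refl c s t K (ℓ (c * t) k) (ℓ (c * s) k) (ℓ t k) (ℓ s k))
      (≳0-+ (≳0-+ (≳0-*ˡ (<⇒≤ 0<t) (log-tangent (0<* 0<c 0<s) (0<* 0<c 0<t)))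
                  (≳0-*ˡ (<⇒≤ (0<* 0<c 0<s)) (log-tangent 0<t 0<s)))
            (≳0-pointwise λ _ → 0≤* (0≤* (<⇒≤ 0<c) 1≤stK) (0≤-square (t - s)))))
      where
      0<s : 0ℚ < s
      0<s = <-≤-trans 0<m m≤s
      0<t : 0ℚ < t
      0<t = <-≤-trans 0<m m≤t
      1≤stK : 0ℚ ≤ s * t * K - 1ℚ
      1≤stK = ≤-diff (begin
        1ℚ         ≡⟨ mmK ⟨
        m * m * K  ≤⟨ *-monoʳ (<⇒≤ 0<K) (*-mono (<⇒≤ 0<m) (<⇒≤ 0<t) m≤s m≤t) ⟩
        s * t * K  ∎)

    -- L(ct) - L(t) and its negative both have quadratic increments, so the value at `b` agrees with
    -- the value at 1, which is L(c). A positive `m` below 1 and `b` keeps the segment away from 0,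
    -- where 1/(st) blows up.
    ratio-constant : ∀ {b} → m ≤ 1ℚ → m ≤ b → (λ k → ℓ (c * b) k - ℓ c k - ℓ b k) ≈0
    ratio-constant {b} m≤1 m≤b = mk≈0
      (≳0-resp
        (λ k → begin-equality
          - (ℓ (c * 1ℚ) k - ℓ 1ℚ k) - - (ℓ (c * b) k - ℓ b k)  ≡⟨ cong₂ (λ x y → - (ℓ x k - y) - - (ℓ (c * b) k - ℓ b k)) (*-identityʳ c) (ℓ-1 k) ⟩
          - (ℓ c k - 0ℚ) - - (ℓ (c * b) k - ℓ b k)             ≡⟨ solve 3 (λ x y z → :- (x :- con 0ℚ) :- :- (y :- z) := y :- x :- z) refl (ℓ c k) (ℓ (c * b) k) (ℓ b k) ⟩
          ℓ (c * b) k - ℓ c k - ℓ b k                          ∎)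
        (quadratic-increments⇒nonincreasing (λ t k → - (ℓ (c * t) k - ℓ t k)) {m} {K} (<⇒≤ 0<K)
          (λ s t m≤s m≤t → ≳0-resp
            (λ k → solve 5 (λ K s t x y → K :* ((s :- t) :* (s :- t)) :+ x :- y := K :* ((t :- s) :* (t :- s)) :+ :- y :- :- x)
              refl K s t (ℓ (c * t) k - ℓ t k) (ℓ (c * s) k - ℓ s k))
            (ratio-increment t s m≤t m≤s)) m≤1 m≤b))
      (≳0-resp
        (λ k → begin-equality
          (ℓ (c * 1ℚ) k - ℓ 1ℚ k) - (ℓ (c * b) k - ℓ b k)  ≡⟨ cong₂ (λ x y → (ℓ x k - y) - (ℓ (c * b) k - ℓ b k)) (*-identityʳ c) (ℓ-1 k) ⟩
          (ℓ c k - 0ℚ) - (ℓ (c * b) k - ℓ b k)             ≡⟨ solve 3 (λ x y z → (x :- con 0ℚ) :- (y :- z) := :- (y :- x :- z)) refl (ℓ c k) (ℓ (c * b) k) (ℓ b k) ⟩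
          - (ℓ (c * b) k - ℓ c k - ℓ b k)                  ∎)
        (quadratic-increments⇒nonincreasing (λ t k → ℓ (c * t) k - ℓ t k) {m} {K} (<⇒≤ 0<K) ratio-increment m≤1 m≤b))

  log-* : ∀ {a b} → 0ℚ < a → 0ℚ < b → (λ k → ℓ (a * b) k - ℓ a k - ℓ b k) ≈0
  log-* {a} {b} 0<a 0<b with ≤-total 1ℚ b
  ... | inj₁ 1≤b = ratio-constant 0<a 0<1 ≤-refl 1≤b
  ... | inj₂ b≤1 = ratio-constant 0<a 0<b b≤1 ≤-refl

  -- The exponential

  expSum : ℚ → ℕ → ℚ
  expSum u n = Σ< n (expTerm u)

  module _ {u v B : ℚ} (∣u∣≤B : ∣ u ∣ ≤ B) (∣v∣≤B : ∣ v ∣ ≤ B) where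
    private
      δ : ℚ
      δ = v - u
      0≤B : 0ℚ ≤ B
      0≤B = ≤-trans (0≤∣p∣ u) ∣u∣≤B
      ∣δ∣² : ∣ δ ∣ * ∣ δ ∣ ≡ δ * δ
      ∣δ∣² = trans (sym (∣p*q∣≡∣p∣*∣q∣ δ δ)) (0≤p⇒∣p∣≡p (0≤-square δ))

      rem : ℕ → ℚ
      rem k = v ^ suc k - u ^ suc k - ι (suc k) * u ^ k * δ

      rem-suc : ∀ k → rem (suc k) ≡ u * rem k + (v ^ suc k - u ^ suc k) * δ
      rem-suc k = begin-equality
        v * V - u * (u * U) - ι (suc (suc k)) * (u * U) * (v - u)
          ≡⟨ cong (λ i → v * V - u * (u * U) - i * (u * U) * (v - u)) (ι-suc (suc k)) ⟩
        v * V - u * (u * U) - (1ℚ + ι (suc k)) * (u * U) * (v - u)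
          ≡⟨ solve 5 (λ u v U V i → v :* V :- u :* (u :* U) :- (con 1ℚ :+ i) :* (u :* U) :* (v :- u)
               := u :* (V :- u :* U :- i :* U :* (v :- u)) :+ (V :- u :* U) :* (v :- u)) refl u v U V (ι (suc k)) ⟩
        u * (V - u * U - ι (suc k) * U * (v - u)) + (V - u * U) * (v - u) ∎
        where
        U = u ^ k
        V = v ^ suc k

      ∣rem-suc∣ : ∀ k → ∣ rem (suc k) ∣ ≤ B * ∣ rem k ∣ + ι (suc k) * B ^ k * (δ * δ)
      ∣rem-suc∣ k = begin
        ∣ rem (suc k) ∣                      ≡⟨ cong ∣_∣ (rem-suc k) ⟩
        ∣ u * rem k + D * δ ∣                ≤⟨ ∣p+q∣≤∣p∣+∣q∣ (u * rem k) (D * δ) ⟩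
        ∣ u * rem k ∣ + ∣ D * δ ∣            ≡⟨ cong₂ _+_ (∣p*q∣≡∣p∣*∣q∣ u (rem k)) (∣p*q∣≡∣p∣*∣q∣ D δ) ⟩
        ∣ u ∣ * ∣ rem k ∣ + ∣ D ∣ * ∣ δ ∣    ≤⟨ +-mono-≤ (*-monoʳ (0≤∣p∣ (rem k)) ∣u∣≤B) (*-monoʳ (0≤∣p∣ δ) (^-lipschitz k ∣v∣≤B ∣u∣≤B)) ⟩
        B * ∣ rem k ∣ + L * ∣ δ ∣ * ∣ δ ∣    ≡⟨ cong (λ q → B * ∣ rem k ∣ + q) (trans (*-assoc L ∣ δ ∣ ∣ δ ∣) (cong (L *_) ∣δ∣²)) ⟩
        B * ∣ rem k ∣ + L * (δ * δ)          ∎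
        where
        D = v ^ suc k - u ^ suc k
        L = ι (suc k) * B ^ k

    -- The recursion behind it is the product rule with remainder. The factor
    -- `ι (suc (suc k)) * ι (suc k)` is twice the sharp one, but it is exactly what two uses of
    -- `invFact-suc` absorb, turning the bound into `expTerm B k`.
    pow-taylor : ∀ k → ∣ v ^ suc (suc k) - u ^ suc (suc k) - ι (suc (suc k)) * u ^ suc k * (v - u) ∣
                       ≤ ι (suc (suc k)) * ι (suc k) * B ^ k * ((v - u) * (v - u))
    pow-taylor zero = begin
      ∣ rem 1 ∣                              ≤⟨ ∣rem-suc∣ 0 ⟩
      B * ∣ rem 0 ∣ + ι 1 * 1ℚ * (δ * δ)     ≡⟨ cong (λ r → B * ∣ r ∣ + ι 1 * 1ℚ * (δ * δ)) rem0 ⟩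
      B * 0ℚ + ι 1 * 1ℚ * (δ * δ)            ≡⟨ solve 3 (λ B i d → B :* con 0ℚ :+ i :* con 1ℚ :* d := i :* (con 1ℚ :* d)) refl B (ι 1) (δ * δ) ⟩
      ι 1 * (1ℚ * (δ * δ))                   ≤⟨ *-monoʳ (0≤* 0≤1ℚ (0≤-square δ)) (ι-mono {1} {2} (s≤s z≤n)) ⟩
      ι 2 * (1ℚ * (δ * δ))                   ≡⟨ solve 2 (λ i d → i :* (con 1ℚ :* d) := i :* con 1ℚ :* con 1ℚ :* d) refl (ι 2) (δ * δ) ⟩
      ι 2 * 1ℚ * 1ℚ * (δ * δ)                ≡⟨ cong (λ i → ι 2 * i * 1ℚ * (δ * δ)) ι-1 ⟨
      ι 2 * ι 1 * 1ℚ * (δ * δ)               ∎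
      where
      rem0 : rem 0 ≡ 0ℚ
      rem0 = trans (cong (λ i → v * 1ℚ - u * 1ℚ - i * 1ℚ * (v - u)) ι-1)
        (solve 2 (λ u v → v :* con 1ℚ :- u :* con 1ℚ :- con 1ℚ :* con 1ℚ :* (v :- u) := con 0ℚ) refl u v)
    pow-taylor (suc k) = begin
      ∣ rem (suc (suc k)) ∣                          ≤⟨ ∣rem-suc∣ (suc k) ⟩
      B * ∣ rem (suc k) ∣ + i₂ * (B * P) * d         ≤⟨ +-monoˡ-≤ (i₂ * (B * P) * d) (*-monoˡ 0≤B (pow-taylor k)) ⟩
      B * (i₂ * i₁ * P * d) + i₂ * (B * P) * d       ≡⟨ solve 5 (λ B i j P d → B :* (i :* j :* P :* d) :+ i :* (B :* P) :* d := (con 1ℚ :+ j) :* (i :* (B :* P) :* d)) refl B i₂ i₁ P d ⟩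
      (1ℚ + i₁) * (i₂ * (B * P) * d)                 ≡⟨ cong (_* (i₂ * (B * P) * d)) (ι-suc (suc k)) ⟨
      i₂ * (i₂ * (B * P) * d)                        ≤⟨ *-monoʳ (0≤* (0≤* (0≤ι (suc (suc k))) (0≤^ (suc k) 0≤B)) (0≤-square δ)) (ι-mono (ℕₚ.n≤1+n (suc (suc k)))) ⟩
      i₃ * (i₂ * (B * P) * d)                        ≡⟨ solve 4 (λ i j Q d → i :* (j :* Q :* d) := i :* j :* Q :* d) refl i₃ i₂ (B * P) d ⟩
      i₃ * i₂ * (B * P) * d                          ∎
      where
      i₁ = ι (suc k)
      i₂ = ι (suc (suc k))
      i₃ = ι (suc (suc (suc k)))
      P = B ^ k
      d = δ * δ

    expTerm-taylor : ∀ k → ∣ expTerm v (suc (suc k)) - expTerm u (suc (suc k)) - (v - u) * expTerm u (suc k) ∣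
                           ≤ expTerm B k * ((v - u) * (v - u))
    expTerm-taylor k = begin
      ∣ V * g₂ - U * g₂ - (v - u) * (U₁ * g₁) ∣           ≡⟨ cong (λ g → ∣ V * g₂ - U * g₂ - (v - u) * (U₁ * g) ∣) (invFact-suc (suc k)) ⟨
      ∣ V * g₂ - U * g₂ - (v - u) * (U₁ * (i₂ * g₂)) ∣    ≡⟨ cong ∣_∣ (solve 6 (λ V U U₁ g i d → V :* g :- U :* g :- d :* (U₁ :* (i :* g)) := (V :- U :- i :* U₁ :* d) :* g) refl V U U₁ g₂ i₂ (v - u)) ⟩
      ∣ (V - U - i₂ * U₁ * (v - u)) * g₂ ∣                ≡⟨ ∣p*q∣≡∣p∣*∣q∣ (V - U - i₂ * U₁ * (v - u)) g₂ ⟩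
      ∣ V - U - i₂ * U₁ * (v - u) ∣ * ∣ g₂ ∣              ≡⟨ cong (∣ V - U - i₂ * U₁ * (v - u) ∣ *_) (0≤p⇒∣p∣≡p (0≤invFact (suc (suc k)))) ⟩
      ∣ V - U - i₂ * U₁ * (v - u) ∣ * g₂                  ≤⟨ *-monoʳ (0≤invFact (suc (suc k))) (pow-taylor k) ⟩
      i₂ * i₁ * P * d * g₂                                ≡⟨ solve 5 (λ i j P d g → i :* j :* P :* d :* g := P :* (j :* (i :* g)) :* d) refl i₂ i₁ P d g₂ ⟩
      P * (i₁ * (i₂ * g₂)) * d                            ≡⟨ cong (λ g → P * (i₁ * g) * d) (invFact-suc (suc k)) ⟩
      P * (i₁ * g₁) * d                                   ≡⟨ cong (λ g → P * g * d) (invFact-suc k) ⟩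
      P * invFact k * d                                   ∎
      where
      V = v ^ suc (suc k)
      U = u ^ suc (suc k)
      U₁ = u ^ suc k
      g₁ = invFact (suc k)
      g₂ = invFact (suc (suc k))
      i₁ = ι (suc k)
      i₂ = ι (suc (suc k))
      P = B ^ k
      d = (v - u) * (v - u)

    -- The series is its own derivative up to a shift of the length: differentiating `n + 2` terms
    -- leaves `n + 1` of them.
    expSum-taylor : ∀ n → ∣ expSum v (suc (suc n)) - expSum u (suc (suc n)) - (v - u) * expSum u (suc n) ∣
                          ≤ expSum B n * ((v - u) * (v - u))
    expSum-taylor zero = ≤-reflexive (trans (cong ∣_∣
        (solve 2 (λ u v → (con 0ℚ :+ con 1ℚ :+ v :* con 1ℚ :* con 1ℚ) :- (con 0ℚ :+ con 1ℚ :+ u :* con 1ℚ :* con 1ℚ) :- (v :- u) :* (con 0ℚ :+ con 1ℚ) := con 0ℚ) refl u v))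
        (sym (*-zeroˡ ((v - u) * (v - u)))))
    expSum-taylor (suc n) = begin
      ∣ (S + s) - (T + t) - d * (R + r) ∣            ≡⟨ cong ∣_∣ (solve 7 (λ S s T t d R r → (S :+ s) :- (T :+ t) :- d :* (R :+ r) := (S :- T :- d :* R) :+ (s :- t :- d :* r)) refl S s T t d R r) ⟩
      ∣ (S - T - d * R) + (s - t - d * r) ∣          ≤⟨ ∣p+q∣≤∣p∣+∣q∣ (S - T - d * R) (s - t - d * r) ⟩
      ∣ S - T - d * R ∣ + ∣ s - t - d * r ∣          ≤⟨ +-mono-≤ (expSum-taylor n) (expTerm-taylor n) ⟩
      expSum B n * (d * d) + expTerm B n * (d * d)   ≡⟨ *-distribʳ-+ (d * d) (expSum B n) (expTerm B n) ⟨
      (expSum B n + expTerm B n) * (d * d)           ∎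
      where
      S = expSum v (suc (suc n))
      s = expTerm v (suc (suc n))
      T = expSum u (suc (suc n))
      t = expTerm u (suc (suc n))
      R = expSum u (suc n)
      r = expTerm u (suc n)
      d = v - u

    -- Brings both sums to the same length at the price of one last term, so that steps with a fixed
    -- truncation can be chained.
    expSum-step : ∀ n → ∣ expSum v (suc (suc n)) - (1ℚ + (v - u)) * expSum u (suc (suc n)) ∣
                        ≤ expSum B n * ((v - u) * (v - u)) + ∣ v - u ∣ * expTerm B (suc n)
    expSum-step n = begin
      ∣ S - (1ℚ + d) * (R + r) ∣                           ≡⟨ cong ∣_∣ (solve 4 (λ S d R r → S :- (con 1ℚ :+ d) :* (R :+ r) := (S :- (R :+ r) :- d :* R) :+ :- (d :* r)) refl S d R r) ⟩
      ∣ (S - (R + r) - d * R) + - (d * r) ∣                ≤⟨ ∣p+q∣≤∣p∣+∣q∣ (S - (R + r) - d * R) (- (d * r)) ⟩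
      ∣ S - (R + r) - d * R ∣ + ∣ - (d * r) ∣              ≡⟨ cong (λ q → ∣ S - (R + r) - d * R ∣ + q) (trans (∣-p∣≡∣p∣ (d * r)) (∣p*q∣≡∣p∣*∣q∣ d r)) ⟩
      ∣ S - (R + r) - d * R ∣ + ∣ d ∣ * ∣ r ∣              ≤⟨ +-mono-≤ (expSum-taylor n) (*-monoˡ (0≤∣p∣ d) (∣expTerm∣ (suc n) ∣u∣≤B)) ⟩
      expSum B n * (d * d) + ∣ d ∣ * expTerm B (suc n)     ∎
      where
      S = expSum v (suc (suc n))
      R = expSum u (suc n)
      r = expTerm u (suc n)
      d = v - u

  expSum-bound : ∀ b n → expSum (ι (suc b)) n ≤ 2ℚ * ι (expBound b)
  expSum-bound b n = begin
    expSum (ι (suc b)) n       ≤⟨ go n ⟩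
    C * (2ℚ - 2ℚ * ½ ^ n)      ≤⟨ *-monoˡ (0≤ι (expBound b)) (0≤-diff (subst (0ℚ ≤_) (solve 1 (λ H → con 2ℚ :* H := con 2ℚ :- (con 2ℚ :- con 2ℚ :* H)) refl (½ ^ n)) (0≤* 0≤2 (0≤^ n 0≤½)))) ⟩
    C * 2ℚ                     ≡⟨ *-comm C 2ℚ ⟩
    2ℚ * C                     ∎
    where
    C = ι (expBound b)
    go : ∀ n → expSum (ι (suc b)) n ≤ C * (2ℚ - 2ℚ * ½ ^ n)
    go zero    = ≤-reflexive (sym (*-zeroʳ C))
    go (suc n) = ≤-trans (+-mono-≤ (go n) (expTerm-dom b n))
      (≤-reflexive (solve 2 (λ C H → C :* (con 2ℚ :- con 2ℚ :* H) :+ C :* H := C :* (con 2ℚ :- con 2ℚ :* (con ½ :* H))) refl C (½ ^ n)))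

  expSum-0 : ∀ n → expSum 0ℚ (suc n) ≡ 1ℚ
  expSum-0 zero    = refl
  expSum-0 (suc n) = trans (cong₂ _+_ (expSum-0 n)
    (trans (cong (_* invFact (suc n)) (*-zeroˡ (0ℚ ^ n))) (*-zeroˡ (invFact (suc n))))) refl

  -- For δ ∈ [-1, 0] the factor 1 + δ does not amplify earlier errors, so they only add up.
  module _ (b : ℕ) {δ : ℚ} (-1≤δ : - 1ℚ ≤ δ) (δ≤0 : δ ≤ 0ℚ) (n : ℕ) where
    private
      B e : ℚ
      B = ι (suc b)
      e = 2ℚ * ι (expBound b) * (δ * δ) + ∣ δ ∣ * expTerm B (suc n)
      0≤1+δ : 0ℚ ≤ 1ℚ + δ
      0≤1+δ = subst (0ℚ ≤_) (solve 1 (λ δ → δ :- :- con 1ℚ := con 1ℚ :+ δ) refl δ) (≤-diff -1≤δ)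
      ∣1+δ∣≤1 : ∣ 1ℚ + δ ∣ ≤ 1ℚ
      ∣1+δ∣≤1 = ≤-trans (≤-reflexive (0≤p⇒∣p∣≡p 0≤1+δ)) (≤-trans (+-monoʳ-≤ 1ℚ δ≤0) (≤-reflexive (+-identityʳ 1ℚ)))

    expSum≈compound : ∀ j → (∀ i → i ℕ.≤ j → ∣ ι i * δ ∣ ≤ B) →
      ∣ expSum (ι j * δ) (suc (suc n)) - (1ℚ + δ) ^ j ∣ ≤ ι j * e
    expSum≈compound zero _ = ≤-reflexive (trans
      (cong ∣_∣ (trans (cong (λ u → expSum u (suc (suc n)) - 1ℚ) (trans (cong (_* δ) ι-0) (*-zeroˡ δ)))
                       (cong (_- 1ℚ) (expSum-0 (suc n)))))
      (sym (trans (cong (_* e) ι-0) (*-zeroˡ e))))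
    expSum≈compound (suc j) ∣iδ∣≤B = begin
      ∣ S′ - (1ℚ + δ) * P ∣
        ≡⟨ cong ∣_∣ (solve 4 (λ S′ S P δ → S′ :- (con 1ℚ :+ δ) :* P := (S′ :- (con 1ℚ :+ δ) :* S) :+ (con 1ℚ :+ δ) :* (S :- P)) refl S′ S P δ) ⟩
      ∣ (S′ - (1ℚ + δ) * S) + (1ℚ + δ) * (S - P) ∣
        ≤⟨ ∣p+q∣≤∣p∣+∣q∣ (S′ - (1ℚ + δ) * S) ((1ℚ + δ) * (S - P)) ⟩
      ∣ S′ - (1ℚ + δ) * S ∣ + ∣ (1ℚ + δ) * (S - P) ∣
        ≤⟨ +-mono-≤ step (begin
             ∣ (1ℚ + δ) * (S - P) ∣     ≡⟨ ∣p*q∣≡∣p∣*∣q∣ (1ℚ + δ) (S - P) ⟩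
             ∣ 1ℚ + δ ∣ * ∣ S - P ∣     ≤⟨ *-monoʳ (0≤∣p∣ (S - P)) ∣1+δ∣≤1 ⟩
             1ℚ * ∣ S - P ∣             ≡⟨ *-identityˡ ∣ S - P ∣ ⟩
             ∣ S - P ∣                  ≤⟨ expSum≈compound j (λ i i≤j → ∣iδ∣≤B i (ℕₚ.m≤n⇒m≤1+n i≤j)) ⟩
             ι j * e                    ∎) ⟩
      e + ι j * e
        ≡⟨ solve 2 (λ e i → e :+ i :* e := (con 1ℚ :+ i) :* e) refl e (ι j) ⟩
      (1ℚ + ι j) * e
        ≡⟨ cong (_* e) (ι-suc j) ⟨
      ι (suc j) * e ∎
      where
      u = ι j * δ
      v = ι (suc j) * δ
      S′ = expSum v (suc (suc n))
      S = expSum u (suc (suc n))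
      P = (1ℚ + δ) ^ j
      v-u : v - u ≡ δ
      v-u = trans (cong (λ i → i * δ - u) (ι-suc j)) (solve 2 (λ i δ → (con 1ℚ :+ i) :* δ :- i :* δ := δ) refl (ι j) δ)
      step : ∣ S′ - (1ℚ + δ) * S ∣ ≤ e
      step = begin
        ∣ S′ - (1ℚ + δ) * S ∣
          ≤⟨ subst (λ d → ∣ S′ - (1ℚ + d) * S ∣ ≤ expSum B n * (d * d) + ∣ d ∣ * expTerm B (suc n)) v-u
               (expSum-step {u} {v} {B} (∣iδ∣≤B j (ℕₚ.n≤1+n j)) (∣iδ∣≤B (suc j) ℕₚ.≤-refl) n) ⟩
        expSum B n * (δ * δ) + ∣ δ ∣ * expTerm B (suc n)
          ≤⟨ +-monoˡ-≤ (∣ δ ∣ * expTerm B (suc n)) (*-monoʳ (0≤-square δ) (expSum-bound b n)) ⟩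
        e ∎

  -- Here `u` is reached in `M` steps of size u/M. The quadratic errors add up to O(1/M); the
  -- truncation errors add up to an amount independent of `M` that vanishes as `n` grows.
  -- `ι (suc b) ≤ ι M` ensures that a step is at least -1.
  expSum≈power : ∀ b M {{_ : NonZero M}} n {u} → ι (suc b) ≤ ι M → - ι (suc b) ≤ u → u ≤ 0ℚ →
    ∣ expSum u (suc (suc n)) - (1ℚ + (+ 1 / M) * u) ^ M ∣
      ≤ 2ℚ * ι (expBound b) * (ι (suc b) * ι (suc b)) * (+ 1 / M) + ι (suc b) * expTerm (ι (suc b)) (suc n)
  expSum≈power b M n {u} B≤M -B≤u u≤0 = begin
    ∣ expSum u (suc (suc n)) - (1ℚ + δ) ^ M ∣           ≡⟨ cong (λ w → ∣ expSum w (suc (suc n)) - (1ℚ + δ) ^ M ∣) Mδ ⟨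
    ∣ expSum (ι M * δ) (suc (suc n)) - (1ℚ + δ) ^ M ∣   ≤⟨ expSum≈compound b -1≤δ δ≤0 n M iδ-bound ⟩
    ι M * (c * (δ * δ) + ∣ δ ∣ * t)                     ≡⟨ cong (λ a → ι M * (c * (δ * δ) + a * t)) (∣p∣-≤0 δ≤0) ⟩
    ι M * (c * (δ * δ) + - δ * t)                       ≡⟨ solve 5 (λ i c r u t → i :* (c :* ((r :* u) :* (r :* u)) :+ :- (r :* u) :* t)
                                                            := (i :* r) :* (c :* (:- u :* :- u) :* r :+ :- u :* t)) refl (ι M) c r u t ⟩
    ι M * r * (c * (- u * - u) * r + - u * t)           ≡⟨ cong (_* (c * (- u * - u) * r + - u * t)) (ι-/ M) ⟩
    1ℚ * (c * (- u * - u) * r + - u * t)                ≡⟨ *-identityˡ _ ⟩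
    c * (- u * - u) * r + - u * t
      ≤⟨ +-mono-≤ (*-monoʳ (0≤1/ M) (*-monoˡ (0≤* 0≤2 (0≤ι (expBound b))) (*-mono 0≤-u (0≤ι (suc b)) -u≤B -u≤B)))
                  (*-monoʳ (0≤* (0≤^ (suc n) (0≤ι (suc b))) (0≤invFact (suc n))) -u≤B) ⟩
    c * (B * B) * r + B * t                             ∎
    where
    B = ι (suc b)
    c = 2ℚ * ι (expBound b)
    r = + 1 / M
    t = expTerm B (suc n)
    δ = r * u
    0≤-u : 0ℚ ≤ - u
    0≤-u = neg-antimono-≤ u≤0
    -u≤B : - u ≤ B
    -u≤B = ≤-trans (neg-antimono-≤ -B≤u) (≤-reflexive (solve 1 (λ p → :- :- p := p) refl B))
    Mδ : ι M * δ ≡ u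
    Mδ = trans (sym (*-assoc (ι M) r u)) (trans (cong (_* u) (ι-/ M)) (*-identityˡ u))
    δ≤0 : δ ≤ 0ℚ
    δ≤0 = ≤-trans (*-monoˡ (0≤1/ M) u≤0) (≤-reflexive (*-zeroʳ r))
    -1≤δ : - 1ℚ ≤ δ
    -1≤δ = begin
      - 1ℚ            ≡⟨ cong -_ (trans (*-comm r (ι M)) (ι-/ M)) ⟨
      - (r * ι M)     ≤⟨ neg-antimono-≤ (*-monoˡ (0≤1/ M) B≤M) ⟩
      - (r * B)       ≡⟨ neg-distribʳ-* r B ⟩
      r * - B         ≤⟨ *-monoˡ (0≤1/ M) -B≤u ⟩
      δ               ∎
    iδ-bound : ∀ i → i ℕ.≤ M → ∣ ι i * δ ∣ ≤ B
    iδ-bound i i≤M = begin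
      ∣ ι i * δ ∣    ≡⟨ ∣p∣-≤0 (≤-trans (*-monoˡ (0≤ι i) δ≤0) (≤-reflexive (*-zeroʳ (ι i)))) ⟩
      - (ι i * δ)    ≡⟨ neg-distribʳ-* (ι i) δ ⟩
      ι i * - δ      ≤⟨ *-monoʳ (neg-antimono-≤ δ≤0) (ι-mono i≤M) ⟩
      ι M * - δ      ≡⟨ neg-distribʳ-* (ι M) δ ⟨
      - (ι M * δ)    ≡⟨ cong -_ Mδ ⟩
      - u            ≤⟨ -u≤B ⟩
      B              ∎

  -- Logarithms of the powers (1 + u/M)^M

  log-^ : ∀ {a} n → 0ℚ < a → (λ k → ℓ (a ^ n) k - ι n * ℓ a k) ≈0
  log-^ {a} zero    0<a = ≈0-zero λ k → trans (cong₂ (λ x i → x - i * ℓ a k) (ℓ-1 k) ι-0)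
    (solve 1 (λ x → con 0ℚ :- con 0ℚ :* x := con 0ℚ) refl (ℓ a k))
  log-^ {a} (suc n) 0<a = ≈0-resp
    (λ k → begin-equality
      ℓ (a * a ^ n) k - ℓ a k - ℓ (a ^ n) k + (ℓ (a ^ n) k - ι n * ℓ a k)
        ≡⟨ solve 4 (λ p x q i → p :- x :- q :+ (q :- i :* x) := p :- (con 1ℚ :+ i) :* x) refl (ℓ (a * a ^ n) k) (ℓ a k) (ℓ (a ^ n) k) (ι n) ⟩
      ℓ (a * a ^ n) k - (1ℚ + ι n) * ℓ a k
        ≡⟨ cong (λ i → ℓ (a * a ^ n) k - i * ℓ a k) (ι-suc n) ⟨
      ℓ (a * a ^ n) k - ι (suc n) * ℓ a k ∎)
    (≈0-+ (log-* 0<a (0<^ n 0<a)) (log-^ n 0<a))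
    where
    0<^ : ∀ {a} n → 0ℚ < a → 0ℚ < a ^ n
    0<^ zero    0<a = 0<1
    0<^ (suc n) 0<a = 0<* 0<a (0<^ n 0<a)

  module _ (M : ℕ) {{_ : NonZero M}} {u B : ℚ} (-B≤u : - B ≤ u) (u≤0 : u ≤ 0ℚ) (2B≤M : 2ℚ * B ≤ ι M) where
    private
      r δ : ℚ
      r = + 1 / M
      δ = r * u

      Mδ : ι M * δ ≡ u
      Mδ = trans (sym (*-assoc (ι M) r u)) (trans (cong (_* u) (ι-/ M)) (*-identityˡ u))

      0≤1+2δ : 0ℚ ≤ 1ℚ + 2ℚ * δ
      0≤1+2δ = begin
        0ℚ                           ≤⟨ +-mono-≤ (0≤* (0≤1/ M) (≤-diff 2B≤M)) (0≤* (0≤* 0≤2 (0≤1/ M)) (≤-diff -B≤u)) ⟩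
        r * (ι M - 2ℚ * B) + 2ℚ * r * (u - - B)  ≡⟨ solve 4 (λ r i B u → r :* (i :- con 2ℚ :* B) :+ con 2ℚ :* r :* (u :- :- B) := i :* r :+ con 2ℚ :* (r :* u)) refl r (ι M) B u ⟩
        ι M * r + 2ℚ * δ             ≡⟨ cong (_+ 2ℚ * δ) (ι-/ M) ⟩
        1ℚ + 2ℚ * δ                  ∎

      0<1+δ : 0ℚ < 1ℚ + δ
      0<1+δ = *-cancelˡ-<-nonNeg 2ℚ (begin-strict
        2ℚ * 0ℚ            ≡⟨⟩
        0ℚ                 <⟨ 0<1 ⟩
        1ℚ                 ≡⟨ +-identityˡ 1ℚ ⟨
        0ℚ + 1ℚ            ≤⟨ +-monoˡ-≤ 1ℚ 0≤1+2δ ⟩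
        1ℚ + 2ℚ * δ + 1ℚ   ≡⟨ solve 1 (λ δ → con 1ℚ :+ con 2ℚ :* δ :+ con 1ℚ := con 2ℚ :* (con 1ℚ :+ δ)) refl δ ⟩
        2ℚ * (1ℚ + δ)      ∎)

      log-1+δ≤ : (λ k → δ - ℓ (1ℚ + δ) k) ≳0
      log-1+δ≤ = ≳0-resp
        (λ k → trans (cong (λ x → (1ℚ + δ) - 1ℚ - 1ℚ * (ℓ (1ℚ + δ) k - x)) (ℓ-1 k))
          (solve 2 (λ δ x → (con 1ℚ :+ δ) :- con 1ℚ :- con 1ℚ :* (x :- con 0ℚ) := δ :- x) refl δ (ℓ (1ℚ + δ) k)))
        (log-tangent 0<1 0<1+δ)

      -- The tangent at 1 + δ gives log(1 + δ) ≥ δ/(1 + δ) = δ - δ²/(1 + δ), and 1 + δ ≥ 1/2 because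
      -- `2ℚ * B ≤ ι M`. This is where the factor 2 comes from.
      log-1+δ≥ : (λ k → ℓ (1ℚ + δ) k - δ + 2ℚ * (δ * δ)) ≳0
      log-1+δ≥ = ≳0-cancel 0<1+δ (≳0-resp
        (λ k → trans (cong (λ x → 1ℚ - (1ℚ + δ) - (1ℚ + δ) * (x - ℓ (1ℚ + δ) k) + δ * δ * (1ℚ + 2ℚ * δ)) (ℓ-1 k))
          (solve 2 (λ δ x → con 1ℚ :- (con 1ℚ :+ δ) :- (con 1ℚ :+ δ) :* (con 0ℚ :- x) :+ δ :* δ :* (con 1ℚ :+ con 2ℚ :* δ)
             := (con 1ℚ :+ δ) :* (x :- δ :+ con 2ℚ :* (δ :* δ))) refl δ (ℓ (1ℚ + δ) k)))
        (≳0-+ (log-tangent 0<1+δ 0<1) (≳0-pointwise λ _ → 0≤* (0≤-square δ) 0≤1+2δ)))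

    0<power : 0ℚ < (1ℚ + (+ 1 / M) * u) ^ M
    0<power = go M
      where
      go : ∀ n → 0ℚ < (1ℚ + δ) ^ n
      go zero    = 0<1
      go (suc n) = 0<* 0<1+δ (go n)

    log-power≤ : (λ k → u - ℓ ((1ℚ + (+ 1 / M) * u) ^ M) k) ≳0
    log-power≤ = ≳0-resp
      (λ k → begin-equality
        ι M * (δ - x k) + - (ℓ ((1ℚ + δ) ^ M) k - ι M * x k)  ≡⟨ solve 4 (λ i δ x p → i :* (δ :- x) :+ :- (p :- i :* x) := i :* δ :- p) refl (ι M) δ (x k) (ℓ ((1ℚ + δ) ^ M) k) ⟩
        ι M * δ - ℓ ((1ℚ + δ) ^ M) k                          ≡⟨ cong (λ w → w - ℓ ((1ℚ + δ) ^ M) k) Mδ ⟩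
        u - ℓ ((1ℚ + δ) ^ M) k                                ∎)
      (≳0-+ (≳0-*ˡ (0≤ι M) log-1+δ≤) (-≈0⇒≳0 (log-^ M 0<1+δ)))
      where
      x : ℕ → ℚ
      x = ℓ (1ℚ + δ)

    log-power≥ : (λ k → ℓ ((1ℚ + (+ 1 / M) * u) ^ M) k - u + 2ℚ * (B * B) * (+ 1 / M)) ≳0
    log-power≥ = ≳0-mono
      (λ k → begin
        ι M * (x k - δ + 2ℚ * (δ * δ)) + (P k - ι M * x k)
          ≡⟨ solve 5 (λ i r u x p → i :* (x :- r :* u :+ con 2ℚ :* ((r :* u) :* (r :* u))) :+ (p :- i :* x)
               := p :- i :* (r :* u) :+ con 2ℚ :* (:- u :* :- u) :* r :* (i :* r)) refl (ι M) r u (x k) (P k) ⟩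
        P k - ι M * δ + 2ℚ * (- u * - u) * r * (ι M * r)
          ≡⟨ cong₂ (λ w i → P k - w + 2ℚ * (- u * - u) * r * i) Mδ (ι-/ M) ⟩
        P k - u + 2ℚ * (- u * - u) * r * 1ℚ
          ≡⟨ cong (λ q → P k - u + q) (*-identityʳ _) ⟩
        P k - u + 2ℚ * (- u * - u) * r
          ≤⟨ +-monoʳ-≤ (P k - u) (*-monoʳ (0≤1/ M) (*-monoˡ 0≤2 (*-mono (neg-antimono-≤ u≤0) 0≤B -u≤B -u≤B))) ⟩
        P k - u + 2ℚ * (B * B) * r ∎)
      (≳0-+ (≳0-*ˡ (0≤ι M) log-1+δ≥) (≈0⇒≳0 (log-^ M 0<1+δ)))
      where
      x P : ℕ → ℚ
      x = ℓ (1ℚ + δ)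
      P = ℓ ((1ℚ + δ) ^ M)
      -u≤B : - u ≤ B
      -u≤B = ≤-trans (neg-antimono-≤ -B≤u) (≤-reflexive (solve 1 (λ p → :- :- p := p) refl B))
      0≤B : 0ℚ ≤ B
      0≤B = ≤-trans (neg-antimono-≤ u≤0) -u≤B

  -- P u is the compound-interest power (1 + u/M) ^ M for a suitable M.
  compound-approximation : ∀ b η → 0ℚ < η → ∃ λ N → ∃ λ (P : ℚ → ℚ) → ∀ u → - ι (suc b) ≤ u → u ≤ 0ℚ →
    0ℚ < P u × (λ k → u - ℓ (P u) k) ≳0 × (λ k → ℓ (P u) k - u + η) ≳0 ×
    (∀ n → N ℕ.≤ n → ∣ expSum u n - P u ∣ ≤ η)
  compound-approximation b η 0<η = suc (suc N₃) , P , λ u -B≤u u≤0 →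
      0<power M {u} {B} -B≤u u≤0 2B≤M , log-power≤ M {u} {B} -B≤u u≤0 2B≤M ,
      ≳0-mono (λ k → +-monoʳ-≤ (ℓ (P u) k - u) log-error≤η) (log-power≥ M {u} {B} -B≤u u≤0 2B≤M) , λ where
        (suc (suc n)) (s≤s (s≤s N₃≤n)) → begin
          ∣ expSum u (suc (suc n)) - P u ∣                ≤⟨ expSum≈power b M n B≤M -B≤u u≤0 ⟩
          c * (B * B) * r + B * expTerm B (suc n)         ≤⟨ +-mono-≤ (≤-trans (*-monoʳ (0≤1/ M) (*-monoʳ (0≤* 0≤B 0≤B) c≤2+c)) Xr≤η′) (tail n N₃≤n) ⟩
          η′ + η′                                         ≡⟨ solve 1 (λ e → e :+ e := con 2ℚ :* e) refl η′ ⟩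
          2ℚ * η′                                         ≡⟨ 2η′≡η ⟩
          η                                               ∎
    where
    B C c : ℚ
    B = ι (suc b)
    C = ι (expBound b)
    c = 2ℚ * C
    0≤B : 0ℚ ≤ B
    0≤B = 0≤ι (suc b)
    0≤c : 0ℚ ≤ c
    0≤c = 0≤* 0≤2 (0≤ι (expBound b))
    2≤2+c : 2ℚ ≤ 2ℚ + c
    2≤2+c = ≤-trans (≤-reflexive (sym (+-identityʳ 2ℚ))) (+-monoʳ-≤ 2ℚ 0≤c)
    c≤2+c : c ≤ 2ℚ + c
    c≤2+c = ≤-trans (≤-reflexive (sym (+-identityˡ c))) (+-monoˡ-≤ c 0≤2)
    half = rescale {η} {2ℚ} 0<η (positive⁻¹ 2ℚ)
    η′ : ℚ
    η′ = proj₁ half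
    0<η′ : 0ℚ < η′
    0<η′ = proj₁ (proj₂ half)
    2η′≡η : 2ℚ * η′ ≡ η
    2η′≡η = proj₂ (proj₂ half)
    η′≤η : η′ ≤ η
    η′≤η = begin
      η′        ≡⟨ +-identityˡ η′ ⟨
      0ℚ + η′   ≤⟨ +-monoˡ-≤ η′ (<⇒≤ 0<η′) ⟩
      η′ + η′   ≡⟨ solve 1 (λ e → e :+ e := con 2ℚ :* e) refl η′ ⟩
      2ℚ * η′   ≡⟨ 2η′≡η ⟩
      η         ∎
    -- The factor `2ℚ + c` dominates both `c`, from the error of the exponential sum, and `2ℚ`, from
    -- the error of the logarithm, so that one `M` serves both.
    X : ℚ
    X = (2ℚ + c) * (B * B)
    large₁ = archimedean-suc {X} {η′} (0≤* (+-mono-≤ 0≤2 0≤c) (0≤* 0≤B 0≤B)) 0<η′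
    large₂ = archimedean-suc {2ℚ * B} {1ℚ} (0≤* 0≤2 0≤B) 0<1
    N₁ N₂ M : ℕ
    N₁ = proj₁ large₁
    N₂ = proj₁ large₂
    M = suc (N₁ ℕ.+ N₂)
    r : ℚ
    r = + 1 / M
    P : ℚ → ℚ
    P u = (1ℚ + r * u) ^ M
    2B≤M : 2ℚ * B ≤ ι M
    2B≤M = begin
      2ℚ * B             ≤⟨ proj₂ large₂ ⟩
      ι (suc N₂) * 1ℚ    ≡⟨ *-identityʳ (ι (suc N₂)) ⟩
      ι (suc N₂)         ≤⟨ ι-mono (s≤s (ℕₚ.m≤n+m N₂ N₁)) ⟩
      ι M                ∎
    B≤M : B ≤ ι M
    B≤M = begin
      B        ≡⟨ +-identityˡ B ⟨
      0ℚ + B   ≤⟨ +-monoˡ-≤ B 0≤B ⟩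
      B + B    ≡⟨ solve 1 (λ e → e :+ e := con 2ℚ :* e) refl B ⟩
      2ℚ * B   ≤⟨ 2B≤M ⟩
      ι M      ∎
    Xr≤η′ : X * r ≤ η′
    Xr≤η′ = begin
      X * r                 ≤⟨ *-monoʳ (0≤1/ M) (proj₂ large₁) ⟩
      ι (suc N₁) * η′ * r   ≤⟨ *-monoʳ (0≤1/ M) (*-monoʳ (<⇒≤ 0<η′) (ι-mono (s≤s (ℕₚ.m≤m+n N₁ N₂)))) ⟩
      ι M * η′ * r          ≡⟨ solve 3 (λ i e r → i :* e :* r := i :* r :* e) refl (ι M) η′ r ⟩
      ι M * r * η′          ≡⟨ cong (_* η′) (ι-/ M) ⟩
      1ℚ * η′               ≡⟨ *-identityˡ η′ ⟩
      η′                    ∎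
    log-error≤η : 2ℚ * (B * B) * r ≤ η
    log-error≤η = ≤-trans (≤-trans (*-monoʳ (0≤1/ M) (*-monoʳ (0≤* 0≤B 0≤B) 2≤2+c)) Xr≤η′) η′≤η
    BC : ℚ
    BC = B * C
    0≤BC : 0ℚ ≤ BC
    0≤BC = 0≤* 0≤B (0≤ι (expBound b))
    scale = rescale {η′} {BC + 1ℚ} 0<η′ (+-mono-≤-< 0≤BC 0<1)
    ε : ℚ
    ε = proj₁ scale
    decay = ½-small ε (proj₁ (proj₂ scale))
    N₃ : ℕ
    N₃ = proj₁ decay
    tail : ∀ n → N₃ ℕ.≤ n → B * expTerm B (suc n) ≤ η′
    tail n N₃≤n = begin
      B * expTerm B (suc n)    ≤⟨ *-monoˡ 0≤B (expTerm-dom b (suc n)) ⟩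
      B * (C * (½ * ½ ^ n))    ≡⟨ solve 3 (λ B C H → B :* (C :* (con ½ :* H)) := B :* C :* (H :* con ½)) refl B C (½ ^ n) ⟩
      BC * (½ ^ n * ½)         ≤⟨ *-monoˡ 0≤BC (proj₂ decay n N₃≤n) ⟩
      BC * ε                   ≤⟨ *-monoʳ (<⇒≤ (proj₁ (proj₂ scale))) (≤-trans (≤-reflexive (sym (+-identityʳ BC))) (+-monoʳ-≤ BC 0≤1ℚ)) ⟩
      (BC + 1ℚ) * ε            ≡⟨ proj₂ (proj₂ scale) ⟩
      η′                       ∎

  -- A single far-out term u = yₘ, together with a rational P ≈ exp u that is a perfect power,
  -- so that log P ≈ u.
  record Approximant (y : ℝ) (η : ℚ) (E : ℕ → Set) : Set where
    field
      m     : ℕ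
      P     : ℚ
      0<P   : 0ℚ < P
      holds : E m
      exp≈P : ∣ seq (exp y) m - P ∣ ≤ η
      close : ∀ k → m ℕ.≤ k → ∣ seq y k - seq y m ∣ ≤ η
      log≤  : (λ k → seq y m - ℓ P k) ≳0
      log≥  : (λ k → ℓ P k - seq y m + η) ≳0

  -- The diagonal definition of `exp` uses the same index for the argument and for the length of the
  -- sum. One `m` must therefore pass four thresholds: the bound on `y`, the length needed for `P`,
  -- the Cauchy modulus of `y`, and the index from which `E` holds.
  approximant : (y : ℝ) → (∀ k → seq y k ≤ 0ℚ) → ∀ η → 0ℚ < η → (E : ℕ → Set) →
                (∃ λ N → ∀ n → N ℕ.≤ n → E n) → Approximant y η E
  approximant y y≤0 η 0<η E (N₃ , e) = record
    { m     = m
    ; P     = P (seq y m)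
    ; 0<P   = proj₁ spec
    ; holds = e m (⊔-≤ʳ {N₂} {N₃} (ℕₚ.m≤n⊔m (K ℕ.⊔ N₁) (N₂ ℕ.⊔ N₃)))
    ; exp≈P = proj₂ (proj₂ (proj₂ spec)) m (⊔-≤ʳ {K} {N₁} K⊔N₁≤m)
    ; close = λ k m≤k → proj₂ (cauchy y η 0<η) k m (ℕₚ.≤-trans N₂≤m m≤k) N₂≤m
    ; log≤  = proj₁ (proj₂ spec)
    ; log≥  = proj₁ (proj₂ (proj₂ spec))
    }
    where
    b K N₁ N₂ : ℕ
    b = proj₁ (bounded y)
    K = proj₁ (proj₂ (bounded y))
    N₁ = proj₁ (compound-approximation b η 0<η)
    N₂ = proj₁ (cauchy y η 0<η)
    P : ℚ → ℚ
    P = proj₁ (proj₂ (compound-approximation b η 0<η))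
    m : ℕ
    m = (K ℕ.⊔ N₁) ℕ.⊔ (N₂ ℕ.⊔ N₃)
    K⊔N₁≤m : K ℕ.⊔ N₁ ℕ.≤ m
    K⊔N₁≤m = ℕₚ.m≤m⊔n (K ℕ.⊔ N₁) (N₂ ℕ.⊔ N₃)
    N₂≤m : N₂ ℕ.≤ m
    N₂≤m = ⊔-≤ˡ {N₂} {N₃} (ℕₚ.m≤n⊔m (K ℕ.⊔ N₁) (N₂ ℕ.⊔ N₃))
    -B≤u : - ι (suc b) ≤ seq y m
    -B≤u = abs-≤ (≤-trans (proj₂ (proj₂ (bounded y)) m (⊔-≤ˡ {K} {N₁} K⊔N₁≤m)) (ι-mono (ℕₚ.n≤1+n b)))
    spec = proj₂ (proj₂ (compound-approximation b η 0<η)) (seq y m) -B≤u (y≤0 m)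

  -- From the order of q and exp y to the order of log q and y

  module _ (y : ℝ) (y≤0 : ∀ k → seq y k ≤ 0ℚ) {q : ℚ} (0<q : 0ℚ < q) where
    private
      -- The hypothesis and `exp≈P` give P ≤ q + 2η, so by the tangent at `q` the product q (L(P) -
      -- L(q)) is at most 2η. Passing from L(P) to `u` and from `u` to later terms of `y` costs qη
      -- each, which makes `(2ℚ + 2ℚ * q) * η`.
      exp≤-step : ∀ {η ε} → (2ℚ + 2ℚ * q) * η ≡ ε → Approximant y η (λ n → 0ℚ ≤ q - seq (exp y) n + η) →
                  (λ k → q * (ℓ q k - seq y k) + ε) ≳0
      exp≤-step {η} {ε} cη≡ε a = ≳0-mono-from m
        (λ k m≤k → 0≤-diff (begin
          0ℚ
            ≤⟨ +-mono-≤ (+-mono-≤ holds (≤-diff (abs-≤ exp≈P)))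
                 (0≤* (<⇒≤ 0<q) (≤-diff (∣p∣≤⇒≤ (close k m≤k)))) ⟩
          q - S + η + (S - P - - η) + q * (η - (seq y k - u))
            ≡⟨ solve 8 (λ q S P η y u l p → q :- S :+ η :+ (S :- P :- :- η) :+ q :* (η :- (y :- u))
                 := q :* (l :- y) :+ (con 2ℚ :+ con 2ℚ :* q) :* η :- (P :- q :- q :* (p :- l) :+ q :* (p :- u :+ η)))
               refl q S P η (seq y k) u (ℓ q k) (ℓ P k) ⟩
          q * (ℓ q k - seq y k) + (2ℚ + 2ℚ * q) * η - (P - q - q * (ℓ P k - ℓ q k) + q * (ℓ P k - u + η))
            ≡⟨ cong (λ ε → q * (ℓ q k - seq y k) + ε - (P - q - q * (ℓ P k - ℓ q k) + q * (ℓ P k - u + η))) cη≡ε ⟩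
          q * (ℓ q k - seq y k) + ε - (P - q - q * (ℓ P k - ℓ q k) + q * (ℓ P k - u + η)) ∎))
        (≳0-+ (log-tangent 0<q 0<P) (≳0-*ˡ (<⇒≤ 0<q) log≥))
        where
        open Approximant a
        S u : ℚ
        S = seq (exp y) m
        u = seq y m

      -- Here the hypothesis gives P ≥ q - 2η, and η is such that P κ ≥ 2η.
      ≤exp-step : ∀ {η κ} → 0ℚ ≤ κ → 2ℚ * (1ℚ + κ) * η ≡ q * κ → Approximant y η (λ n → 0ℚ ≤ seq (exp y) n - q + η) →
                  (λ k → seq y k - ℓ q k + (κ + η)) ≳0
      ≤exp-step {η} {κ} 0≤κ ηκ a = ≳0-mono-from m
        (λ k m≤k → 0≤-diff (begin
          0ℚ
            ≤⟨ ≤-diff (abs-≤ (close k m≤k)) ⟩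
          seq y k - u - - η
            ≡⟨ solve 6 (λ y u η l p κ → y :- u :- :- η := y :- l :+ (κ :+ η) :- (p :- l :+ κ :+ (u :- p))) refl (seq y k) u η (ℓ q k) (ℓ P k) κ ⟩
          seq y k - ℓ q k + (κ + η) - (ℓ P k - ℓ q k + κ + (u - ℓ P k)) ∎))
        (≳0-+ logq≤logP+κ log≤)
        where
        open Approximant a
        S u : ℚ
        S = seq (exp y) m
        u = seq y m
        P≥ : 0ℚ ≤ P - q + 2ℚ * η
        P≥ = begin
          0ℚ                               ≤⟨ +-mono-≤ holds (≤-diff (∣p∣≤⇒≤ exp≈P)) ⟩
          S - q + η + (η - (S - P))        ≡⟨ solve 4 (λ S q η P → S :- q :+ η :+ (η :- (S :- P)) := P :- q :+ con 2ℚ :* η) refl S q η P ⟩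
          P - q + 2ℚ * η                   ∎
        Pκ≥ : 0ℚ ≤ P * κ - (q - P)
        Pκ≥ = begin
          0ℚ                                                      ≤⟨ 0≤* (+-mono-≤ 0≤1ℚ 0≤κ) P≥ ⟩
          (1ℚ + κ) * (P - q + 2ℚ * η)                             ≡⟨ solve 4 (λ κ P q η → (con 1ℚ :+ κ) :* (P :- q :+ con 2ℚ :* η)
                                                                       := P :* κ :- (q :- P) :+ (con 2ℚ :* (con 1ℚ :+ κ) :* η :- q :* κ)) refl κ P q η ⟩
          P * κ - (q - P) + (2ℚ * (1ℚ + κ) * η - q * κ)           ≡⟨ cong (λ x → P * κ - (q - P) + (x - q * κ)) ηκ ⟩
          P * κ - (q - P) + (q * κ - q * κ)                       ≡⟨ solve 2 (λ x y → x :+ (y :- y) := x) refl (P * κ - (q - P)) (q * κ) ⟩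
          P * κ - (q - P)                                         ∎
        logq≤logP+κ : (λ k → ℓ P k - ℓ q k + κ) ≳0
        logq≤logP+κ = ≳0-cancel 0<P (≳0-resp
          (λ k → solve 5 (λ P q κ p l → q :- P :- P :* (l :- p) :+ (P :* κ :- (q :- P)) := P :* (p :- l :+ κ)) refl P q κ (ℓ P k) (ℓ q k))
          (≳0-+ (log-tangent 0<P 0<q) (≳0-pointwise λ _ → Pκ≥)))

    exp≤⇒≤log : (λ k → q - seq (exp y) k) ≳0 → (λ k → ℓ q k - seq y k) ≳0
    exp≤⇒≤log exp≤q = ≳0-cancel 0<q (≳0-limit λ ε 0<ε →
      let η , 0<η , cη≡ε = rescale {ε} {2ℚ + 2ℚ * q} 0<ε (+-mono-<-≤ (positive⁻¹ 2ℚ) (0≤* 0≤2 (<⇒≤ 0<q)))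
      in exp≤-step cη≡ε (approximant y y≤0 η 0<η _ (eventually exp≤q η 0<η)))

    ≤exp⇒log≤ : (λ k → seq (exp y) k - q) ≳0 → (λ k → seq y k - ℓ q k) ≳0
    ≤exp⇒log≤ q≤exp = ≳0-limit λ ε 0<ε →
      -- `κ` is the relative excess of `q` over `P` that is tolerated, and `η` is adapted to it. The
      -- constants give κ + η ≤ κ + 2(1 + κ)η = κ + qκ = ε.
      let κ , 0<κ , cκ≡ε = rescale {ε} {1ℚ + q} 0<ε (+-mono-< 0<1 0<q)
          η , 0<η , cη≡qκ = rescale {q * κ} {2ℚ * (1ℚ + κ)} (0<* 0<q 0<κ) (0<* (positive⁻¹ 2ℚ) (+-mono-< 0<1 0<κ))
      in ≳0-mono (λ k → +-monoʳ-≤ (seq y k - ℓ q k) (begin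
           κ + η                       ≡⟨ +-identityʳ (κ + η) ⟨
           κ + η + 0ℚ                  ≤⟨ +-monoʳ-≤ (κ + η) (0≤* (+-mono-≤ 0≤1ℚ (0≤* 0≤2 (<⇒≤ 0<κ))) (<⇒≤ 0<η)) ⟩
           κ + η + (1ℚ + 2ℚ * κ) * η   ≡⟨ solve 2 (λ κ η → κ :+ η :+ (con 1ℚ :+ con 2ℚ :* κ) :* η := κ :+ con 2ℚ :* (con 1ℚ :+ κ) :* η) refl κ η ⟩
           κ + 2ℚ * (1ℚ + κ) * η       ≡⟨ cong (λ x → κ + x) cη≡qκ ⟩
           κ + q * κ                   ≡⟨ solve 2 (λ κ q → κ :+ q :* κ := (con 1ℚ :+ q) :* κ) refl κ q ⟩
           (1ℚ + q) * κ                ≡⟨ cκ≡ε ⟩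
           ε                           ∎))
         (≤exp-step (<⇒≤ 0<κ) cη≡qκ (approximant y y≤0 η 0<η _ (eventually q≤exp η 0<η)))

  -- Entropy of lists

  ∑ : List ℕ → (ℕ → ℚ) → ℚ
  ∑ []       f = 0ℚ
  ∑ (x ∷ xs) f = f x + ∑ xs f

  ∑-cong : ∀ {f g} xs → (∀ x → x ∈ xs → f x ≡ g x) → ∑ xs f ≡ ∑ xs g
  ∑-cong []       h = refl
  ∑-cong (x ∷ xs) h = cong₂ _+_ (h x (here refl)) (∑-cong xs λ y y∈ → h y (there y∈))

  ∑-+ : ∀ {f g} xs → ∑ xs (λ x → f x + g x) ≡ ∑ xs f + ∑ xs g
  ∑-+ []               = refl
  ∑-+ {f} {g} (x ∷ xs) = trans (cong (λ s → f x + g x + s) (∑-+ {f} {g} xs))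
    (solve 4 (λ a b c d → a :+ b :+ (c :+ d) := (a :+ c) :+ (b :+ d)) refl (f x) (g x) (∑ xs f) (∑ xs g))

  ∑-*ˡ : ∀ c {f} xs → c * ∑ xs f ≡ ∑ xs (λ x → c * f x)
  ∑-*ˡ c []           = *-zeroʳ c
  ∑-*ˡ c {f} (x ∷ xs) = trans (*-distribˡ-+ c (f x) (∑ xs f)) (cong (λ s → c * f x + s) (∑-*ˡ c xs))

  ∑-const : ∀ c xs → ∑ xs (λ _ → c) ≡ ι (length xs) * c
  ∑-const c []       = sym (trans (cong (_* c) ι-0) (*-zeroˡ c))
  ∑-const c (x ∷ xs) = trans (cong (λ s → c + s) (∑-const c xs))
    (trans (solve 2 (λ c i → c :+ i :* c := (con 1ℚ :+ i) :* c) refl c (ι (length xs))) (cong (_* c) (sym (ι-suc (length xs)))))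

  ∑-++ : ∀ {f} xs ys → ∑ (xs ++ ys) f ≡ ∑ xs f + ∑ ys f
  ∑-++ {f} []       ys = sym (+-identityˡ (∑ ys f))
  ∑-++ {f} (x ∷ xs) ys = trans (cong (λ s → f x + s) (∑-++ xs ys)) (sym (+-assoc (f x) (∑ xs f) (∑ ys f)))

  ∑-↭ : ∀ {f xs ys} → xs ↭ ys → ∑ xs f ≡ ∑ ys f
  ∑-↭ ↭.refl                 = refl
  ∑-↭ {f} (↭.prep x p)       = cong (λ s → f x + s) (∑-↭ p)
  ∑-↭ {f} (↭.swap {xs} {ys} x y p) = trans (cong (λ s → f x + (f y + s)) (∑-↭ p))
    (solve 3 (λ a b c → a :+ (b :+ c) := b :+ (a :+ c)) refl (f x) (f y) (∑ ys f))
  ∑-↭ (↭.trans p q)          = trans (∑-↭ p) (∑-↭ q)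

  ∑-≤0 : ∀ {f} xs → (∀ x → f x ≤ 0ℚ) → ∑ xs f ≤ 0ℚ
  ∑-≤0 []       h = ≤-refl
  ∑-≤0 (x ∷ xs) h = +-mono-≤ (h x) (∑-≤0 xs h)

  ∑-≈0 : ∀ {f : ℕ → ℕ → ℚ} xs → (∀ x → x ∈ xs → f x ≈0) → (λ k → ∑ xs (λ x → f x k)) ≈0
  ∑-≈0 []       h = ≈0-zero λ _ → refl
  ∑-≈0 (x ∷ xs) h = ≈0-+ (h x (here refl)) (∑-≈0 xs λ y y∈ → h y (there y∈))

  count : ℕ → List ℕ → ℕ
  count q xs = length (filter (q ℕ.≟_) xs)

  count-++ : ∀ q xs ys → count q (xs ++ ys) ≡ count q xs ℕ.+ count q ys
  count-++ q xs ys = trans (cong length (filter-++ (q ℕ.≟_) xs ys)) (length-++ (filter (q ℕ.≟_) xs))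

  count-↭ : ∀ q {xs ys} → xs ↭ ys → count q xs ≡ count q ys
  count-↭ q p = ↭-length (filter-↭ (q ℕ.≟_) p)

  count-All≢ : ∀ q {xs} → All (q ≢_) xs → count q xs ≡ 0
  count-All≢ q h = cong length (filter-none (q ℕ.≟_) h)

  count-All≡ : ∀ q {xs} → All (q ≡_) xs → count q xs ≡ length xs
  count-All≡ q h = cong length (filter-all (q ℕ.≟_) h)

  count>0 : ∀ q {xs} → q ∈ xs → 0 ℕ.< count q xs
  count>0 q {xs} q∈xs with filter (q ℕ.≟_) xs | ∈-filter⁺ (q ℕ.≟_) q∈xs refl
  ... | _ ∷ _ | _ = s≤s z≤n

  indicator : ℕ → ℕ → ℚ
  indicator x q with q ℕ.≟ x
  ... | yes _ = 1ℚ
  ... | no  _ = 0ℚ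

  indicator-≡ : ∀ x → indicator x x ≡ 1ℚ
  indicator-≡ x with x ℕ.≟ x
  ... | yes _   = refl
  ... | no x≢x = contradiction refl x≢x

  indicator-≢ : ∀ {x q} → q ≢ x → indicator x q ≡ 0ℚ
  indicator-≢ {x} {q} q≢x with q ℕ.≟ x
  ... | yes q≡x = contradiction q≡x q≢x
  ... | no _    = refl

  ι-count-∷ : ∀ q x xs → ι (count q (x ∷ xs)) ≡ indicator x q + ι (count q xs)
  ι-count-∷ q x xs = go (q ℕ.≟ x)
    where
    go : _ → ι (count q (x ∷ xs)) ≡ indicator x q + ι (count q xs)
    go (yes refl) = trans (cong (λ ys → ι (length ys)) (filter-accept (q ℕ.≟_) refl))
      (trans (ι-suc (count q xs)) (cong (_+ ι (count q xs)) (sym (indicator-≡ x))))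
    go (no q≢x) = trans (cong (λ ys → ι (length ys)) (filter-reject (q ℕ.≟_) q≢x))
      (trans (sym (+-identityˡ (ι (count q xs)))) (cong (_+ ι (count q xs)) (sym (indicator-≢ q≢x))))

  module _ (φ : ℕ → ℚ) where
    ∑-indicator-∉ : ∀ {x} ds → All (x ≢_) ds → ∑ ds (λ q → indicator x q * φ q) ≡ 0ℚ
    ∑-indicator-∉ []       []        = refl
    ∑-indicator-∉ (d ∷ ds) (x≢d ∷ h) = trans
      (cong₂ _+_ (trans (cong (_* φ d) (indicator-≢ (λ d≡x → x≢d (sym d≡x)))) (*-zeroˡ (φ d))) (∑-indicator-∉ ds h)) refl

    ∑-indicator : ∀ {x} ds → Unique ds → x ∈ ds → ∑ ds (λ q → indicator x q * φ q) ≡ φ x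
    ∑-indicator {x} (d ∷ ds) (d∉ds ∷ _) (here refl) = trans
      (cong₂ _+_ (trans (cong (_* φ x) (indicator-≡ x)) (*-identityˡ (φ x))) (∑-indicator-∉ ds d∉ds)) (+-identityʳ (φ x))
    ∑-indicator {x} (d ∷ ds) (d∉ds ∷ u) (there x∈ds) = trans
      (cong₂ _+_ (trans (cong (_* φ d) (indicator-≢ (All.lookup d∉ds x∈ds))) (*-zeroˡ (φ d))) (∑-indicator ds u x∈ds)) (+-identityˡ (φ x))

    -- Turns a sum over distinct primes weighted by multiplicity into an unweighted sum over all
    -- prime factors, which behaves well under `_++_` and permutation. The list `ds` is kept
    -- arbitrary and fixed because `deduplicate xs` would change along the induction on `xs`.
    ∑-count : ∀ {ds} xs → Unique ds → (∀ {x} → x ∈ xs → x ∈ ds) → ∑ ds (λ q → ι (count q xs) * φ q) ≡ ∑ xs φ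
    ∑-count {ds} [] u xs⊆ds = trans (∑-cong ds λ q _ → trans (cong (_* φ q) ι-0) (*-zeroˡ (φ q)))
      (trans (∑-const 0ℚ ds) (*-zeroʳ (ι (length ds))))
    ∑-count {ds} (x ∷ xs) u xs⊆ds = begin-equality
      ∑ ds (λ q → ι (count q (x ∷ xs)) * φ q)
        ≡⟨ ∑-cong ds (λ q _ → trans (cong (_* φ q) (ι-count-∷ q x xs)) (*-distribʳ-+ (φ q) (indicator x q) (ι (count q xs)))) ⟩
      ∑ ds (λ q → indicator x q * φ q + ι (count q xs) * φ q)
        ≡⟨ ∑-+ ds ⟩
      ∑ ds (λ q → indicator x q * φ q) + ∑ ds (λ q → ι (count q xs) * φ q)
        ≡⟨ cong₂ _+_ (∑-indicator ds u (xs⊆ds (here refl))) (∑-count xs u (λ x∈ → xs⊆ds (there x∈))) ⟩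
      φ x + ∑ xs φ ∎

    ∑-deduplicate : ∀ xs → ∑ (deduplicate ℕ._≟_ xs) (λ q → ι (count q xs) * φ q) ≡ ∑ xs φ
    ∑-deduplicate xs = ∑-count xs (deduplicate-! xs) (∈-deduplicate⁺ ℕ._≟_)

  ι*ratio : ∀ c m → ι (suc m) * ratio c (suc m) ≡ ι c
  ι*ratio c m = toℚᵘ-injective (ℚᵘₚ.≃-trans (toℚᵘ-homo-* (ι (suc m)) (+ c / suc m))
    (ℚᵘₚ.≃-trans (ℚᵘₚ.*-cong (ι≃ (suc m)) (to-/ (+ c) (suc m)))
      (ℚᵘₚ.≃-trans (ℚᵘ.*≡* (trans (ℤₚ.*-identityʳ _) (trans (ℤₚ.*-comm (+ suc m) (+ c))
          (cong (λ k → + c ℤ.* + suc k) (sym (ℕₚ.+-identityʳ m))))))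
        (ℚᵘₚ.≃-sym (ι≃ c)))))
    where
    ι≃ : ∀ n → toℚᵘ (ι n) ℚᵘ.≃ (+ n ℚᵘ./ 1)
    ι≃ n = subst (λ q → toℚᵘ q ℚᵘ.≃ (+ n ℚᵘ./ 1)) (sym (ι≡ n)) (to-/ (+ n) 1)

  -- True at every index and not only in the limit, since each artanh term at a nonpositive argument
  -- is nonpositive. The power approximation is applied to single terms of -H(n), which must be
  -- nonpositive themselves.
  ℓ≤0 : ∀ {q} → q ≤ 1ℚ → ∀ k → ℓ q k ≤ 0ℚ
  ℓ≤0 {q} q≤1 k = subst (_≤ 0ℚ) (sym (ℓ≡log q k)) (go (0ℚ <? q))
    where
    artanhTerm≤0 : ∀ {z} → z ≤ 0ℚ → ∀ j → artanhTerm z j ≤ 0ℚ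
    artanhTerm≤0 {z} z≤0 j = begin
      z * z ^ (2 ℕ.* j) * r    ≡⟨ cong (λ p → z * p * r) (pow-double z j) ⟩
      z * (z * z) ^ j * r      ≡⟨ *-assoc z ((z * z) ^ j) r ⟩
      z * ((z * z) ^ j * r)    ≤⟨ *-monoʳ (0≤* (0≤^ j (0≤-square z)) (0≤1/ (suc (2 ℕ.* j)))) z≤0 ⟩
      0ℚ * ((z * z) ^ j * r)   ≡⟨ *-zeroˡ ((z * z) ^ j * r) ⟩
      0ℚ                       ∎
      where r = + 1 / suc (2 ℕ.* j)
    artanhSum≤0 : ∀ {z} → z ≤ 0ℚ → ∀ k → artanhSum z k ≤ 0ℚ
    artanhSum≤0 z≤0 zero    = ≤-refl
    artanhSum≤0 z≤0 (suc k) = +-mono-≤ (artanhSum≤0 z≤0 k) (artanhTerm≤0 z≤0 k)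
    go : _ → seq (log q) k ≤ 0ℚ
    go (yes 0<q) = subst (_≤ 0ℚ) (sym (log≡artanhSum q 0<q k))
      (≤-trans (*-monoˡ 0≤2 (artanhSum≤0 (cayley≤0 q 0<q q≤1) k)) (≤-reflexive (*-zeroʳ 2ℚ)))
    go (no 0≮q) with 0ℚ <? q
    ... | yes 0<q = contradiction 0<q 0≮q
    ... | no _    = ≤-refl

  seq-sumᴿ : ∀ (f : ℕ → ℝ) xs k → seq (sumᴿ (map f xs)) k ≡ ∑ xs (λ q → seq (f q) k)
  seq-sumᴿ f []       k = refl
  seq-sumᴿ f (x ∷ xs) k = cong (λ s → seq (f x) k + s) (seq-sumᴿ f xs k)

  entropySeq : List ℕ → ℕ → ℚ
  entropySeq xs k = - ∑ (deduplicate ℕ._≟_ xs) (λ q → ratio (count q xs) (length xs) * ℓ (ratio (count q xs) (length xs)) k)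

  seq-H : ∀ N k → seq (H N) k ≡ entropySeq (primeFactors N) k
  seq-H N k = cong -_ (trans (seq-sumᴿ (entropyTerm N) (deduplicate ℕ._≟_ (primeFactors N)) k)
    (∑-cong (deduplicate ℕ._≟_ (primeFactors N)) λ q _ → cong (f q *_) (sym (ℓ≡log (f q) k))))
    where
    f : ℕ → ℚ
    f q = ratio (count q (primeFactors N)) (length (primeFactors N))

  -- This is S = ∑ aᵢ L(aᵢ): repetition in `xs` supplies the weights aᵢ.
  logCounts : List ℕ → ℕ → ℚ
  logCounts xs k = ∑ xs (λ q → ℓ (ι (count q xs)) k)

  module _ (xs : List ℕ) where
    private
      M : ℕ
      M = length xs
      f : ℕ → ℚ
      f q = ratio (count q xs) M

      M*f : ∀ q → 0 ℕ.< M → ι M * f q ≡ ι (count q xs)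
      M*f q 0<M = go M 0<M
        where
        go : ∀ m → 0 ℕ.< m → ι m * ratio (count q xs) m ≡ ι (count q xs)
        go (suc m) _ = ι*ratio (count q xs) m

    M*entropySeq : 0 ℕ.< M → ∀ k → ι M * entropySeq xs k ≡ - ∑ xs (λ q → ℓ (f q) k)
    M*entropySeq 0<M k = begin-equality
      ι M * - ∑ ds (λ q → f q * ℓ (f q) k)      ≡⟨ neg-distribʳ-* (ι M) _ ⟨
      - (ι M * ∑ ds (λ q → f q * ℓ (f q) k))    ≡⟨ cong -_ (∑-*ˡ (ι M) ds) ⟩
      - ∑ ds (λ q → ι M * (f q * ℓ (f q) k))    ≡⟨ cong -_ (∑-cong ds λ q _ → trans (sym (*-assoc (ι M) (f q) (ℓ (f q) k))) (cong (_* ℓ (f q) k) (M*f q 0<M))) ⟩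
      - ∑ ds (λ q → ι (count q xs) * ℓ (f q) k) ≡⟨ cong -_ (∑-deduplicate (λ q → ℓ (f q) k) xs) ⟩
      - ∑ xs (λ q → ℓ (f q) k)                  ∎
      where ds = deduplicate ℕ._≟_ xs

    -- The sum over all prime factors of `log-*` for the product of `ι M` and the frequency of `q`,
    -- which is the multiplicity of `q`.
    entropySeq-≈ : 0 ℕ.< M → (λ k → ι M * entropySeq xs k - (ι M * ℓ (ι M) k - logCounts xs k)) ≈0
    entropySeq-≈ 0<M = ≈0-resp
      (λ k → begin-equality
        ∑ xs (λ q → ℓ (ι M * f q) k - ℓ (ι M) k - ℓ (f q) k)
          ≡⟨ ∑-cong xs (λ q _ → trans (cong (λ x → ℓ x k - ℓ (ι M) k - ℓ (f q) k) (M*f q 0<M))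
               (solve 3 (λ a b c → a :- b :- c := a :+ (:- con 1ℚ :* b :+ :- con 1ℚ :* c)) refl (ℓ (ι (count q xs)) k) (ℓ (ι M) k) (ℓ (f q) k))) ⟩
        ∑ xs (λ q → ℓ (ι (count q xs)) k + (- 1ℚ * ℓ (ι M) k + - 1ℚ * ℓ (f q) k))
          ≡⟨ trans (∑-+ xs) (cong (λ s → logCounts xs k + s) (trans (∑-+ xs) (cong₂ _+_ (∑-const (- 1ℚ * ℓ (ι M) k) xs) (sym (∑-*ˡ (- 1ℚ) xs))))) ⟩
        logCounts xs k + (ι M * (- 1ℚ * ℓ (ι M) k) + - 1ℚ * F k)
          ≡⟨ solve 4 (λ S M l F → S :+ (M :* (:- con 1ℚ :* l) :+ :- con 1ℚ :* F) := :- F :- (M :* l :- S)) refl (logCounts xs k) (ι M) (ℓ (ι M) k) (F k) ⟩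
        - F k - (ι M * ℓ (ι M) k - logCounts xs k)
          ≡⟨ cong (λ h → h - (ι M * ℓ (ι M) k - logCounts xs k)) (M*entropySeq 0<M k) ⟨
        ι M * entropySeq xs k - (ι M * ℓ (ι M) k - logCounts xs k) ∎)
      (∑-≈0 xs λ q q∈xs → log-* (0<ι 0<M) (0<f q q∈xs))
      where
      F : ℕ → ℚ
      F k = ∑ xs (λ q → ℓ (f q) k)
      0<f : ∀ q → q ∈ xs → 0ℚ < f q
      0<f q q∈xs = *-cancelˡ-<-nonNeg (ι M) {{nonNegative (0≤ι M)}} (begin-strict
        ι M * 0ℚ         ≡⟨ *-zeroʳ (ι M) ⟩
        0ℚ               <⟨ 0<ι (count>0 q q∈xs) ⟩
        ι (count q xs)   ≡⟨ M*f q 0<M ⟨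
        ι M * f q        ∎)

    -entropySeq≤0 : 0 ℕ.< M → ∀ k → - entropySeq xs k ≤ 0ℚ
    -entropySeq≤0 0<M k = ≤-trans (≤-reflexive (solve 1 (λ x → :- :- x := x) refl _))
      (∑-≤0 (deduplicate ℕ._≟_ xs) λ q → ≤-trans (*-monoˡ (0≤f q) (ℓ≤0 (f≤1 q) k)) (≤-reflexive (*-zeroʳ (f q))))
      where
      0≤f : ∀ q → 0ℚ ≤ f q
      0≤f q = *-cancelˡ-≤-pos (ι M) {{positive (0<ι 0<M)}} (begin
        ι M * 0ℚ         ≡⟨ *-zeroʳ (ι M) ⟩
        0ℚ               ≤⟨ 0≤ι (count q xs) ⟩
        ι (count q xs)   ≡⟨ M*f q 0<M ⟨
        ι M * f q        ∎)
      f≤1 : ∀ q → f q ≤ 1ℚ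
      f≤1 q = *-cancelˡ-≤-pos (ι M) {{positive (0<ι 0<M)}} (begin
        ι M * f q        ≡⟨ M*f q 0<M ⟩
        ι (count q xs)   ≤⟨ ι-mono (length-filter (q ℕ.≟_) xs) ⟩
        ι M              ≡⟨ *-identityʳ (ι M) ⟨
        ι M * 1ℚ         ∎)

  -- Comparing entropies

  -- Here gibbs compares the two-point distributions of weights (w, x) and (w, y).
  module _ {w x y : ℚ} (0<w : 0ℚ < w) (0<x : 0ℚ < x) (0<y : 0ℚ < y) {g h S : ℕ → ℚ}
    (g-eq : (λ k → (w + x) * g k - ((w + x) * ℓ (w + x) k - (S k + x * ℓ x k))) ≈0)
    (h-eq : (λ k → (w + y) * h k - ((w + y) * ℓ (w + y) k - (S k + y * ℓ y k))) ≈0)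
    where
    private
      0<w+x : 0ℚ < w + x
      0<w+x = +-mono-< 0<w 0<x
      0<w+y : 0ℚ < w + y
      0<w+y = +-mono-< 0<w 0<y
      s t : ℚ
      s = y * (w + x)
      t = x * (w + y)

      gibbs : (λ k → x * (ℓ x k - ℓ y k) - (w + x) * (ℓ (w + x) k - ℓ (w + y) k)) ≳0
      gibbs = ≳0-cancel 0<w+y (≳0-resp
        (λ k → solve 9 (λ w x y a b c d e f →
            y :* (w :+ x) :- x :* (w :+ y) :- x :* (w :+ y) :* (e :- f)
              :+ w :* (w :+ x :- (w :+ y) :- (w :+ y) :* (c :- d))
              :+ (x :* (w :+ y) :* (e :- b :- c) :+ :- (x :* (w :+ y)) :* (f :- a :- d))
            := (w :+ y) :* (x :* (a :- b) :- (w :+ x) :* (c :- d)))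
          refl w x y (ℓ x k) (ℓ y k) (ℓ (w + x) k) (ℓ (w + y) k) (ℓ s k) (ℓ t k))
        -- The inequality log r ≤ r - 1 is used for both likelihood ratios, r = y(w + x)/(x(w + y))
        -- with weight x and r = (w + x)/(w + y) with weight w. After clearing denominators the
        -- linear parts w(y - x) and w(x - y) cancel.
        (≳0-+ (≳0-+ (log-tangent (0<* 0<x 0<w+y) (0<* 0<y 0<w+x))
                    (≳0-*ˡ (<⇒≤ 0<w) (log-tangent 0<w+y 0<w+x)))
              (≈0⇒≳0 (≈0-+ (≈0-*ˡ (x * (w + y)) (log-* 0<y 0<w+x)) (≈0-*ˡ (- (x * (w + y))) (log-* 0<x 0<w+y))))))

    -- The primes of `n` keep their relative proportions when the exponent of `p` changes, so two
    -- blocks of weights `w` and `x` or `y` suffice for Gibbs' inequality, and the distribution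
    -- inside the first block enters through `S` alone.
    entropy-compare : (λ k → (x - y) * (w * ℓ y k - S k)) ≳0 → (λ k → h k - g k) ≳0
    entropy-compare sgn = ≳0-cancel (0<* 0<w+x 0<w+y) (≳0-resp
      (λ k → solve 10 (λ w x y g h S a b c d →
          (w :+ y) :* (x :* (a :- b) :- (w :+ x) :* (c :- d)) :+ (x :- y) :* (w :* b :- S)
            :+ ((w :+ x) :* ((w :+ y) :* h :- ((w :+ y) :* d :- (S :+ y :* b)))
                :+ :- (w :+ y) :* ((w :+ x) :* g :- ((w :+ x) :* c :- (S :+ x :* a))))
          := (w :+ x) :* (w :+ y) :* (h :- g))
        refl w x y (g k) (h k) (S k) (ℓ x k) (ℓ y k) (ℓ (w + x) k) (ℓ (w + y) k))
      (≳0-+ (≳0-+ (≳0-*ˡ (<⇒≤ 0<w+y) gibbs) sgn)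
            (≈0⇒≳0 (≈0-+ (≈0-*ˡ (w + x) h-eq) (≈0-*ˡ (- (w + y)) g-eq)))))

  -- The condition on W exp(-h) as the sign of W L(b) - S

  module _ (W : ℕ) (0<W : 0 ℕ.< W) (y : ℝ) (y≤0 : ∀ k → seq y k ≤ 0ℚ) {S : ℕ → ℚ}
    (S-eq : (λ k → ι W * seq y k + (ι W * ℓ (ι W) k - S k)) ≈0)
    (b : ℕ) (0<b : 0 ℕ.< b) where
    private
      instance
        W≢0 : NonZero W
        W≢0 = ℕ.>-nonZero 0<W
      r q : ℚ
      r = + 1 / W
      q = r * ι b
      0<ιW : 0ℚ < ι W
      0<ιW = 0<ι 0<W
      Wq : ι W * q ≡ ι b
      Wq = trans (sym (*-assoc (ι W) r (ι b))) (trans (cong (_* ι b) (ι-/ W)) (*-identityˡ (ι b)))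
      0<q : 0ℚ < q
      0<q = *-cancelˡ-<-nonNeg (ι W) {{nonNegative (0≤ι W)}} (begin-strict
        ι W * 0ℚ  ≡⟨ *-zeroʳ (ι W) ⟩
        0ℚ        <⟨ 0<ι 0<b ⟩
        ι b       ≡⟨ Wq ⟨
        ι W * q   ∎)
      rW : ∀ e → r * (ι W * e) ≡ e
      rW e = trans (sym (*-assoc r (ι W) e)) (trans (cong (_* e) (trans (*-comm r (ι W)) (ι-/ W))) (*-identityˡ e))
      log-q : (λ k → ℓ (ι b) k - ℓ (ι W) k - ℓ q k) ≈0
      log-q = ≈0-resp (λ k → cong (λ x → ℓ x k - ℓ (ι W) k - ℓ q k) Wq) (log-* 0<ιW 0<q)
      unfold : ∀ k → ι W * (ℓ q k - seq y k) + (ι W * (ℓ (ι b) k - ℓ (ι W) k - ℓ q k) + (ι W * seq y k + (ι W * ℓ (ι W) k - S k)))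
                     ≡ ι W * ℓ (ι b) k - S k
      unfold k = solve 6 (λ W q y b w S → W :* (q :- y) :+ (W :* (b :- w :- q) :+ (W :* y :+ (W :* w :- S))) := W :* b :- S)
        refl (ι W) (ℓ q k) (seq y k) (ℓ (ι b) k) (ℓ (ι W) k) (S k)

    -- The transfer from exp to log compares a rational with `exp y` itself, so the hypothesis is
    -- first divided by W, giving `q` = b/W. By `S-eq`, W (L(q) - y) agrees with W L(b) - S up to a
    -- null sequence.
    log-above : (λ k → ι b - ι W * seq (exp y) k) ≳0 → (λ k → ι W * ℓ (ι b) k - S k) ≳0
    log-above hyp = ≳0-resp unfold
      (≳0-+ (≳0-*ˡ (0≤ι W) (exp≤⇒≤log y y≤0 0<q
          (≳0-resp (λ k → trans (solve 3 (λ r b e → r :* (b :- e) := r :* b :- r :* e) refl r (ι b) (ι W * seq (exp y) k))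
                                (cong (λ e → q - e) (rW (seq (exp y) k))))
            (≳0-*ˡ (0≤1/ W) hyp))))
        (≈0⇒≳0 (≈0-+ (≈0-*ˡ (ι W) log-q) S-eq)))

    log-below : (λ k → ι W * seq (exp y) k - ι b) ≳0 → (λ k → S k - ι W * ℓ (ι b) k) ≳0
    log-below hyp = ≳0-resp
      (λ k → trans (solve 4 (λ W q y z → W :* (y :- q) :+ :- z := :- (W :* (q :- y) :+ z)) refl (ι W) (ℓ q k) (seq y k) _)
               (trans (cong -_ (unfold k)) (solve 2 (λ a b → :- (a :- b) := b :- a) refl (ι W * ℓ (ι b) k) (S k))))
      (≳0-+ (≳0-*ˡ (0≤ι W) (≤exp⇒log≤ y y≤0 0<q
          (≳0-resp (λ k → trans (solve 3 (λ r b e → r :* (e :- b) := r :* e :- r :* b) refl r (ι b) (ι W * seq (exp y) k))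
                                (cong (λ e → e - q) (rW (seq (exp y) k))))
            (≳0-*ˡ (0≤1/ W) hyp))))
        (-≈0⇒≳0 (≈0-+ (≈0-*ˡ (ι W) log-q) S-eq)))

  -- Prime factors of n pˣ and the conclusion

  primeFactorisation : ∀ n .{{_ : NonZero n}} → PrimeFactorisation n
  primeFactorisation n@(suc _) = factorise n

  primeFactors≡factors : ∀ n .{{_ : NonZero n}} → primeFactors n ≡ PrimeFactorisation.factors (primeFactorisation n)
  primeFactors≡factors (suc _) = refl

  product-replicate : ∀ n p → product (replicate n p) ≡ p ℕ.^ n
  product-replicate zero    p = refl
  product-replicate (suc n) p = cong (p ℕ.*_) (product-replicate n p)

  module _ {n p : ℕ} (n≥2 : n ℕ.≥ 2) (prime-p : Prime p) (coprime : gcd n p ≡ 1) where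
    private
      instance
        n≢0 : NonZero n
        n≢0 = ℕ.>-nonZero (ℕₚ.≤-trans (s≤s z≤n) n≥2)
        p≢0 : NonZero p
        p≢0 = prime⇒nonZero prime-p
      F : PrimeFactorisation n
      F = primeFactorisation n
      xs : List ℕ
      xs = primeFactors n
      W : ℕ
      W = Ω n
      n≡product : n ≡ product xs
      n≡product = trans (PrimeFactorisation.isFactorisation F) (cong product (sym (primeFactors≡factors n)))
      S : ℕ → ℚ
      S = logCounts xs

      0<W : 0 ℕ.< W
      0<W = go xs n≡product
        where
        go : ∀ ys → n ≡ product ys → 0 ℕ.< length ys
        go []      n≡1 = contradiction (subst (2 ℕ.≤_) n≡1 n≥2) λ { (s≤s ()) }
        go (_ ∷ _) _   = s≤s z≤n

      p∉xs : ∀ q → q ∈ xs → q ≢ p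
      p∉xs q q∈xs refl = ¬prime[1] (subst Prime (∣1⇒≡1 p∣1) prime-p)
        where
        p∣1 : p ∣ 1
        p∣1 = subst (p ∣_) coprime (gcd-greatest (subst (p ∣_) (sym n≡product) (∈⇒∣product q∈xs)) ∣-refl)

      module _ (x : ℕ) where
        N : ℕ
        N = n ℕ.* p ℕ.^ x
        ys : List ℕ
        ys = xs ++ replicate x p

        instance
          p^x≢0 : NonZero (p ℕ.^ x)
          p^x≢0 = ℕₚ.m^n≢0 p x
          N≢0 : NonZero N
          N≢0 = ℕₚ.m*n≢0 n (p ℕ.^ x)

        -- The position of the copies of `p` among the factors of `N` is left open: uniqueness of
        -- factorisation gives a permutation, under which lengths, counts and sums are invariant.
        factors-↭ : primeFactors N ↭ ys
        factors-↭ = subst (_↭ ys) (sym (primeFactors≡factors N)) (factorisationUnique (primeFactorisation N) record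
          { factors = ys
          ; isFactorisation = sym (trans (product-++ xs (replicate x p)) (cong₂ ℕ._*_ (sym n≡product) (product-replicate x p)))
          ; factorsPrime = ++⁺ (subst (All Prime) (sym (primeFactors≡factors n)) (PrimeFactorisation.factorsPrime F)) (replicate⁺ x prime-p)
          })

        length-N : length (primeFactors N) ≡ W ℕ.+ x
        length-N = trans (↭-length factors-↭) (trans (length-++ xs) (cong (W ℕ.+_) (length-replicate x)))

        count-xs : ∀ q → q ∈ xs → count q ys ≡ count q xs
        count-xs q q∈xs = trans (count-++ q xs (replicate x p))
          (trans (cong (count q xs ℕ.+_) (count-All≢ q (replicate⁺ x (p∉xs q q∈xs)))) (ℕₚ.+-identityʳ (count q xs)))

        count-p : count p ys ≡ x
        count-p = trans (count-++ p xs (replicate x p))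
          (cong₂ ℕ._+_ (count-All≢ p (All.tabulate λ {q} q∈xs p≡q → p∉xs q q∈xs (sym p≡q)))
                       (trans (count-All≡ p (replicate⁺ x refl)) (length-replicate x)))

        ∑-replicate : ∀ f m → ∑ (replicate m p) f ≡ ι m * f p
        ∑-replicate f zero    = sym (trans (cong (_* f p) ι-0) (*-zeroˡ (f p)))
        ∑-replicate f (suc m) = trans (cong (λ s → f p + s) (∑-replicate f m))
          (trans (solve 2 (λ a i → a :+ i :* a := (con 1ℚ :+ i) :* a) refl (f p) (ι m)) (cong (_* f p) (sym (ι-suc m))))

        -- As `p` is not among the factors of `n`, the counts in the two blocks do not interfere,
        -- and the copies of `p` contribute the single extra term x L(x).
        logCounts-N : ∀ k → logCounts (primeFactors N) k ≡ S k + ι x * ℓ (ι x) k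
        logCounts-N k = begin-equality
          ∑ (primeFactors N) (λ q → ℓ (ι (count q (primeFactors N))) k)
            ≡⟨ ∑-cong (primeFactors N) (λ q _ → cong (λ c → ℓ (ι c) k) (count-↭ q factors-↭)) ⟩
          ∑ (primeFactors N) c
            ≡⟨ ∑-↭ factors-↭ ⟩
          ∑ ys c
            ≡⟨ ∑-++ xs (replicate x p) ⟩
          ∑ xs c + ∑ (replicate x p) c
            ≡⟨ cong₂ _+_ (∑-cong xs λ q q∈xs → cong (λ c → ℓ (ι c) k) (count-xs q q∈xs))
                         (trans (∑-replicate c x) (cong (λ j → ι x * ℓ (ι j) k) count-p)) ⟩
          S k + ι x * ℓ (ι x) k ∎
          where
          c : ℕ → ℚ
          c q = ℓ (ι (count q ys)) k

        H-N : (λ k → (ι W + ι x) * seq (H N) k - ((ι W + ι x) * ℓ (ι W + ι x) k - (S k + ι x * ℓ (ι x) k))) ≈0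
        H-N = ≈0-resp
          (λ k → trans
            (cong₂ (λ L h → L * h - (L * ℓ L k - logCounts (primeFactors N) k))
              (trans (cong ι length-N) (ι-+ W x)) (sym (seq-H N k)))
            (cong (λ s → (ι W + ι x) * seq (H N) k - ((ι W + ι x) * ℓ (ι W + ι x) k - s)) (logCounts-N k)))
          (entropySeq-≈ (primeFactors N) (subst (0 ℕ.<_) (sym length-N) (ℕₚ.≤-trans 0<W (ℕₚ.m≤m+n W x))))

      compare : ∀ x y → 1 ℕ.≤ x → 1 ℕ.≤ y → (λ k → (ι x - ι y) * (ι W * ℓ (ι y) k - S k)) ≳0 →
                H (n ℕ.* p ℕ.^ x) ≤ᴿ H (n ℕ.* p ℕ.^ y)
      compare x y 1≤x 1≤y sgn ε 0<ε =
        let K , bound = eventually (entropy-compare (0<ι 0<W) (0<ι 1≤x) (0<ι 1≤y) (H-N x) (H-N y) sgn) ε 0<ε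
        in K , λ k K≤k → 0≤-diff (subst (0ℚ ≤_)
          (solve 3 (λ a b e → b :- a :+ e := b :+ e :- a) refl (seq (H (n ℕ.* p ℕ.^ x)) k) (seq (H (n ℕ.* p ℕ.^ y)) k) ε)
          (bound k K≤k))

      -H≤0 : ∀ k → seq (-ᴿ H n) k ≤ 0ℚ
      -H≤0 k = subst (λ h → - h ≤ 0ℚ) (sym (seq-H n k)) (-entropySeq≤0 xs 0<W k)

      S-eq : (λ k → ι W * seq (-ᴿ H n) k + (ι W * ℓ (ι W) k - S k)) ≈0
      S-eq = ≈0-resp
        (λ k → trans (solve 3 (λ W h c → :- con 1ℚ :* (W :* h :- c) := W :* :- h :+ c) refl (ι W) (entropySeq xs k) (ι W * ℓ (ι W) k - S k))
          (cong (λ h → ι W * - h + (ι W * ℓ (ι W) k - S k)) (sym (seq-H n k))))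
        (≈0-*ˡ (- 1ℚ) (entropySeq-≈ xs 0<W))

    -- The reference exponent `y` of the comparison is the one nearer to the threshold, here `β`;
    -- both factors of (α - β)(W L(β) - S) are then nonnegative.
    H-antitone : ∀ {α β} → β ℕ.≥ 1 → α ℕ.≥ β → fromℕ β ≥ᴿ fromℕ (Ω n) *ᴿ exp (-ᴿ H n) →
                 H (n ℕ.* p ℕ.^ α) ≤ᴿ H (n ℕ.* p ℕ.^ β)
    H-antitone {α} {β} β≥1 α≥β hyp = compare α β (ℕₚ.≤-trans β≥1 α≥β) β≥1
      (≳0-*ˡ (≤-diff (ι-mono α≥β)) (log-above W 0<W (-ᴿ H n) -H≤0 S-eq β β≥1
        (mk≳0 λ ε 0<ε → let K , bound = hyp ε 0<ε in K , λ k K≤k →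
          subst (0ℚ ≤_) (trans (solve 3 (λ b e x → b :+ e :- x := b :- x :+ e) refl (+ β / 1) ε (+ W / 1 * seq (exp (-ᴿ H n)) k))
                               (cong₂ (λ b w → b - w * seq (exp (-ᴿ H n)) k + ε) (sym (ι≡ β)) (sym (ι≡ W))))
            (≤-diff (bound k K≤k)))))

    -- Below the threshold the nearer exponent is `α`, so the roles are exchanged and (β - α)(W L(α)
    -- - S) is a product of two nonpositive factors.
    H-monotone : ∀ {α β} → β ℕ.≥ 1 → β ℕ.≤ α → fromℕ α ≤ᴿ fromℕ (Ω n) *ᴿ exp (-ᴿ H n) →
                 H (n ℕ.* p ℕ.^ α) ≥ᴿ H (n ℕ.* p ℕ.^ β)
    H-monotone {α} {β} β≥1 β≤α hyp = compare β α β≥1 α≥1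
      (≳0-resp (λ k → solve 4 (λ a b l S → (a :- b) :* (S :- l) := (b :- a) :* (l :- S)) refl (ι α) (ι β) (ι W * ℓ (ι α) k) (S k))
        (≳0-*ˡ (≤-diff (ι-mono β≤α)) (log-below W 0<W (-ᴿ H n) -H≤0 S-eq α α≥1
          (mk≳0 λ ε 0<ε → let K , bound = hyp ε 0<ε in K , λ k K≤k →
            subst (0ℚ ≤_) (trans (solve 3 (λ b e x → x :+ e :- b := x :- b :+ e) refl (+ α / 1) ε (+ W / 1 * seq (exp (-ᴿ H n)) k))
                                 (cong₂ (λ b w → w * seq (exp (-ᴿ H n)) k - b + ε) (sym (ι≡ α)) (sym (ι≡ W))))
              (≤-diff (bound k K≤k))))))
      where
      α≥1 : α ℕ.≥ 1
      α≥1 = ℕₚ.≤-trans β≥1 β≤α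

open import Data.Nat using (ℕ; _*_; _^_; _≤_; _≥_)
open import Data.Nat.GCD using (gcd)
open import Data.Nat.Primality using (Prime)
open import Data.Product using (_×_; _,_)
open import Relation.Binary.PropositionalEquality using (_≡_)
open EntropyComparison using (H-antitone; H-monotone)

proposition4p1 : (α β : ℕ) → α ≥ 1 → β ≥ 1 →
    (p : ℕ) → Prime p →
    (n : ℕ) → n ≥ 2 → gcd n p ≡ 1 →
    (α ≥ β → fromℕ β ≥ᴿ fromℕ (Ω n) *ᴿ exp (-ᴿ H n) →
    H (n * p ^ α) ≤ᴿ H (n * p ^ β))
    × (β ≤ α → fromℕ α ≤ᴿ fromℕ (Ω n) *ᴿ exp (-ᴿ H n) →
    H (n * p ^ α) ≥ᴿ H (n * p ^ β))
proposition4p1 α β α≥1 β≥1 p prime-p n n≥2 coprime =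
  H-antitone n≥2 prime-p coprime β≥1 , H-monotone n≥2 prime-p coprime β≥1
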